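{- Let $p$ be a prime and let $\overline{\mathbb{F}}_p$ be an algebraic closure of $\mathbb{F}_p$. If $f\in\overline{\mathbb{F}}_p[x^p]$ (that is, $f$ is a polynomial in $x^p$ with coefficients in $\overline{\mathbb{F}}_p$) and $\deg f\geq 2$, then $\zeta_f(\overline{\mathbb{F}}_p;t)\in\mathbb{Q}(t)$. In particular, if $m\geq 2$ is an integer with $p\mid m$, then $\zeta_{x^m}(\overline{\mathbb{F}}_p;t)\in\mathbb{Q}(t)$. If $m\geq 2$ is an integer with $p\nmid m$, then $\zeta_{x^m}(\overline{\mathbb{F}}_p;t)$ is transcendental over $\mathbb{Q}(t)$.
   Context: For a polynomial $f\in\overline{\mathbb{F}}_p[x]$ of degree $d\geq 2$, regard $f$ as a self-map of $\mathbb{A}^1(\overline{\mathbb{F}}_p)=\overline{\mathbb{F}}_p$. Write $f^n$ for $f$ composed with itself $n$ times, and let $a_n=\#\{x\in\overline{\mathbb{F}}_p : f^n(x)=x\}$, the number of fixed points of $f^n$, counted without multiplicity (this is finite, with $a_n\leq d^n$). The Artin-Mazur zeta function of $f$ is the formal power series $$\zeta_f(\overline{\mathbb{F}}_p;t)=\exp\left(\sum_{n=1}^\infty a_n\frac{t^n}{n}\right)\in\mathbb{Q}[[t]].$$ Here $\zeta_{x^m}$ denotes the zeta function of the map $x\mapsto x^m$. Rationality (membership in $\mathbb{Q}(t)$) and transcendence over $\mathbb{Q}(t)$ are understood inside the field of formal Laurent series $\mathbb{Q}((t))$, which contains both $\mathbb{Q}(t)$ and $\mathbb{Q}[[t]]$.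 -}

module Defs where

open import Algebra.Bundles using (RawRing; CommutativeRing)
open import Algebra.Morphism.Structures using (module RingMorphisms)
import Algebra.Definitions.RawMonoid as RawMonoidDefinitions
import Algebra.Properties.CommutativeSemigroup as CommutativeSemigroupProperties
import Algebra.Properties.Ring as RingProperties
open import Data.Fin.Base using (toℕ)
open import Data.Integer.Base as ℤ using (ℤ; +_; -[1+_])
open import Data.Integer.Divisibility as ℤ∣ using ()
open import Data.List.Base using (List; []; _∷_; _++_; length; map; replicate)
import Data.List.Membership.Setoid as Membership
open import Data.List.Properties using (length-map)
open import Data.List.Relation.Unary.All as All using (All)
open import Data.List.Relation.Unary.Any using (Any; here; there)
open import Data.List.Relation.Unary.AllPairs using ([]; _∷_)
import Data.List.Relation.Unary.Unique.Setoid as Unique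
open import Data.Nat.Base as ℕ using (ℕ; zero; suc; z≤n; s≤s; _!)
open import Data.Nat.GeneralisedArithmetic using (fold)
import Data.Nat.Properties as ℕ
open import Data.Product.Base using (_×_; _,_; ∃-syntax)
open import Data.Rational.Base as ℚ using (ℚ; 0ℚ)
open import Function.Base using (_∘_)
open import Function.Bundles using (_⇔_; mk⇔; Equivalence)
open import Level using (Level; _⊔_; 0ℓ) renaming (suc to lsuc)
open import Relation.Binary.Bundles using (Setoid)
open import Relation.Binary.Definitions using (Decidable)
open import Relation.Binary.PropositionalEquality.Core as ≡ using (_≡_)
import Relation.Binary.Reasoning.Setoid as SetoidReasoning
open import Relation.Nullary using (¬_; Dec; yes; no; contradiction)
open import Relation.Unary using (Pred)

private
  variable
    a b c ℓ : Level

-- Coefficients are listed in order of increasing degree. Trailing zeros are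
-- allowed, so equality of polynomials is _≈ₚ_ and not equality of lists.

module Polynomial (R : RawRing c ℓ) where
  open RawRing R

  Poly : Set c
  Poly = List Carrier

  coeff : Poly → ℕ → Carrier
  coeff []      _       = 0#
  coeff (x ∷ _) zero    = x
  coeff (_ ∷ f) (suc n) = coeff f n

  infix 4 _≈ₚ_
  _≈ₚ_ : Poly → Poly → Set ℓ
  f ≈ₚ g = ∀ n → coeff f n ≈ coeff g n

  Nonzero : Poly → Set (c ⊔ ℓ)
  Nonzero = Any (λ x → ¬ (x ≈ 0#))

  HasDegree : Poly → ℕ → Set ℓ
  HasDegree f d = ¬ (coeff f d ≈ 0#) × (∀ n → d ℕ.< n → coeff f n ≈ 0#)

  DegreeAtLeast : ℕ → Poly → Set ℓ
  DegreeAtLeast k f = ∃[ d ] HasDegree f d × k ℕ.≤ d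

  eval : Poly → Carrier → Carrier
  eval []      _ = 0#
  eval (a ∷ f) x = a + x * eval f x

  infixl 6 _+ₚ_
  _+ₚ_ : Poly → Poly → Poly
  []          +ₚ g       = g
  f@(_ ∷ _)   +ₚ []      = f
  (a ∷ f)     +ₚ (b ∷ g) = a + b ∷ f +ₚ g

  infixl 7 _*ₚ_
  _*ₚ_ : Poly → Poly → Poly
  []      *ₚ g = []
  (a ∷ f) *ₚ g = map (a *_) g +ₚ (0# ∷ f *ₚ g)

  infixr 9 _∘ₚ_
  _∘ₚ_ : Poly → Poly → Poly
  []      ∘ₚ g = []
  (a ∷ f) ∘ₚ g = (a ∷ []) +ₚ (f ∘ₚ g) *ₚ g

  X^_ : ℕ → Poly
  X^ m = replicate m 0# ++ 1# ∷ []

  -- f ∈ R[x^k]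
  IsPolyIn-X^ : ℕ → Poly → Set (c ⊔ ℓ)
  IsPolyIn-X^ k f = ∃[ g ] f ≈ₚ g ∘ₚ (X^ k)

-- S is the subring of scalars.
AlgebraicOver : (R : RawRing c ℓ) → Pred (RawRing.Carrier R) a →
                Pred (RawRing.Carrier R) (c ⊔ ℓ ⊔ a)
AlgebraicOver R S x = ∃[ G ] All S G × Nonzero G × eval G x ≈ 0#
  where
  open RawRing R
  open Polynomial R

-- Equality is decidable, as it is in the algebraic closure of a finite
-- field; classically this is no restriction.

record Field c ℓ : Set (lsuc (c ⊔ ℓ)) where
  field
    commutativeRing : CommutativeRing c ℓ
  open CommutativeRing commutativeRing public
  field
    _≈?_    : Decidable _≈_
    0≉1     : ¬ (0# ≈ 1#)
    inverse : ∀ x → ¬ (x ≈ 0#) → ∃[ y ] x * y ≈ 1#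

record AlgebraicallyClosedField c ℓ : Set (lsuc (c ⊔ ℓ)) where
  field
    field′ : Field c ℓ
  open Field field′ public
  open Polynomial rawRing public
  field
    root : ∀ f → DegreeAtLeast 1 f → ∃[ x ] eval f x ≈ 0#

record AlgebraicClosure (F : RawRing a b) c ℓ : Set (a ⊔ b ⊔ lsuc (c ⊔ ℓ)) where
  field
    algebraicallyClosedField : AlgebraicallyClosedField c ℓ
  open AlgebraicallyClosedField algebraicallyClosedField public
  open RingMorphisms F rawRing
  field
    ι                  : RawRing.Carrier F → Carrier
    ι-isRingHomomorphism : IsRingHomomorphism ι
    algebraic          : ∀ x → AlgebraicOver rawRing (λ y → ∃[ k ] y ≈ ι k) x

-- ℤ/pℤ, as ℤ with congruence modulo p as its equality
𝔽 : ℕ → RawRing 0ℓ 0ℓ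
𝔽 p = record
  { Carrier = ℤ
  ; _≈_     = λ x y → + p ℤ∣.∣ x ℤ.- y
  ; _+_     = ℤ._+_
  ; _*_     = ℤ._*_
  ; -_      = ℤ.-_
  ; 0#      = ℤ.0ℤ
  ; 1#      = ℤ.1ℤ
  }

record Enumeration (S : Setoid c ℓ) (P : Pred (Setoid.Carrier S) a)
       : Set (c ⊔ ℓ ⊔ a) where
  open Membership S using (_∈_)
  field
    elements : List (Setoid.Carrier S)
    unique   : Unique.Unique S elements
    member   : ∀ x → x ∈ elements ⇔ P x

  cardinality : ℕ
  cardinality = length elements

module ℚ[t] = Polynomial ℚ.+-*-rawRing

PowerSeries : Set
PowerSeries = ℕ → ℚ

open RawMonoidDefinitions ℚ.+-0-rawMonoid using (sum)

infixl 7 _⊛_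
_⊛_ : PowerSeries → PowerSeries → PowerSeries
(s ⊛ u) n = sum {suc n} λ i → s (toℕ i) ℚ.* u (n ℕ.∸ toℕ i)

infixr 8 _^ₛ_
_^ₛ_ : PowerSeries → ℕ → PowerSeries
s ^ₛ k = fold (ℚ[t].coeff (ℚ.1ℚ ∷ [])) (s ⊛_) k

-- exp s = Σ_k s^k / k!. This is meant for s with zero constant term; then
-- s^k contributes nothing to the coefficient of t^n for k > n.
exp : PowerSeries → PowerSeries
exp s n = sum {suc n} λ k → (s ^ₛ toℕ k) n ℚ.* (ℤ.1ℤ ℚ./ (toℕ k !)) {{toℕ k ℕ.!≢0}}

shift : ℕ → PowerSeries → PowerSeries
shift zero    s n       = s n
shift (suc k) s zero    = 0ℚ
shift (suc k) s (suc n) = shift k s n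

-- laurent N s represents t^(-N) · s.
record Laurent : Set where
  constructor laurent
  field
    pole   : ℕ
    series : PowerSeries

coeffₗ : Laurent → ℤ → ℚ
coeffₗ (laurent N s) k with k ℤ.+ + N
... | + n      = s n
... | -[1+ _ ] = 0ℚ

fromSeries : PowerSeries → Laurent
fromSeries = laurent 0

fromPoly : ℚ[t].Poly → Laurent
fromPoly f = fromSeries (ℚ[t].coeff f)

ℚ⦅t⦆ : RawRing 0ℓ 0ℓ
ℚ⦅t⦆ = record
  { Carrier = Laurent
  ; _≈_     = λ z w → ∀ k → coeffₗ z k ≡ coeffₗ w k
  ; _+_     = λ (laurent N s) (laurent M u) →
                laurent (N ℕ.+ M) (λ n → shift M s n ℚ.+ shift N u n)
  ; _*_     = λ (laurent N s) (laurent M u) → laurent (N ℕ.+ M) (s ⊛ u)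
  ; -_      = λ (laurent N s) → laurent N (λ n → ℚ.- s n)
  ; 0#      = fromPoly []
  ; 1#      = fromPoly (ℚ.1ℚ ∷ [])
  }

-- z belongs to the subfield ℚ(t): z = num / den in ℚ((t)).
Rational : Pred Laurent 0ℓ
Rational z = ∃[ num ] ∃[ den ] ℚ[t].Nonzero den × z * fromPoly den ≈ fromPoly num
  where open RawRing ℚ⦅t⦆

Transcendental : Pred Laurent 0ℓ
Transcendental z = ¬ AlgebraicOver ℚ⦅t⦆ Rational z

module Roots (K : AlgebraicallyClosedField c ℓ) where
  open AlgebraicallyClosedField K
  open CommutativeSemigroupProperties +-commutativeSemigroup using ()
    renaming (x∙yz≈y∙xz to x+[y+z]≈y+[x+z]; interchange to +-interchange)
  open CommutativeSemigroupProperties *-commutativeSemigroup using ()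
    renaming (x∙yz≈y∙xz to x*[y*z]≈y*[x*z])
  open RingProperties ring using (x∙y⁻¹≈ε⇒x≈y)
  open Equivalence using (to; from)
  open SetoidReasoning setoid

  -- Degree f d: f is a list of length suc d with nonzero last entry
  data Degree : Poly → ℕ → Set (c ⊔ ℓ) where
    leading : ∀ {a} → ¬ (a ≈ 0#) → Degree (a ∷ []) 0
    _∷_     : ∀ a {f d} → Degree f d → Degree (a ∷ f) (suc d)

  Degree⇒HasDegree : ∀ {f d} → Degree f d → HasDegree f d
  Degree⇒HasDegree (leading a≉0) = a≉0 , λ { (suc n) _ → refl }
  Degree⇒HasDegree (a ∷ f) with Degree⇒HasDegree f
  ... | l , h = l , λ { (suc n) (s≤s d<n) → h n d<n }

  eval-zero : ∀ f → (∀ n → coeff f n ≈ 0#) → ∀ x → eval f x ≈ 0#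
  eval-zero []      _ x = refl
  eval-zero (a ∷ f) h x = begin
    a + x * eval f x ≈⟨ +-cong (h 0) (*-congˡ (eval-zero f (h ∘ suc) x)) ⟩
    0# + x * 0#      ≈⟨ +-identityˡ _ ⟩
    x * 0#           ≈⟨ zeroʳ x ⟩
    0#               ∎

  HasDegree⇒Degree : ∀ f d → HasDegree f d →
                     ∃[ g ] Degree g d × ∀ x → eval f x ≈ eval g x
  HasDegree⇒Degree []      d       (l , _) = contradiction refl l
  HasDegree⇒Degree (a ∷ f) zero    (l , h) =
    a ∷ [] , leading l ,
    λ x → +-congˡ (*-congˡ (eval-zero f (λ n → h (suc n) (s≤s z≤n)) x))
  HasDegree⇒Degree (a ∷ f) (suc d) (l , h)
    with HasDegree⇒Degree f d (l , λ n d<n → h (suc n) (s≤s d<n))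
  ... | g , g° , f≈g = a ∷ g , a ∷ g° , λ x → +-congˡ (*-congˡ (f≈g x))

  eval-cong : ∀ f {x y} → x ≈ y → eval f x ≈ eval f y
  eval-cong []      x≈y = refl
  eval-cong (a ∷ f) x≈y = +-congˡ (*-cong x≈y (eval-cong f x≈y))

  eval-+ : ∀ f g x → eval (f +ₚ g) x ≈ eval f x + eval g x
  eval-+ []      g       x = sym (+-identityˡ _)
  eval-+ (a ∷ f) []      x = sym (+-identityʳ _)
  eval-+ (a ∷ f) (b ∷ g) x = begin
    (a + b) + x * eval (f +ₚ g) x           ≈⟨ +-congˡ (*-congˡ (eval-+ f g x)) ⟩
    (a + b) + x * (eval f x + eval g x)     ≈⟨ +-congˡ (distribˡ x _ _) ⟩
    (a + b) + (x * eval f x + x * eval g x) ≈⟨ +-interchange a b _ _ ⟩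
    (a + x * eval f x) + (b + x * eval g x) ∎

  eval-map : ∀ a f x → eval (map (a *_) f) x ≈ a * eval f x
  eval-map a []      x = sym (zeroʳ a)
  eval-map a (b ∷ f) x = begin
    a * b + x * eval (map (a *_) f) x ≈⟨ +-congˡ (*-congˡ (eval-map a f x)) ⟩
    a * b + x * (a * eval f x)        ≈⟨ +-congˡ (x*[y*z]≈y*[x*z] x a _) ⟩
    a * b + a * (x * eval f x)        ≈⟨ distribˡ a _ _ ⟨
    a * (b + x * eval f x)            ∎

  eval-* : ∀ f g x → eval (f *ₚ g) x ≈ eval f x * eval g x
  eval-* []      g x = sym (zeroˡ _)
  eval-* (a ∷ f) g x = begin
    eval (map (a *_) g +ₚ (0# ∷ f *ₚ g)) x
      ≈⟨ eval-+ (map (a *_) g) _ x ⟩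
    eval (map (a *_) g) x + (0# + x * eval (f *ₚ g) x)
      ≈⟨ +-cong (eval-map a g x) (+-identityˡ _) ⟩
    a * eval g x + x * eval (f *ₚ g) x
      ≈⟨ +-congˡ (*-congˡ (eval-* f g x)) ⟩
    a * eval g x + x * (eval f x * eval g x)
      ≈⟨ +-congˡ (*-assoc x _ _) ⟨
    a * eval g x + x * eval f x * eval g x
      ≈⟨ distribʳ _ a _ ⟨
    (a + x * eval f x) * eval g x ∎

  eval-∘ : ∀ f g x → eval (f ∘ₚ g) x ≈ eval f (eval g x)
  eval-∘ []      g x = refl
  eval-∘ (a ∷ f) g x = begin
    eval ((a ∷ []) +ₚ (f ∘ₚ g) *ₚ g) x
      ≈⟨ eval-+ (a ∷ []) ((f ∘ₚ g) *ₚ g) x ⟩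
    (a + x * 0#) + eval ((f ∘ₚ g) *ₚ g) x
      ≈⟨ +-cong (trans (+-congˡ (zeroʳ x)) (+-identityʳ a)) (eval-* (f ∘ₚ g) g x) ⟩
    a + eval (f ∘ₚ g) x * eval g x
      ≈⟨ +-congˡ (trans (*-congʳ (eval-∘ f g x)) (*-comm _ _)) ⟩
    a + eval g x * eval f (eval g x) ∎

  *-≉0 : ∀ {x y} → ¬ (x ≈ 0#) → ¬ (y ≈ 0#) → ¬ (x * y ≈ 0#)
  *-≉0 {x} {y} x≉0 y≉0 xy≈0 with inverse x x≉0
  ... | z , xz≈1 = y≉0 (begin
    y           ≈⟨ *-identityˡ y ⟨
    1# * y      ≈⟨ *-congʳ (trans (*-comm z x) xz≈1) ⟨
    z * x * y   ≈⟨ *-assoc z x y ⟩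
    z * (x * y) ≈⟨ *-congˡ xy≈0 ⟩
    z * 0#      ≈⟨ zeroʳ z ⟩
    0#          ∎)

  +ₚ-degreeʳ : ∀ {f d} g → Degree f d → length g ℕ.≤ d → Degree (f +ₚ g) d
  +ₚ-degreeʳ []      (leading l) _         = leading l
  +ₚ-degreeʳ []      (a ∷ f)     _         = a ∷ f
  +ₚ-degreeʳ (b ∷ g) (a ∷ f)     (s≤s g≤d) = a + b ∷ +ₚ-degreeʳ g f g≤d

  +ₚ-degreeˡ : ∀ f {g d} → length f ℕ.≤ d → Degree g d → Degree (f +ₚ g) d
  +ₚ-degreeˡ []      _         g       = g
  +ₚ-degreeˡ (a ∷ f) (s≤s f≤d) (b ∷ g) = a + b ∷ +ₚ-degreeˡ f f≤d g

  +ₚ0-degree : ∀ {f d} → Degree f d → Degree (f +ₚ (0# ∷ [])) d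
  +ₚ0-degree (leading l)             = leading (l ∘ trans (sym (+-identityʳ _)))
  +ₚ0-degree (a ∷ f@(leading _))     = a + 0# ∷ f
  +ₚ0-degree (a ∷ f@(_ ∷ _))         = a + 0# ∷ f

  map-degree : ∀ {a f d} → ¬ (a ≈ 0#) → Degree f d → Degree (map (a *_) f) d
  map-degree a≉0 (leading l) = leading (*-≉0 a≉0 l)
  map-degree a≉0 (b ∷ f)     = _ ∷ map-degree a≉0 f

  degree-length : ∀ {f d} → Degree f d → length f ≡ suc d
  degree-length (leading _) = ≡.refl
  degree-length (_ ∷ f)     = ≡.cong suc (degree-length f)

  *ₚ-degree : ∀ {f d g e} → Degree f d → Degree g e → Degree (f *ₚ g) (d ℕ.+ e)
  *ₚ-degree (leading l)                     g° = +ₚ0-degree (map-degree l g°)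
  *ₚ-degree {d = suc d} {g} {e} (a ∷ f°) g° =
    +ₚ-degreeˡ (map (a *_) g)
      (≡.subst (ℕ._≤ _)
        (≡.sym (≡.trans (length-map (a *_) g) (degree-length g°)))
        (s≤s (ℕ.m≤n+m e d)))
      (0# ∷ *ₚ-degree f° g°)

  ∘ₚ-degree : ∀ {f d g e} → Degree f d → Degree g (suc e) →
              Degree (f ∘ₚ g) (d ℕ.* suc e)
  ∘ₚ-degree (leading l) g° = leading l
  ∘ₚ-degree {d = suc d} {g} {e} (a ∷ f°) g° =
    +ₚ-degreeˡ (a ∷ []) (s≤s z≤n)
      (≡.subst (Degree _) (ℕ.+-comm (d ℕ.* suc e) (suc e))
        (*ₚ-degree (∘ₚ-degree f° g°) g°))

  -- The quotient of f by X - r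
  quotient : Carrier → Poly → Poly
  quotient r []            = []
  quotient r (a ∷ [])      = []
  quotient r (a ∷ b ∷ f)   = eval (b ∷ f) r ∷ quotient r (b ∷ f)

  quotient-degree : ∀ {f d} r → Degree f (suc d) → Degree (quotient r f) d
  quotient-degree r (a ∷ leading l) = leading (l ∘ trans (sym (begin
    _ + r * 0# ≈⟨ +-congˡ (zeroʳ r) ⟩
    _ + 0#     ≈⟨ +-identityʳ _ ⟩
    _          ∎)))
  quotient-degree r (a ∷ f@(_ ∷ _)) = _ ∷ quotient-degree r f

  eval-quotient : ∀ r e f →
    eval f (r + e) ≈ eval f r + e * eval (quotient r f) (r + e)
  eval-quotient r e []          = sym (trans (+-identityˡ _) (zeroʳ e))
  eval-quotient r e (a ∷ [])    = begin
    a + (r + e) * 0#       ≈⟨ +-congˡ (trans (zeroʳ _) (sym (zeroʳ r))) ⟩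
    a + r * 0#             ≈⟨ +-identityʳ _ ⟨
    (a + r * 0#) + 0#      ≈⟨ +-congˡ (zeroʳ e) ⟨
    (a + r * 0#) + e * 0#  ∎
  eval-quotient r e (a ∷ f@(_ ∷ _)) = begin
    a + (r + e) * eval f (r + e)
      ≈⟨ +-congˡ (*-congˡ (eval-quotient r e f)) ⟩
    a + (r + e) * (F + e * Q)
      ≈⟨ +-congˡ (distribˡ _ F _) ⟩
    a + ((r + e) * F + (r + e) * (e * Q))
      ≈⟨ +-congˡ (+-cong (distribʳ F r e) (x*[y*z]≈y*[x*z] (r + e) e Q)) ⟩
    a + ((r * F + e * F) + e * ((r + e) * Q))
      ≈⟨ +-congˡ (+-assoc _ _ _) ⟩
    a + (r * F + (e * F + e * ((r + e) * Q)))
      ≈⟨ +-assoc a _ _ ⟨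
    (a + r * F) + (e * F + e * ((r + e) * Q))
      ≈⟨ +-congˡ (distribˡ e F _) ⟨
    (a + r * F) + e * (F + (r + e) * Q) ∎
    where
    F = eval f r
    Q = eval (quotient r f) (r + e)

  factor : ∀ {r} f → eval f r ≈ 0# → ∀ x →
           eval f x ≈ (x - r) * eval (quotient r f) x
  factor {r} f fr≈0 x = begin
    eval f x                             ≈⟨ eval-cong f x≈r+e ⟩
    eval f (r + e)                       ≈⟨ eval-quotient r e f ⟩
    eval f r + e * eval q (r + e)        ≈⟨ +-congʳ fr≈0 ⟩
    0# + e * eval q (r + e)              ≈⟨ +-identityˡ _ ⟩
    e * eval q (r + e)                   ≈⟨ *-congˡ (eval-cong q x≈r+e) ⟨
    e * eval q x                         ∎
    where
    e = x - r
    q = quotient r f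
    x≈r+e : x ≈ r + (x - r)
    x≈r+e = sym (begin
      r + (x - r)   ≈⟨ x+[y+z]≈y+[x+z] r x (- r) ⟩
      x + (r - r)   ≈⟨ +-congˡ (-‿inverseʳ r) ⟩
      x + 0#        ≈⟨ +-identityʳ x ⟩
      x             ∎)

  Root : Poly → Pred Carrier ℓ
  Root f x = eval f x ≈ 0#

  roots : ∀ {f d} → Degree f d → Enumeration setoid (Root f)
  roots {f} {zero} (leading {a} l) = record
    { elements = []
    ; unique   = []
    ; member   = λ x → mk⇔ (λ ()) (λ fx≈0 → contradiction (begin
        a          ≈⟨ +-identityʳ a ⟨
        a + 0#     ≈⟨ +-congˡ (zeroʳ x) ⟨
        a + x * 0# ≈⟨ fx≈0 ⟩
        0#         ∎) l)
    }
  roots {f} {suc d} f° with root f (suc d , Degree⇒HasDegree f° , s≤s z≤n)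
  ... | r , fr≈0 = go (eval q r ≈? 0#)
    where
    q = quotient r f
    open Enumeration (roots (quotient-degree r f°))

    Root-q⇒Root-f : ∀ {x} → Root q x → Root f x
    Root-q⇒Root-f {x} qx≈0 =
      trans (factor f fr≈0 x) (trans (*-congˡ qx≈0) (zeroʳ _))

    Root-f⇒Root-q : ∀ {x} → Root f x → ¬ (x ≈ r) → Root q x
    Root-f⇒Root-q {x} fx≈0 x≉r with eval q x ≈? 0#
    ... | yes qx≈0 = qx≈0
    ... | no  qx≉0 = contradiction (trans (sym (factor f fr≈0 x)) fx≈0)
      (*-≉0 (x≉r ∘ x∙y⁻¹≈ε⇒x≈y x r) qx≉0)

    go : Dec (Root q r) → Enumeration setoid (Root f)
    go (yes qr≈0) = record
      { elements = elements
      ; unique   = unique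
      ; member   = λ x → mk⇔ (Root-q⇒Root-f ∘ to (member x)) (λ fx≈0 → from (member x) (x∈q x fx≈0))
      }
      where
      x∈q : ∀ x → Root f x → Root q x
      x∈q x fx≈0 with x ≈? r
      ... | yes x≈r = trans (eval-cong q x≈r) qr≈0
      ... | no  x≉r = Root-f⇒Root-q fx≈0 x≉r
    go (no qr≉0) = record
      { elements = r ∷ elements
      ; unique   = All.tabulateₛ setoid (λ {y} y∈q r≈y →
          qr≉0 (trans (eval-cong q r≈y) (to (member y) y∈q))) ∷ unique
      ; member   = λ x → mk⇔
          (λ { (here x≈r)  → trans (eval-cong f x≈r) fr≈0
             ; (there x∈q) → Root-q⇒Root-f (to (member x) x∈q) })
          (x∈r∷q x)
      }
      where
      x∈r∷q : ∀ x → Root f x → Any (x ≈_) (r ∷ elements)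
      x∈r∷q x fx≈0 with x ≈? r
      ... | yes x≈r = here x≈r
      ... | no  x≉r = there (from (member x) (Root-f⇒Root-q fx≈0 x≉r))

module FixedPoints (K : AlgebraicallyClosedField c ℓ) where
  open AlgebraicallyClosedField K
  open Roots K
  open RingProperties ring using (-1*x≈-x; x∙y⁻¹≈ε⇒x≈y; x≈y⇒x∙y⁻¹≈ε)
  open Equivalence using (to; from)
  open SetoidReasoning setoid

  infixr 8 _^∘_
  _^∘_ : (Carrier → Carrier) → ℕ → Carrier → Carrier
  (φ ^∘ n) x = fold x φ n

  FixedPoint : (Carrier → Carrier) → Pred Carrier ℓ
  FixedPoint φ x = φ x ≈ x

  iterate-degree : ∀ f → DegreeAtLeast 1 f → ∀ n →
    ∃[ g ] ∃[ e ] Degree g (suc e) × ∀ x → (eval f ^∘ n) x ≈ eval g x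
  iterate-degree f _ zero = 0# ∷ 1# ∷ [] , 0 , 0# ∷ leading (0≉1 ∘ sym) , λ x → sym (begin
    0# + x * (1# + x * 0#) ≈⟨ +-identityˡ _ ⟩
    x * (1# + x * 0#)      ≈⟨ *-congˡ (trans (+-congˡ (zeroʳ x)) (+-identityʳ 1#)) ⟩
    x * 1#                 ≈⟨ *-identityʳ x ⟩
    x                      ∎)
  iterate-degree f (suc d , f° , s≤s z≤n) (suc n)
    with HasDegree⇒Degree f (suc d) f° | iterate-degree f (suc d , f° , s≤s z≤n) n
  ... | g , g° , f≈g | h , e , h° , fⁿ≈h = g ∘ₚ h , _ , ∘ₚ-degree g° h° , λ x → begin
    eval f ((eval f ^∘ n) x) ≈⟨ eval-cong f (fⁿ≈h x) ⟩
    eval f (eval h x)        ≈⟨ f≈g _ ⟩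
    eval g (eval h x)        ≈⟨ eval-∘ g h x ⟨
    eval (g ∘ₚ h) x          ∎

  iterate-minus-id : ∀ f → DegreeAtLeast 2 f → ∀ n →
    ∃[ g ] ∃[ e ] Degree g e × ∀ x → (eval f ^∘ suc n) x - x ≈ eval g x
  iterate-minus-id f (suc (suc d) , f° , s≤s (s≤s z≤n)) n
    with HasDegree⇒Degree f (suc (suc d)) f°
       | iterate-degree f (suc (suc d) , f° , s≤s z≤n) n
  ... | g , g° , f≈g | h , e , h° , fⁿ≈h =
    (g ∘ₚ h) +ₚ -X , _ ,
    +ₚ-degreeʳ -X (∘ₚ-degree g° h°)
      (s≤s (ℕ.≤-trans (s≤s z≤n) (ℕ.m≤n+m (suc (e ℕ.+ d ℕ.* suc e)) e))) ,
    λ x → begin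
      eval f ((eval f ^∘ n) x) - x    ≈⟨ +-congʳ (eval-cong f (fⁿ≈h x)) ⟩
      eval f (eval h x) - x           ≈⟨ +-cong (f≈g _) (eval--X x) ⟩
      eval g (eval h x) + eval -X x   ≈⟨ +-congʳ (eval-∘ g h x) ⟨
      eval (g ∘ₚ h) x + eval -X x     ≈⟨ eval-+ (g ∘ₚ h) -X x ⟨
      eval ((g ∘ₚ h) +ₚ -X) x         ∎
    where
    -X : Poly
    -X = 0# ∷ - 1# ∷ []

    eval--X : ∀ x → - x ≈ eval -X x
    eval--X x = sym (begin
      0# + x * (- 1# + x * 0#) ≈⟨ +-identityˡ _ ⟩
      x * (- 1# + x * 0#)      ≈⟨ *-congˡ (trans (+-congˡ (zeroʳ x)) (+-identityʳ _)) ⟩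
      x * - 1#                 ≈⟨ *-comm x _ ⟩
      - 1# * x                 ≈⟨ -1*x≈-x x ⟩
      - x                      ∎)

  fixedPoints : ∀ f → DegreeAtLeast 2 f → ∀ n →
                Enumeration setoid (FixedPoint (eval f ^∘ suc n))
  fixedPoints f f° n with iterate-minus-id f f° n
  ... | g , _ , g° , fⁿ-x≈g = record
    { elements = elements
    ; unique   = unique
    ; member   = λ x → mk⇔
        (λ x∈g → x∙y⁻¹≈ε⇒x≈y _ _ (trans (fⁿ-x≈g x) (to (member x) x∈g)))
        (λ fx≈x → from (member x) (trans (sym (fⁿ-x≈g x)) (x≈y⇒x∙y⁻¹≈ε fx≈x)))
    }
    where open Enumeration (roots g°)

module ArtinMazur (K : AlgebraicallyClosedField c ℓ) where
  open AlgebraicallyClosedField K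
  open FixedPoints K

  -- The number of fixed points of the (n + 1)-st iterate
  fixedPointCount : ∀ f → DegreeAtLeast 2 f → ℕ → ℕ
  fixedPointCount f f° n = Enumeration.cardinality (fixedPoints f f° n)

  ζ : ∀ f → DegreeAtLeast 2 f → Laurent
  ζ f f° = fromSeries (exp Σaₙtⁿ/n)
    where
    Σaₙtⁿ/n : PowerSeries
    Σaₙtⁿ/n zero    = 0ℚ
    Σaₙtⁿ/n (suc n) = + fixedPointCount f f° n ℚ./ suc n

  X^-degree : ∀ {k} m → k ℕ.≤ m → DegreeAtLeast k (X^ m)
  X^-degree m k≤m = m , hasDegree m , k≤m
    where
    hasDegree : ∀ m → HasDegree (X^ m) m
    hasDegree zero    = 0≉1 ∘ sym , λ { (suc _) _ → refl }
    hasDegree (suc m) with hasDegree m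
    ... | l , h = l , λ { (suc n) (s≤s m<n) → h n m<n }

{-# OPTIONS --safe #-}

-- Let aₙ be the number of fixed points of fⁿ and F = Σ aₙtⁿ, so that t ζ′ = F ζ.
--
-- If f ∈ K[xᵖ], then fⁿ - x has derivative -1 and hence only simple roots, so
-- aₙ = dⁿ for d = deg f, and ζ = 1 / (1 - dt).
--
-- If f = xᵐ with p ∤ m, then aₙ = 1 + u where mⁿ - 1 = pᵛu and p ∤ u. Suppose that
-- ζ is algebraic. Then F = t ζ′ / ζ lies in the field ℚ(t)(ζ), which has finite
-- dimension over ℚ(t) and is closed under θ = t d/dt, so the series θⁱF are
-- linearly dependent over ℚ[t]. Comparing coefficients gives a recurrence
-- Σ_k Q_k(x - k) a_{x-k} = 0 with polynomials Q_k that are not all zero. Fix j₀ and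
-- let x = N + j₀, where N runs through an arithmetic progression on which
-- v = v_p(m^N - 1) is constant and exceeds all v_p(m^d - 1) with 0 < d ≤ J, J being
-- the length of the recurrence. On it v_p(m^{N±d} - 1) = v_p(m^d - 1) does not depend
-- on N, so the recurrence has the form A(N) + m^N B(N) = 0 with polynomials A and B,
-- and hence B = 0. Two such progressions with different values of v yield
-- polynomials B whose difference is a nonzero multiple of Q_{j₀}, so Q_{j₀} = 0 for
-- every j₀.

module Submission where

open import Defs
open import Algebra.Bundles using (CommutativeRing; RawRing)
import Algebra.Morphism.Structures as MorphismStructures
import Algebra.Properties.CommutativeMonoid.Mult as CommutativeMonoidMult
import Algebra.Properties.CommutativeSemigroup as CommutativeSemigroupProperties
import Algebra.Properties.CommutativeSemiring.Binomial as Binomial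
import Algebra.Properties.Ring as RingProperties
import Algebra.Properties.Semiring.Exp as SemiringExp
import Algebra.Properties.Semiring.Mult as SemiringMult
import Algebra.Properties.Semiring.Mult.TCOptimised as SemiringMultTC
import Algebra.Properties.Semiring.Sum as SemiringSum
import Algebra.Solver.Ring as RingSolver
open import Algebra.Solver.Ring.AlmostCommutativeRing
  using (_-Raw-AlmostCommutative⟶_; fromCommutativeRing)
open import Data.Fin.Base using (Fin; zero; suc; punchIn; toℕ; inject₁; fromℕ; fromℕ<)
import Data.Fin.Properties as Fin
open import Data.Integer.Base as ℤ using (ℤ; +_; -[1+_])
import Data.Integer.Properties as ℤ
open import Data.List.Base using (List; []; _∷_; length; map)
import Data.List.Membership.Setoid as Membership
open import Data.List.Properties using (length-removeAt′)
open import Data.List.Relation.Unary.All as All using (All; []; _∷_)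
open import Data.List.Relation.Unary.AllPairs using ([]; _∷_)
open import Data.List.Relation.Unary.Any using (Any; here; there; index; _─_)
import Data.List.Relation.Unary.Unique.Setoid as Unique
open import Data.Maybe.Base using (Maybe; just; nothing)
open import Data.Nat.Base as ℕ using (ℕ; zero; suc; _≤_; z≤n; s≤s; _!)
open import Data.Nat.Combinatorics using (_C_; k![n∸k]!∣n!; nCk≡n!/k![n-k]!; nCn≡1)
open import Data.Nat.Coprimality using (Coprime; coprime-Bézout)
open import Data.Nat.Divisibility as ℕ using (_∣_; _∤_; divides)
import Data.Nat.DivMod as ℕ
open import Data.Nat.GCD using (module Bézout)
open import Data.Nat.GeneralisedArithmetic using (fold)
import Data.Nat.Induction as ℕ
open import Data.Nat.Primality using (Prime; euclidsLemma; prime⇒nonZero; prime⇒nonTrivial; prime⇒irreducible)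
import Data.Nat.Properties as ℕ
open import Data.Nat.Solver using (module +-*-Solver)
open import Data.Product.Base using (_×_; _,_; ∃; ∃-syntax; proj₁; proj₂)
open import Data.Rational.Base as ℚ using (ℚ; 0ℚ; 1ℚ)
import Data.Rational.Properties as ℚ
import Data.Rational.Unnormalised.Base as ℚᵘ
import Data.Rational.Unnormalised.Properties as ℚᵘ
open import Data.Sum.Base using (_⊎_; inj₁; inj₂)
open import Data.Vec.Functional using (insertAt)
open import Data.Vec.Functional.Properties using (insertAt-lookup; insertAt-punchIn)
open import Function.Base using (_∘_)
open import Function.Bundles using (_⇔_; mk⇔; Equivalence)
open import Level using (Level; _⊔_; 0ℓ) renaming (suc to lsuc)
open import Relation.Binary.Bundles using (Setoid)
open import Relation.Binary.PropositionalEquality.Core as ≡ using (_≡_; _≢_)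
import Relation.Binary.PropositionalEquality.Properties as ≡
open import Relation.Binary.Definitions using (tri<; tri≈; tri>)
import Relation.Binary.Reasoning.Setoid as SetoidReasoning
open import Relation.Nullary using (¬_; Dec; yes; no; contradiction)
open import Relation.Nullary.Decidable using (decidable-stable)
open import Relation.Unary using (Pred)

-- Transcendence is a negation, and this shapes the algebraic half of the proof. The axioms give no
-- decision whether a power series, and in particular P′(ζ) for an equation P(ζ) = 0, vanishes.
-- Separability, elimination and the clearing of denominators are therefore proved under a double
-- negation and used only against the final contradiction. No fraction field is built. The place of
-- ℚ(t)(ζ) is taken by ℚ[t][ζ] inside the domain ℚ[[t]], and every division is paid for by a nonzero
-- factor: the leading coefficient of P for reduction modulo P, P′(ζ) for θζ, and ζ for F. Closure
-- under θ rests on characteristic zero, where P can be replaced by P′ until P′(ζ) is nonzero. The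
-- recurrence comes apart because the exponent v of p in m^x - 1 enters a_x only as a weight p^(-v).
-- The identity m^(N+d) - 1 = m^d (m^N - 1) + (m^d - 1) makes every term with d ≠ 0 forget N as soon
-- as m^N - 1 is divisible by a high power of p, while the term d = 0 carries the weight of the
-- progression. Changing the progression changes that weight alone, which isolates one coefficient.

-- Coefficients are formal differences of natural numbers, (a , b) standing for
-- a - b, so that equality of coefficients is decidable in every ring.
module DifferenceSolver {c ℓ} (R : CommutativeRing c ℓ) where
  open CommutativeRing R
  open RingProperties ring using (-‿distribˡ-*; -‿distribʳ-*; -‿involutive; -‿+-comm; -0#≈0#)
  open CommutativeSemigroupProperties +-commutativeSemigroup using (interchange)
  open SemiringMultTC semiring using (×-homo-+; ×1-homo-*) renaming (_×_ to _×′_)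
  open SetoidReasoning setoid

  differences : RawRing _ _
  differences = record
    { Carrier = ℕ × ℕ
    ; _≈_     = _≡_
    ; _+_     = λ (a , b) (c , d) → a ℕ.+ c , b ℕ.+ d
    ; _*_     = λ (a , b) (c , d) → a ℕ.* c ℕ.+ b ℕ.* d , a ℕ.* d ℕ.+ b ℕ.* c
    ; -_      = λ (a , b) → b , a
    ; 0#      = 0 , 0
    ; 1#      = 1 , 0
    }

  ⟦_⟧ᵈ : ℕ × ℕ → Carrier
  ⟦ a , b ⟧ᵈ = a ×′ 1# - b ×′ 1#

  +-homo : ∀ a b c d → (a ℕ.+ c) ×′ 1# - (b ℕ.+ d) ×′ 1# ≈ ⟦ a , b ⟧ᵈ + ⟦ c , d ⟧ᵈ
  +-homo a b c d = begin
    (a ℕ.+ c) ×′ 1# - (b ℕ.+ d) ×′ 1#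
      ≈⟨ +-cong (×-homo-+ 1# a c) (-‿cong (×-homo-+ 1# b d)) ⟩
    (a ×′ 1# + c ×′ 1#) - (b ×′ 1# + d ×′ 1#)
      ≈⟨ +-congˡ (-‿+-comm _ _) ⟨
    (a ×′ 1# + c ×′ 1#) + (- (b ×′ 1#) - d ×′ 1#)
      ≈⟨ interchange _ _ _ _ ⟩
    ⟦ a , b ⟧ᵈ + ⟦ c , d ⟧ᵈ ∎

  *-homo : ∀ a b c d → ⟦ a ℕ.* c ℕ.+ b ℕ.* d , a ℕ.* d ℕ.+ b ℕ.* c ⟧ᵈ ≈ ⟦ a , b ⟧ᵈ * ⟦ c , d ⟧ᵈ
  *-homo a b c d = sym (begin
    (A - B) * (C - D)                          ≈⟨ distribʳ _ _ _ ⟩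
    A * (C - D) + - B * (C - D)                ≈⟨ +-cong (distribˡ _ _ _) (distribˡ _ _ _) ⟩
    (A * C + A * - D) + (- B * C + - B * - D)  ≈⟨ +-cong (+-congˡ (-‿distribʳ-* A D)) (+-cong (-‿distribˡ-* B C) -B*-D) ⟨
    (A * C - A * D) + (- (B * C) + B * D)      ≈⟨ +-congˡ (+-comm _ _) ⟩
    (A * C - A * D) + (B * D - B * C)          ≈⟨ interchange _ _ _ _ ⟩
    (A * C + B * D) + (- (A * D) - B * C)      ≈⟨ +-congˡ (-‿+-comm _ _) ⟩
    (A * C + B * D) - (A * D + B * C)          ≈⟨ +-cong (+-cong (×1-homo-* a c) (×1-homo-* b d)) (-‿cong (+-cong (×1-homo-* a d) (×1-homo-* b c))) ⟨
    ((a ℕ.* c) ×′ 1# + (b ℕ.* d) ×′ 1#) - ((a ℕ.* d) ×′ 1# + (b ℕ.* c) ×′ 1#)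
      ≈⟨ +-cong (×-homo-+ 1# (a ℕ.* c) _) (-‿cong (×-homo-+ 1# (a ℕ.* d) _)) ⟨
    ⟦ a ℕ.* c ℕ.+ b ℕ.* d , a ℕ.* d ℕ.+ b ℕ.* c ⟧ᵈ ∎)
    where
    A = a ×′ 1#
    B = b ×′ 1#
    C = c ×′ 1#
    D = d ×′ 1#
    -B*-D : B * D ≈ - B * - D
    -B*-D = trans (sym (-‿involutive _)) (trans (-‿cong (-‿distribˡ-* B D)) (-‿distribʳ-* _ D))

  homomorphism : differences -Raw-AlmostCommutative⟶ fromCommutativeRing R
  homomorphism = record
    { ⟦_⟧    = ⟦_⟧ᵈ
    ; +-homo = λ (a , b) (c , d) → +-homo a b c d
    ; *-homo = λ (a , b) (c , d) → *-homo a b c d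
    ; -‿homo = λ (a , b) → sym (trans (sym (-‿+-comm _ _)) (trans (+-congˡ (-‿involutive _)) (+-comm _ _)))
    ; 0-homo = -‿inverseʳ 0#
    ; 1-homo = trans (+-congˡ -0#≈0#) (+-identityʳ 1#)
    }

  sameDifference : ∀ x y → Maybe (⟦ x ⟧ᵈ ≈ ⟦ y ⟧ᵈ)
  sameDifference (a , b) (c , d) with a ℕ.+ d ℕ.≟ b ℕ.+ c
  ... | no  _  = nothing
  ... | yes eq = just (begin
    A - B             ≈⟨ +-identityʳ _ ⟨
    (A - B) + 0#      ≈⟨ +-congˡ (-‿inverseʳ D) ⟨
    (A - B) + (D - D) ≈⟨ interchange _ _ _ _ ⟩
    (A + D) + (- B - D) ≈⟨ +-congʳ (×-homo-+ 1# a d) ⟨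
    (a ℕ.+ d) ×′ 1# + (- B - D) ≡⟨ ≡.cong (λ n → n ×′ 1# + (- B - D)) eq ⟩
    (b ℕ.+ c) ×′ 1# + (- B - D) ≈⟨ +-congʳ (×-homo-+ 1# b c) ⟩
    (B + C) + (- B - D) ≈⟨ interchange _ _ _ _ ⟩
    (B - B) + (C - D)   ≈⟨ +-congʳ (-‿inverseʳ B) ⟩
    0# + (C - D)        ≈⟨ +-identityˡ _ ⟩
    C - D               ∎)
    where
    A = a ×′ 1#
    B = b ×′ 1#
    C = c ×′ 1#
    D = d ×′ 1#

  open RingSolver differences (fromCommutativeRing R) homomorphism sameDifference public
    using (solve; _:=_; _:+_; _:*_; _:-_; :-_; con)

-- Elements algebraic over a differential subring

record DifferentialDomain c ℓ : Set (lsuc (c ⊔ ℓ)) where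
  field
    commutativeRing : CommutativeRing c ℓ
  open CommutativeRing commutativeRing public hiding (zero)
  open SemiringMult semiring public using () renaming (_×_ to _·_)
  field
    ≈0-stable : ∀ {x} → ¬ ¬ (x ≈ 0#) → x ≈ 0#
    cancel    : ∀ {x y} → ¬ (x ≈ 0#) → x * y ≈ 0# → y ≈ 0#
    ·-cancel  : ∀ n {x} → suc n · x ≈ 0# → x ≈ 0#
    1≉0       : ¬ (1# ≈ 0#)
    ∂         : Carrier → Carrier
    ∂-cong    : ∀ {x y} → x ≈ y → ∂ x ≈ ∂ y
    ∂-+       : ∀ x y → ∂ (x + y) ≈ ∂ x + ∂ y
    ∂-*       : ∀ x y → ∂ (x * y) ≈ ∂ x * y + x * ∂ y

  *-≉0 : ∀ {x y} → ¬ (x ≈ 0#) → ¬ (y ≈ 0#) → ¬ (x * y ≈ 0#)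
  *-≉0 x≉0 y≉0 xy≈0 = y≉0 (cancel x≉0 xy≈0)

record DifferentialSubring {c ℓ} (R : DifferentialDomain c ℓ) a : Set (c ⊔ ℓ ⊔ lsuc a) where
  open DifferentialDomain R
  field
    A      : Pred Carrier a
    A-resp : ∀ {x y} → x ≈ y → A x → A y
    A-0    : A 0#
    A-1    : A 1#
    A-+    : ∀ {x y} → A x → A y → A (x + y)
    A-*    : ∀ {x y} → A x → A y → A (x * y)
    A-neg  : ∀ {x} → A x → A (- x)
    A-∂    : ∀ {x} → A x → A (∂ x)

module AlgebraicElement {c ℓ a} (R : DifferentialDomain c ℓ) (S : DifferentialSubring R a)
  (z : DifferentialDomain.Carrier R) where
  open DifferentialDomain R
  open DifferentialSubring S
  open DifferenceSolver commutativeRing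
  open RingProperties ring using (-1*x≈-x) renaming (+-inverseʳ-unique to inverseʳ-unique)
  open SemiringExp semiring using (_^_)
  open SemiringMult semiring using (×-assoc-*; ×-comm-*)
  open SemiringSum semiring using (sum; sum-cong-≋; sum-remove; *-distribˡ-sum; ∑-distrib-+)
  open SetoidReasoning setoid

  *0+ : ∀ x {y} → y ≈ 0# → x * y ≈ 0#
  *0+ x y≈0 = trans (*-congˡ y≈0) (zeroʳ x)

  A-· : ∀ n {x} → A x → A (n · x)
  A-· zero    Ax = A-0
  A-· (suc n) Ax = A-+ Ax (A-· n Ax)

  A-sum : ∀ {n} (f : Fin n → Carrier) → (∀ i → A (f i)) → A (sum f)
  A-sum {zero}  f Af = A-0
  A-sum {suc n} f Af = A-+ (Af zero) (A-sum (f ∘ suc) (Af ∘ suc))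

  -- The values at z of the polynomials of degree less than k over A
  data V : ℕ → Carrier → Set (c ⊔ ℓ ⊔ a) where
    nil  : ∀ {x} → x ≈ 0# → V 0 x
    cons : ∀ {k b x y} → A b → V k y → x ≈ b + z * y → V (suc k) x

  V-resp : ∀ {k x y} → x ≈ y → V k x → V k y
  V-resp x≈y (nil x≈0)        = nil (trans (sym x≈y) x≈0)
  V-resp x≈y (cons Ab Vy eq)  = cons Ab Vy (trans (sym x≈y) eq)

  V-suc : ∀ {k x} → V k x → V (suc k) x
  V-suc {x = x} (nil x≈0) = cons A-0 (nil refl) (begin
    x            ≈⟨ x≈0 ⟩
    0#           ≈⟨ zeroʳ z ⟨
    z * 0#       ≈⟨ +-identityˡ _ ⟨
    0# + z * 0#  ∎)
  V-suc (cons Ab Vy eq) = cons Ab (V-suc Vy) eq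

  V-mono : ∀ {k l x} → k ≤ l → V k x → V l x
  V-mono {l = zero}  z≤n       Vx               = Vx
  V-mono {l = suc l} z≤n       Vx               = V-suc (V-mono z≤n Vx)
  V-mono             (s≤s k≤l) (cons Ab Vy eq)  = cons Ab (V-mono k≤l Vy) eq

  V-+ : ∀ {k x y} → V k x → V k y → V k (x + y)
  V-+ (nil x≈0) (nil y≈0) = nil (trans (+-cong x≈0 y≈0) (+-identityˡ 0#))
  V-+ {x = x} {y} (cons {b = b} {y = x′} Ab Vx eq) (cons {b = d} {y = y′} Ad Vy eq′) =
    cons (A-+ Ab Ad) (V-+ Vx Vy) (begin
      x + y                          ≈⟨ +-cong eq eq′ ⟩
      (b + z * x′) + (d + z * y′)    ≈⟨ solve 5 (λ z b d x y → (b :+ z :* x) :+ (d :+ z :* y)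
             := (b :+ d) :+ z :* (x :+ y))
           refl z b d x′ y′ ⟩
      (b + d) + z * (x′ + y′)        ∎)

  V-· : ∀ {k d x} → A d → V k x → V k (d * x)
  V-· {d = d} Ad (nil x≈0) = nil (*0+ d x≈0)
  V-· {d = d} {x} Ad (cons {b = b} {y = y} Ab Vy eq) = cons (A-* Ad Ab) (V-· Ad Vy) (begin
    d * x               ≈⟨ *-congˡ eq ⟩
    d * (b + z * y)     ≈⟨ solve 4 (λ z d b y → d :* (b :+ z :* y) := d :* b :+ z :* (d :* y)) refl z d b y ⟩
    d * b + z * (d * y) ∎)

  V-neg : ∀ {k x} → V k x → V k (- x)
  V-neg Vx = V-resp (-1*x≈-x _) (V-· (A-neg A-1) Vx)

  V-z : ∀ {k x} → V k x → V (suc k) (z * x)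
  V-z Vx = cons A-0 Vx (sym (+-identityˡ _))

  V-* : ∀ {k l x y} → V k x → V l y → V (k ℕ.+ l) (x * y)
  V-* {y = y} (nil x≈0) Vy = V-mono z≤n (nil (trans (*-congʳ x≈0) (zeroˡ y)))
  V-* {suc k} {l} {x} {y} (cons {b = b} {y = x′} Ab Vx eq) Vy = V-resp (begin
    b * y + z * (x′ * y) ≈⟨ solve 4 (λ z b x y → b :* y :+ z :* (x :* y) := (b :+ z :* x) :* y) refl z b x′ y ⟩
    (b + z * x′) * y     ≈⟨ *-congʳ eq ⟨
    x * y                ∎)
    (V-+ (V-mono (ℕ.m≤n+m l (suc k)) (V-· Ab Vy)) (V-z (V-* Vx Vy)))

  V-^ : ∀ k → V (suc k) (z ^ k)
  V-^ zero    = cons A-1 (nil refl) (sym (trans (+-congˡ (zeroʳ z)) (+-identityʳ 1#)))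
  V-^ (suc k) = V-z (V-^ k)

  -- The Horner form exposes the constant term, while reduction modulo a relation acts on the
  -- leading one.
  V-top : ∀ {k x} → V (suc k) x → ∃[ y ] ∃[ b ] V k y × A b × x ≈ y + b * z ^ k
  V-top {x = x} (cons {b = b} {y = y} Ab (nil y≈0) eq) = 0# , b , nil refl , Ab , (begin
    x           ≈⟨ eq ⟩
    b + z * y   ≈⟨ +-congˡ (*0+ z y≈0) ⟩
    b + 0#      ≈⟨ +-comm b 0# ⟩
    0# + b      ≈⟨ +-congˡ (*-identityʳ b) ⟨
    0# + b * 1# ∎)
  V-top {suc k} {x} (cons {b = b} {y = y} Ab Vy@(cons _ _ _) eq) with V-top Vy
  ... | y′ , d , Vy′ , Ad , eq′ = b + z * y′ , d , cons Ab Vy′ refl , Ad , (begin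
    x                           ≈⟨ eq ⟩
    b + z * y                   ≈⟨ +-congˡ (*-congˡ eq′) ⟩
    b + z * (y′ + d * z ^ k)    ≈⟨ solve 5 (λ z b y d w → b :+ z :* (y :+ d :* w) := (b :+ z :* y) :+ d :* (z :* w))
         refl z b y′ d (z ^ k) ⟩
    (b + z * y′) + d * z ^ suc k ∎)

  -- ∂ (P(z)) = P^∂(z) + P′(z) ∂z
  V-∂ : ∀ {k x} → V (suc k) x → ∃[ y ] ∃[ w ] V k y × V (suc k) w × ∂ x ≈ w + y * ∂ z
  V-∂ {x = x} (cons {b = b} {y = y} Ab (nil y≈0) eq) =
    0# , ∂ b , nil refl , cons (A-∂ Ab) (nil refl) (sym (trans (+-congˡ (zeroʳ z)) (+-identityʳ _))) , (begin
      ∂ x            ≈⟨ ∂-cong (trans eq (trans (+-congˡ (*0+ z y≈0)) (+-identityʳ b))) ⟩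
      ∂ b            ≈⟨ +-identityʳ _ ⟨
      ∂ b + 0#       ≈⟨ +-congˡ (zeroˡ (∂ z)) ⟨
      ∂ b + 0# * ∂ z ∎)
  V-∂ {suc k} {x} (cons {b = b} {y = y} Ab Vy@(cons _ _ _) eq) with V-∂ Vy
  ... | y′ , w , Vy′ , Vw , eq′ =
    y + z * y′ , ∂ b + z * w , V-+ Vy (V-z Vy′) , cons (A-∂ Ab) Vw refl , (begin
      ∂ x                                         ≈⟨ ∂-cong eq ⟩
      ∂ (b + z * y)                               ≈⟨ ∂-+ b _ ⟩
      ∂ b + ∂ (z * y)                             ≈⟨ +-congˡ (∂-* z y) ⟩
      ∂ b + (∂ z * y + z * ∂ y)                   ≈⟨ +-congˡ (+-congˡ (*-congˡ eq′)) ⟩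
      ∂ b + (∂ z * y + z * (w + y′ * ∂ z))        ≈⟨ solve 6 (λ z b dz y w y′ → b :+ (dz :* y :+ z :* (w :+ y′ :* dz))
             := (b :+ z :* w) :+ (y :+ z :* y′) :* dz)
           refl z (∂ b) (∂ z) y w y′ ⟩
      (∂ b + z * w) + (y + z * y′) * ∂ z ∎)

  A[z] : Pred Carrier (c ⊔ ℓ ⊔ a)
  A[z] x = ∃[ k ] V k x

  S-resp : ∀ {x y} → x ≈ y → A[z] x → A[z] y
  S-resp x≈y (k , Vx) = k , V-resp x≈y Vx

  S-+ : ∀ {x y} → A[z] x → A[z] y → A[z] (x + y)
  S-+ (k , Vx) (l , Vy) = k ℕ.⊔ l , V-+ (V-mono (ℕ.m≤m⊔n k l) Vx) (V-mono (ℕ.m≤n⊔m k l) Vy)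

  S-* : ∀ {x y} → A[z] x → A[z] y → A[z] (x * y)
  S-* (k , Vx) (l , Vy) = k ℕ.+ l , V-* Vx Vy

  S-neg : ∀ {x} → A[z] x → A[z] (- x)
  S-neg (k , Vx) = k , V-neg Vx

  S-z : A[z] z
  S-z = 2 , V-resp (*-identityʳ z) (V-^ 1)

  -- The equation P(z) = 0 for a polynomial P of formal degree k with leading coefficient g; y
  -- collects the lower terms.
  Relation : Carrier → ℕ → Set (c ⊔ ℓ ⊔ a)
  Relation g k = ∃[ y ] V k y × y + g * z ^ k ≈ 0#

  relation-suc : ∀ {g k} → Relation g k → Relation g (suc k)
  relation-suc {g} {k} (y , Vy , eq) = z * y , V-z Vy , (begin
    z * y + g * z ^ suc k ≈⟨ solve 4 (λ z y g w → z :* y :+ g :* (z :* w) := z :* (y :+ g :* w)) refl z y g (z ^ k) ⟩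
    z * (y + g * z ^ k)   ≈⟨ *0+ z eq ⟩
    0#                    ∎)

  -- Pseudo-division: g need not be invertible, so x is multiplied by g before b times the relation
  -- is subtracted, which cancels the top term.
  reduce₁ : ∀ {g k x} → A g → Relation g k → V (suc k) x → V k (g * x)
  reduce₁ {g} {k} {x} Ag (y , Vy , eq) Vx with V-top Vx
  ... | x′ , b , Vx′ , Ab , eq′ = V-resp (begin
    g * x′ + - b * y                            ≈⟨ +-identityʳ _ ⟨
    (g * x′ + - b * y) + 0#                     ≈⟨ +-congˡ (*0+ b eq) ⟨
    (g * x′ + - b * y) + b * (y + g * z ^ k)    ≈⟨ solve 5 (λ g x b y w → (g :* x :+ (:- b) :* y) :+ b :* (y :+ g :* w)
           := g :* (x :+ b :* w))
         refl g x′ b y (z ^ k) ⟩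
    g * (x′ + b * z ^ k)                        ≈⟨ *-congˡ eq′ ⟨
    g * x                                       ∎)
    (V-+ (V-· Ag Vx′) (V-· (A-neg Ab) Vy))

  -- Each of the j steps costs one factor g. `lift` multiplies the relation by a power of z so that
  -- it meets the current top degree.
  reduce : ∀ {g k} j {x} → A g → Relation g k → V (j ℕ.+ k) x → V k (g ^ j * x)
  reduce zero            Ag rel Vx = V-resp (sym (*-identityˡ _)) Vx
  reduce {g} {k} (suc j) {x} Ag rel Vx =
    V-resp (solve 3 (λ g w x → w :* (g :* x) := (g :* w) :* x) refl g (g ^ j) x)
      (reduce j Ag rel (reduce₁ Ag (lift j) Vx))
    where
    lift : ∀ j → Relation g (j ℕ.+ k)
    lift zero    = rel
    lift (suc j) = relation-suc (lift j)

  ∂-≈0 : ∀ {x} → x ≈ 0# → ∂ x ≈ 0#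
  ∂-≈0 {x} x≈0 = begin
    ∂ x                       ≈⟨ ∂-cong (trans x≈0 (sym (zeroˡ 0#))) ⟩
    ∂ (0# * 0#)               ≈⟨ ∂-* 0# 0# ⟩
    ∂ 0# * 0# + 0# * ∂ 0#     ≈⟨ +-cong (zeroʳ _) (zeroˡ _) ⟩
    0# + 0#                   ≈⟨ +-identityˡ 0# ⟩
    0#                        ∎

  ∂-^ : ∀ k → ∂ (z ^ suc k) ≈ (suc k · z ^ k) * ∂ z
  ∂-^ zero = begin
    ∂ (z * 1#)             ≈⟨ ∂-cong (*-identityʳ z) ⟩
    ∂ z                    ≈⟨ *-identityˡ _ ⟨
    1# * ∂ z               ≈⟨ *-congʳ (+-identityʳ 1#) ⟨
    (1# + 0#) * ∂ z        ∎
  ∂-^ (suc k) = begin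
    ∂ (z * z ^ suc k)                                    ≈⟨ ∂-* z _ ⟩
    ∂ z * z ^ suc k + z * ∂ (z ^ suc k)                  ≈⟨ +-congˡ (*-congˡ (∂-^ k)) ⟩
    ∂ z * z ^ suc k + z * ((suc k · z ^ k) * ∂ z)        ≈⟨ solve 4 (λ dz w z v → dz :* w :+ z :* (v :* dz)
           := (w :+ z :* v) :* dz)
         refl (∂ z) (z ^ suc k) z (suc k · z ^ k) ⟩
    (z ^ suc k + z * (suc k · z ^ k)) * ∂ z              ≈⟨ *-congʳ (+-congˡ (×-comm-* (suc k) z (z ^ k))) ⟩
    (z ^ suc k + suc k · (z * z ^ k)) * ∂ z              ∎

  -- Says that ∂ z is a quotient of elements of A[z] with denominator δ. Differentiating P(z) = 0
  -- gives P′(z) ∂z = -P^∂(z), so δ will be P′(z).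
  record Separable : Set (c ⊔ ℓ ⊔ a) where
    field
      {lead}   : Carrier
      {degree} : ℕ
      A-lead   : A lead
      lead≉0   : ¬ (lead ≈ 0#)
      relation : Relation lead degree
      {δ}      : Carrier
      S-δ      : A[z] δ
      δ≉0      : ¬ (δ ≈ 0#)
      S-δ∂z    : A[z] (δ * ∂ z)

  -- If P(z) = 0 and P′(z) = 0, continue with P′, which has smaller degree and,
  -- in characteristic zero, a nonzero leading coefficient.
  separable : ∀ {g} k → A g → ¬ (g ≈ 0#) → Relation g k → ¬ ¬ Separable
  separable {g} zero Ag g≉0 (y , nil y≈0 , eq) _ = g≉0 (begin
    g            ≈⟨ *-identityʳ g ⟨
    g * 1#       ≈⟨ +-identityˡ _ ⟨
    0# + g * 1#  ≈⟨ +-congʳ y≈0 ⟨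
    y + g * 1#   ≈⟨ eq ⟩
    0#           ∎)
  separable {g} (suc k) Ag g≉0 rel@(y , Vy , eq) ¬sep with V-∂ Vy
  ... | y′ , w , Vy′ , Vw , eq′ =
    separable k (A-· (suc k) Ag) (g≉0 ∘ ·-cancel k) (y′ , Vy′ , ≈0-stable ¬δ≉0) ¬sep
    where
    -- Here δ is P′(z) and w′ is P^∂(z), the value after applying ∂ to the coefficients; `δ∂z≈` is
    -- the derivative of P(z) = 0.
    δ = y′ + (suc k · g) * z ^ k
    w′ = w + ∂ g * z ^ suc k
    δ∂z≈ : - w′ ≈ δ * ∂ z
    δ∂z≈ = sym (inverseʳ-unique w′ (δ * ∂ z) (begin
      (w + ∂ g * z ^ suc k) + (y′ + (suc k · g) * z ^ k) * ∂ z
        ≈⟨ +-congˡ (*-congʳ (+-congˡ (trans (×-assoc-* (suc k) g _) (sym (×-comm-* (suc k) g _))))) ⟩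
      (w + ∂ g * z ^ suc k) + (y′ + g * (suc k · z ^ k)) * ∂ z
        ≈⟨ solve 7 (λ w dg v y g u dz → (w :+ dg :* v) :+ (y :+ g :* u) :* dz
               := (w :+ y :* dz) :+ (dg :* v :+ g :* (u :* dz)))
             refl w (∂ g) (z ^ suc k) y′ g (suc k · z ^ k) (∂ z) ⟩
      (w + y′ * ∂ z) + (∂ g * z ^ suc k + g * ((suc k · z ^ k) * ∂ z))
        ≈⟨ +-cong eq′ (+-congˡ (*-congˡ (∂-^ k))) ⟨
      ∂ y + (∂ g * z ^ suc k + g * ∂ (z ^ suc k)) ≈⟨ +-congˡ (∂-* g _) ⟨
      ∂ y + ∂ (g * z ^ suc k)                     ≈⟨ ∂-+ y _ ⟨
      ∂ (y + g * z ^ suc k)                       ≈⟨ ∂-≈0 eq ⟩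
      0#                                          ∎))
    ¬δ≉0 : ¬ ¬ (δ ≈ 0#)
    ¬δ≉0 δ≉0 = ¬sep record
      { A-lead   = Ag
      ; lead≉0   = g≉0
      ; relation = rel
      ; S-δ      = suc k , V-+ (V-suc Vy′) (V-· (A-· (suc k) Ag) (V-^ k))
      ; δ≉0      = δ≉0
      ; S-δ∂z    = S-resp δ∂z≈ (S-neg (S-+ (_ , Vw) (_ , V-· (A-∂ Ag) (V-^ (suc k)))))
      }

  Dependent : ∀ {n} → (Fin n → Carrier) → Set (c ⊔ ℓ ⊔ a)
  Dependent {n} x = ∃ λ (d : Fin n → Carrier) →
    (∀ i → A (d i)) × (∃[ i ] ¬ (d i ≈ 0#)) × sum (λ i → d i * x i) ≈ 0#

  sum-≈0 : ∀ {n} (f : Fin n → Carrier) → (∀ i → f i ≈ 0#) → sum f ≈ 0#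
  sum-≈0 {zero}  f f≈0 = refl
  sum-≈0 {suc n} f f≈0 = trans (+-cong (f≈0 zero) (sum-≈0 (f ∘ suc) (f≈0 ∘ suc))) (+-identityˡ 0#)

  -- Fraction-free elimination on the constant terms b. No pivot can be searched for, since b p ≈ 0#
  -- is not decided; instead, granted that no dependence exists, `pivot` refutes b p ≉ 0# for every
  -- p by eliminating with it. All x i are then z times elements of V k, and those other than x zero
  -- already yield a dependence.
  dependent : ∀ k (x : Fin (suc k) → Carrier) → (∀ i → V k (x i)) → ¬ ¬ Dependent x
  dependent zero x Vx ¬dep with Vx zero
  ... | nil x≈0 = ¬dep ((λ _ → 1#) , (λ _ → A-1) , (zero , 1≉0) , trans (+-identityʳ _) (*0+ 1# x≈0))
  dependent (suc k) x Vx ¬dep =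
    dependent k (y ∘ suc) (Vy ∘ suc) λ (d , Ad , (i , di≉0) , Σ≈0) → ¬dep
      ( (λ { zero → 0# ; (suc j) → d j })
      , (λ { zero → A-0 ; (suc j) → Ad j })
      , (suc i , di≉0)
      , (begin
          0# * x zero + sum (λ j → d j * x (suc j))
            ≈⟨ +-cong (zeroˡ _) (sum-cong-≋ λ j → begin
                 d j * x (suc j)                   ≈⟨ *-congˡ (eq (suc j)) ⟩
                 d j * (b (suc j) + z * y (suc j)) ≈⟨ *-congˡ (+-congʳ (pivot (suc j))) ⟩
                 d j * (0# + z * y (suc j))        ≈⟨ *-congˡ (+-identityˡ _) ⟩
                 d j * (z * y (suc j))             ≈⟨ solve 3 (λ d z y → d :* (z :* y) := z :* (d :* y))
                      refl (d j) z (y (suc j)) ⟩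
                 z * (d j * y (suc j))             ∎) ⟩
          0# + sum (λ j → z * (d j * y (suc j)))   ≈⟨ +-identityˡ _ ⟩
          sum (λ j → z * (d j * y (suc j)))        ≈⟨ *-distribˡ-sum z (λ j → d j * y (suc j)) ⟨
          z * sum (λ j → d j * y (suc j))          ≈⟨ *0+ z Σ≈0 ⟩
          0#                                       ∎))
    where
    split : ∀ i → ∃[ b ] ∃[ y ] A b × V k y × x i ≈ b + z * y
    split i with Vx i
    ... | cons Ab Vy eq = _ , _ , Ab , Vy , eq

    b y : Fin (suc (suc k)) → Carrier
    b i = proj₁ (split i)
    y i = proj₁ (proj₂ (split i))

    Ab : ∀ i → A (b i)
    Ab i = proj₁ (proj₂ (proj₂ (split i)))

    Vy : ∀ i → V k (y i)
    Vy i = proj₁ (proj₂ (proj₂ (proj₂ (split i))))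

    eq : ∀ i → x i ≈ b i + z * y i
    eq i = proj₂ (proj₂ (proj₂ (proj₂ (split i))))

    pivot : ∀ p → b p ≈ 0#
    pivot p = ≈0-stable λ bp≉0 →
      dependent k w
        (λ j → V-+ (V-· (Ab p) (Vy _)) (V-· (A-neg (Ab _)) (Vy p)))
        λ (d , Ad , (i , di≉0) , Σ≈0) →
          -- These coefficients come from expanding Σ d j (b p x (q j) - b (q j) x p): e belongs to
          -- x p, and f to the others.
          let e = sum (λ j → d j * - b (q j))
              f = λ j → d j * b p
              g = insertAt f p e
          in ¬dep
          ( g
          , A-insertAt p (A-sum (λ j → d j * - b (q j)) (λ j → A-* (Ad j) (A-neg (Ab _)))) (λ j → A-* (Ad j) (Ab p))
          , (q i , λ gi≈0 → *-≉0 di≉0 bp≉0 (trans (reflexive (≡.sym (insertAt-punchIn f p e i))) gi≈0))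
          , (begin
              sum (λ j → g j * x j)                               ≈⟨ sum-remove {i = p} (λ j → g j * x j) ⟩
              g p * x p + sum (λ j → g (q j) * x (q j))
                ≈⟨ +-cong (*-congʳ (reflexive (insertAt-lookup f p e)))
                          (sum-cong-≋ λ j → *-congʳ {x (q j)} (reflexive (insertAt-punchIn f p e j))) ⟩
              e * x p + sum (λ j → f j * x (q j))                 ≈⟨ +-congʳ (trans (*-comm e _) (*-distribˡ-sum (x p) (λ j → d j * - b (q j)))) ⟩
              sum (λ j → x p * (d j * - b (q j))) + sum (λ j → f j * x (q j))
                ≈⟨ ∑-distrib-+ (λ j → x p * (d j * - b (q j))) (λ j → f j * x (q j)) ⟨
              sum (λ j → x p * (d j * - b (q j)) + f j * x (q j)) ≈⟨ sum-cong-≋ (λ j → eliminate (d j) j) ⟩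
              sum (λ j → z * (d j * w j))                         ≈⟨ *-distribˡ-sum z (λ j → d j * w j) ⟨
              z * sum (λ j → d j * w j)                           ≈⟨ *0+ z Σ≈0 ⟩
              0# ∎))
      where
      q = punchIn p
      w : Fin (suc k) → Carrier
      w j = b p * y (q j) + - b (q j) * y p

      A-insertAt : ∀ {n} (p : Fin (suc n)) {e f} → A e → (∀ j → A (f j)) → ∀ j → A (insertAt f p e j)
      A-insertAt         zero    Ae Af zero    = Ae
      A-insertAt         zero    Ae Af (suc j) = Af j
      A-insertAt {suc n} (suc p) Ae Af zero    = Af zero
      A-insertAt {suc n} (suc p) Ae Af (suc j) = A-insertAt p Ae (Af ∘ suc) j

      eliminate : ∀ d j → x p * (d * - b (q j)) + d * b p * x (q j) ≈ z * (d * w j)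
      eliminate d j = begin
        x p * (d * - b (q j)) + d * b p * x (q j)
          ≈⟨ +-cong (*-congʳ (eq p)) (*-congˡ (eq (q j))) ⟩
        (b p + z * y p) * (d * - b (q j)) + d * b p * (b (q j) + z * y (q j))
          ≈⟨ solve 6 (λ z d bp yp bq yq → (bp :+ z :* yp) :* (d :* (:- bq)) :+ d :* bp :* (bq :+ z :* yq)
                                        := z :* (d :* (bp :* yq :+ (:- bq) :* yp))) refl z d (b p) (y p) (b (q j)) (y (q j)) ⟩
        z * (d * w j) ∎

  -- If E ∂ⁿf is a polynomial in z, then so is δ E² ∂ⁿ⁺¹f, by differentiating.
  multiplier : ∀ {s δ f} → A[z] s → ¬ (s ≈ 0#) → A[z] (s * f) →
    A[z] δ → ¬ (δ ≈ 0#) → A[z] (δ * ∂ z) → ∀ n →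
    ∃[ E ] A[z] E × ¬ (E ≈ 0#) × ∃[ J ] (∀ k → k ≤ n → V J (E * fold f ∂ k))
  multiplier {s} {f = f} Ss s≉0 (J , Vsf) Sδ δ≉0 Sδ∂z zero =
    s , Ss , s≉0 , J , λ { zero z≤n → Vsf }
  multiplier {δ = δ} {f} Ss s≉0 Ssf Sδ δ≉0 Sδ∂z (suc n)
    with multiplier Ss s≉0 Ssf Sδ δ≉0 Sδ∂z n
  ... | E , SE , E≉0 , J , VE = δ * E * E , S-* SδE SE , *-≉0 (*-≉0 δ≉0 E≉0) E≉0 , (J₁ ℕ.+ J) ℕ.⊔ J₂ , bound
    where
    SδE = S-* Sδ SE
    S-δ∂ : ∀ {x} → A[z] x → A[z] (δ * ∂ x)
    S-δ∂ {x} (k , Vx) with V-∂ (V-suc Vx)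
    ... | y , w , Vy , Vw , eq = S-resp (begin
      δ * w + y * (δ * ∂ z) ≈⟨ solve 4 (λ δ w y dz → δ :* w :+ y :* (δ :* dz) := δ :* (w :+ y :* dz))
           refl δ w y (∂ z) ⟩
      δ * (w + y * ∂ z)     ≈⟨ *-congˡ eq ⟨
      δ * ∂ x               ∎) (S-+ (S-* Sδ (_ , Vw)) (S-* (_ , Vy) Sδ∂z))
    fₙ = fold f ∂ n
    v = E * fₙ
    Sv : A[z] v
    Sv = J , VE n ℕ.≤-refl
    new : A[z] (δ * E * E * ∂ fₙ)
    -- For v = E ∂ⁿf the product rule gives E ∂v - ∂E v = E² ∂ⁿ⁺¹f; the factor δ brings ∂v and ∂E
    -- into A[z].
    new = S-resp (begin
      E * (δ * ∂ v) + - (δ * ∂ E * v)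
        ≈⟨ +-congʳ (*-congˡ (*-congˡ (∂-* E fₙ))) ⟩
      E * (δ * (∂ E * fₙ + E * ∂ fₙ)) + - (δ * ∂ E * (E * fₙ))
        ≈⟨ solve 5 (λ δ E dE f df → E :* (δ :* (dE :* f :+ E :* df)) :+ :- (δ :* dE :* (E :* f)) := δ :* E :* E :* df)
             refl δ E (∂ E) fₙ (∂ fₙ) ⟩
      δ * E * E * ∂ fₙ ∎)
      (S-+ (S-* SE (S-δ∂ Sv)) (S-neg (S-* (S-δ∂ SE) Sv)))
    J₁ = proj₁ SδE
    J₂ = proj₁ new
    bound : ∀ k → k ≤ suc n → V ((J₁ ℕ.+ J) ℕ.⊔ J₂) (δ * E * E * fold f ∂ k)
    bound k k≤ with ℕ.m≤n⇒m<n∨m≡n k≤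
    ... | inj₁ (s≤s k≤n) = V-mono (ℕ.m≤m⊔n _ J₂)
                             (V-resp (sym (*-assoc _ E _)) (V-* (proj₂ SδE) (VE k k≤n)))
    ... | inj₂ ≡.refl    = V-mono (ℕ.m≤n⊔m (J₁ ℕ.+ J) J₂) (proj₂ new)

  -- Up to a common factor, the ∂ᵏf for k ≤ degree lie in a module of rank degree.
  derivatives-dependent : ∀ {g k f} → A g → ¬ (g ≈ 0#) → Relation g k →
    ¬ (z ≈ 0#) → z * f ≈ ∂ z → ¬ ¬ (∃[ n ] Dependent {n} (λ i → fold f ∂ (toℕ i)))
  derivatives-dependent {k = k} {f} Ag g≉0 rel z≉0 zf≈∂z ¬dep = separable k Ag g≉0 rel λ sep →
    let open Separable sep
        -- The first multiplier is δ z because f stands for ∂z / z, so that δ z f = δ ∂z.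
        E , SE , E≉0 , J , VE = multiplier {s = δ * z} (S-* S-δ S-z) (*-≉0 δ≉0 z≉0)
                                  (S-resp (sym (trans (*-assoc δ z f) (*-congˡ zf≈∂z))) S-δ∂z)
                                  S-δ δ≉0 S-δ∂z degree
        -- J pseudo-divisions bring the bound J + degree down to degree, at the cost of `lead` to
        -- the power J.
        G = lead ^ J
    in dependent degree (λ i → G * (E * fold f ∂ (toℕ i)))
         (λ i → reduce J A-lead relation (V-mono (ℕ.m≤m+n J degree) (VE (toℕ i) (Fin.toℕ≤pred[n] i))))
         λ (d , Ad , nonzero , Σ≈0) → ¬dep (_ , d , Ad , nonzero ,
           cancel E≉0 (cancel (^-≉0 lead≉0 J) (begin
             G * (E * sum (λ i → d i * fold f ∂ (toℕ i)))
               ≈⟨ *-congˡ (*-distribˡ-sum E (λ i → d i * fold f ∂ (toℕ i))) ⟩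
             G * sum (λ i → E * (d i * fold f ∂ (toℕ i)))
               ≈⟨ *-distribˡ-sum G (λ i → E * (d i * fold f ∂ (toℕ i))) ⟩
             sum (λ i → G * (E * (d i * fold f ∂ (toℕ i))))
               ≈⟨ sum-cong-≋ (λ i → solve 4 (λ G E d f → G :* (E :* (d :* f)) := d :* (G :* (E :* f)))
                    refl G E (d i) (fold f ∂ (toℕ i))) ⟩
             sum (λ i → d i * (G * (E * fold f ∂ (toℕ i)))) ≈⟨ Σ≈0 ⟩
             0# ∎)))
    where
    ^-≉0 : ∀ {x} → ¬ (x ≈ 0#) → ∀ n → ¬ (x ^ n ≈ 0#)
    ^-≉0 x≉0 zero    = 1≉0
    ^-≉0 x≉0 (suc n) = *-≉0 x≉0 (^-≉0 x≉0 n)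

  -- The values at z of the nonzero polynomials over A
  Leading : Pred Carrier (c ⊔ ℓ ⊔ a)
  Leading x = ∃[ k ] ∃[ g ] ∃[ y ] A g × ¬ (g ≈ 0#) × V k y × x ≈ y + g * z ^ k

  leading-const : ∀ {x} → A x → ¬ (x ≈ 0#) → Leading x
  leading-const {x} Ax x≉0 = 0 , x , 0# , Ax , x≉0 , nil refl , sym (trans (+-identityˡ _) (*-identityʳ x))

  leading-cons : ∀ {b d x} → A b → A d → ¬ (d ≈ 0#) → Leading x → Leading (b + z * (d * x))
  leading-cons {b} {d} {x} Ab Ad d≉0 (k , g , y , Ag , g≉0 , Vy , x≈) =
    suc k , d * g , b + z * (d * y) , A-* Ad Ag , *-≉0 d≉0 g≉0 , cons Ab (V-· Ad Vy) refl , (begin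
      b + z * (d * x)                             ≈⟨ +-congˡ (*-congˡ (*-congˡ x≈)) ⟩
      b + z * (d * (y + g * z ^ k))
        ≈⟨ solve 6 (λ b z d y g w → b :+ z :* (d :* (y :+ g :* w)) := (b :+ z :* (d :* y)) :+ (d :* g) :* (z :* w))
             refl b z d y g (z ^ k) ⟩
      (b + z * (d * y)) + (d * g) * z ^ suc k     ∎)

  leading-resp : ∀ {x y} → x ≈ y → Leading x → Leading y
  leading-resp x≈y (k , g , w , Ag , g≉0 , Vw , x≈) = k , g , w , Ag , g≉0 , Vw , trans (sym x≈y) x≈

  leading-dependent : ∀ {x f} → Leading x → x ≈ 0# → ¬ (z ≈ 0#) → z * f ≈ ∂ z →
    ¬ ¬ (∃[ n ] Dependent {n} (λ i → fold f ∂ (toℕ i)))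
  leading-dependent (k , g , y , Ag , g≉0 , Vy , x≈) x≈0 =
    derivatives-dependent Ag g≉0 (y , Vy , trans (sym x≈) x≈0)

  clear : ∀ {T U s d num e E E′} → E ≈ T * s + U * (z * E′) → s * d ≈ num →
          T * (num * e) + z * ((U * d) * (e * E′)) ≈ (d * e) * E
  clear {T} {U} {s} {d} {num} {e} {E} {E′} E≈ sd≈num = begin
    T * (num * e) + z * ((U * d) * (e * E′))    ≈⟨ +-congʳ (*-congˡ (*-congʳ sd≈num)) ⟨
    T * (s * d * e) + z * ((U * d) * (e * E′))
      ≈⟨ solve 7 (λ T U s d e z E → T :* (s :* d :* e) :+ z :* ((U :* d) :* (e :* E))
             := (d :* e) :* (T :* s :+ U :* (z :* E)))
           refl T U s d e z E′ ⟩
    (d * e) * (T * s + U * (z * E′))            ≈⟨ *-congˡ E≈ ⟨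
    (d * e) * E ∎

  -- N says that some coefficient is nonzero; if so, a multiple of E is the
  -- value at z of a nonzero polynomial over A.
  record Clearable {n} (E : Carrier) (N : Set n) : Set (c ⊔ ℓ ⊔ a ⊔ n) where
    constructor clearable
    field
      {denominator} : Carrier
      A-denominator : A denominator
      denominator≉0 : ¬ (denominator ≈ 0#)
      cleared       : ¬ ¬ ((E ≈ 0# × ¬ N) ⊎ Leading (denominator * E))

  clearable-nil : ∀ {n} {N : Set n} {E} → E ≈ 0# → ¬ N → Clearable E N
  clearable-nil E≈0 ¬N = clearable A-1 1≉0 λ ¬clear → ¬clear (inj₁ (E≈0 , ¬N))

  -- One Horner step, with T and U the powers of t that addition of Laurent series introduces. If
  -- the rest E′ has a nonzero polynomial as multiple, its leading term survives under z. If E′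
  -- vanishes with all its coefficients, then s decides: nonzero, it gives a constant polynomial;
  -- zero, all coefficients vanish.
  clearable-cons : ∀ {n n′} {N : Set n} {N′ : Set n′} {T U s d E E′} →
    A T → ¬ (T ≈ 0#) → A U → ¬ (U ≈ 0#) → A d → ¬ (d ≈ 0#) → A (s * d) →
    E ≈ T * s + U * (z * E′) → (N → s ≈ 0# → N′) → Clearable E′ N′ → Clearable E N
  clearable-cons {T = T} {U} {s} {d} {E} {E′} AT T≉0 AU U≉0 Ad d≉0 Asd E≈ N⇒N′ (clearable {e} Ae e≉0 clear-E′) =
    clearable (A-* Ad Ae) (*-≉0 d≉0 e≉0) λ ¬clear → clear-E′ λ
      { (inj₁ (E′≈0 , ¬N′)) →
          let s≈0 = ≈0-stable λ s≉0 → ¬clear (inj₂ (leading-resp (trans (sym (drop E′≈0)) (clear E≈ refl))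
                      (leading-const (A-* AT (A-* Asd Ae)) (*-≉0 T≉0 (*-≉0 (*-≉0 s≉0 d≉0) e≉0)))))
          in ¬clear (inj₁ (
            (begin
              E                       ≈⟨ E≈ ⟩
              T * s + U * (z * E′)    ≈⟨ +-cong (*0+ T s≈0) (*0+ U (*0+ z E′≈0)) ⟩
              0# + 0#                 ≈⟨ +-identityˡ 0# ⟩
              0#                      ∎) ,
            λ N → ¬N′ (N⇒N′ N s≈0)))
      ; (inj₂ leading-E′) → ¬clear (inj₂ (leading-resp (clear E≈ refl)
          (leading-cons (A-* AT (A-* Asd Ae)) (A-* AU Ad) (*-≉0 U≉0 d≉0) leading-E′)))
      }
    where
    drop : E′ ≈ 0# → T * (s * d * e) + z * ((U * d) * (e * E′)) ≈ T * (s * d * e)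
    drop E′≈0 = trans (+-congˡ (*0+ z (*0+ (U * d) (*0+ e E′≈0)))) (+-identityʳ _)

  clearable-dependent : ∀ {n} {N : Set n} {E f} → Clearable E N → N → E ≈ 0# → ¬ (z ≈ 0#) → z * f ≈ ∂ z →
    ¬ ¬ (∃[ n ] Dependent {n} (λ i → fold f ∂ (toℕ i)))
  clearable-dependent (clearable {d} _ _ clear-E) N E≈0 z≉0 zf≈∂z ¬dep = clear-E λ
    { (inj₁ (_ , ¬N))  → ¬N N
    ; (inj₂ leading)   → leading-dependent leading (*0+ d E≈0) z≉0 zf≈∂z ¬dep
    }

-- Formal power series, the derivation t d/dt and the exponential

module Series {c ℓ} (R : CommutativeRing c ℓ) where
  open CommutativeRing R hiding (zero)
  open RingProperties ring using (-0#≈0#)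
  open DifferenceSolver R
  open SemiringMult semiring using (×-assoc-*; ×-comm-*; ×-congʳ) renaming (_×_ to _·_)
  open SemiringSum semiring using (sum; sum-cong-≋; ∑-comm; *-distribˡ-sum; *-distribʳ-sum; ∑-distrib-+)
  open CommutativeMonoidMult +-commutativeMonoid using (×-distrib-+)
  open CommutativeSemigroupProperties +-commutativeSemigroup using (x∙yz≈y∙xz)
  open SetoidReasoning setoid

  private
    Seq : Set c
    Seq = ℕ → Carrier

  sum-≈0 : ∀ {n} (f : Fin n → Carrier) → (∀ i → f i ≈ 0#) → sum f ≈ 0#
  sum-≈0 {zero}  f f≈0 = refl
  sum-≈0 {suc n} f f≈0 = trans (+-cong (f≈0 zero) (sum-≈0 (f ∘ suc) (f≈0 ∘ suc))) (+-identityˡ 0#)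

  sum-truncate : ∀ {m n} (f : ℕ → Carrier) → m ≤ n → (∀ k → m ≤ k → f k ≈ 0#) →
                 sum {n} (f ∘ toℕ) ≈ sum {m} (f ∘ toℕ)
  sum-truncate {n = n} f z≤n f≈0 = sum-≈0 {n} (f ∘ toℕ) (λ i → f≈0 (toℕ i) z≤n)
  sum-truncate f (s≤s m≤n) f≈0 = +-congˡ (sum-truncate (f ∘ suc) m≤n (λ k m≤k → f≈0 (suc k) (s≤s m≤k)))

  infix 4 _≋_
  _≋_ : Seq → Seq → Set ℓ
  s ≋ u = ∀ n → s n ≈ u n

  infixl 6 _⊞_
  _⊞_ : Seq → Seq → Seq
  (s ⊞ u) n = s n + u n

  ⊟_ : Seq → Seq
  (⊟ s) n = - s n

  𝟘 𝟙 : Seq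
  𝟘 _       = 0#
  𝟙 zero    = 1#
  𝟙 (suc _) = 0#

  tail : Seq → Seq
  tail s n = s (suc n)

  infixl 7 _⊠_
  -- Over ℚ this unfolds to the same convolution as `_⊛_`, so what follows applies to the series of
  -- the statement by definition.
  _⊠_ : Seq → Seq → Seq
  (s ⊠ u) n = sum {suc n} λ i → s (toℕ i) * u (n ℕ.∸ toℕ i)

  ⊠-cong : ∀ {s s′ u u′} → s ≋ s′ → u ≋ u′ → s ⊠ u ≋ s′ ⊠ u′
  ⊠-cong s≋ u≋ n = sum-cong-≋ {n = suc n} λ i → *-cong (s≋ (toℕ i)) (u≋ (n ℕ.∸ toℕ i))

  ⊠-0 : ∀ s u → (s ⊠ u) 0 ≈ s 0 * u 0
  ⊠-0 s u = +-identityʳ _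

  -- The product unfolds by splitting off s 0. Splitting off u 0 instead is the symmetric
  -- counterpart that drives the induction for `⊠-comm`.
  ⊠-tailʳ : ∀ s u n → (s ⊠ u) (suc n) ≈ s (suc n) * u 0 + (s ⊠ tail u) n
  ⊠-tailʳ s u zero    = begin
    s 0 * u 1 + (s 1 * u 0 + 0#) ≈⟨ x∙yz≈y∙xz _ _ _ ⟩
    s 1 * u 0 + (s 0 * u 1 + 0#) ∎
  ⊠-tailʳ s u (suc n) = begin
    s 0 * u (suc (suc n)) + (tail s ⊠ u) (suc n)
      ≈⟨ +-congˡ (⊠-tailʳ (tail s) u n) ⟩
    s 0 * u (suc (suc n)) + (s (suc (suc n)) * u 0 + (tail s ⊠ tail u) n)
      ≈⟨ x∙yz≈y∙xz _ _ _ ⟩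
    s (suc (suc n)) * u 0 + (s ⊠ tail u) (suc n) ∎

  ⊠-comm : ∀ s u → s ⊠ u ≋ u ⊠ s
  ⊠-comm s u zero    = +-congʳ (*-comm (s 0) (u 0))
  ⊠-comm s u (suc n) = begin
    s 0 * u (suc n) + (tail s ⊠ u) n ≈⟨ +-cong (*-comm _ _) (⊠-comm (tail s) u n) ⟩
    u (suc n) * s 0 + (u ⊠ tail s) n ≈⟨ ⊠-tailʳ u s n ⟨
    (u ⊠ s) (suc n)                  ∎

  ⊠-distribʳ : ∀ w s u → (s ⊞ u) ⊠ w ≋ (s ⊠ w) ⊞ (u ⊠ w)
  ⊠-distribʳ w s u n = trans
    (sum-cong-≋ {n = suc n} λ i → distribʳ (w (n ℕ.∸ toℕ i)) (s (toℕ i)) (u (toℕ i)))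
    (∑-distrib-+ {suc n} (λ i → s (toℕ i) * w (n ℕ.∸ toℕ i)) (λ i → u (toℕ i) * w (n ℕ.∸ toℕ i)))

  ⊠-scaleˡ : ∀ a s w → (λ n → a * s n) ⊠ w ≋ (λ n → a * (s ⊠ w) n)
  ⊠-scaleˡ a s w n = trans
    (sum-cong-≋ {n = suc n} λ i → *-assoc a (s (toℕ i)) (w (n ℕ.∸ toℕ i)))
    (sym (*-distribˡ-sum {suc n} a (λ i → s (toℕ i) * w (n ℕ.∸ toℕ i))))

  ⊠-zeroˡ : ∀ {s} → s ≋ 𝟘 → ∀ u → s ⊠ u ≋ 𝟘
  ⊠-zeroˡ s≋0 u zero    = trans (+-identityʳ _) (trans (*-congʳ (s≋0 0)) (zeroˡ _))
  ⊠-zeroˡ s≋0 u (suc n) = trans (+-cong (trans (*-congʳ (s≋0 0)) (zeroˡ _)) (⊠-zeroˡ (s≋0 ∘ suc) u n)) (+-identityˡ 0#)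

  ⊠-identityˡ : ∀ s → 𝟙 ⊠ s ≋ s
  ⊠-identityˡ s zero    = trans (+-identityʳ _) (*-identityˡ (s 0))
  ⊠-identityˡ s (suc n) = trans (+-cong (*-identityˡ _) (⊠-zeroˡ (λ _ → refl) s n)) (+-identityʳ _)

  ⊠-assoc : ∀ s u w → (s ⊠ u) ⊠ w ≋ s ⊠ (u ⊠ w)
  ⊠-assoc s u w zero    = begin
    (s 0 * u 0 + 0#) * w 0 + 0# ≈⟨ +-congʳ (*-congʳ (+-identityʳ _)) ⟩
    s 0 * u 0 * w 0 + 0#        ≈⟨ +-congʳ (*-assoc _ _ _) ⟩
    s 0 * (u 0 * w 0) + 0#      ≈⟨ +-congʳ (*-congˡ (+-identityʳ _)) ⟨
    s 0 * (u 0 * w 0 + 0#) + 0# ∎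
  ⊠-assoc s u w (suc n) = begin
    (s ⊠ u) 0 * w (suc n) + (((λ k → s 0 * u (suc k)) ⊞ (tail s ⊠ u)) ⊠ w) n
      ≈⟨ +-cong (*-congʳ (⊠-0 s u)) (⊠-distribʳ w (λ k → s 0 * u (suc k)) (tail s ⊠ u) n) ⟩
    s 0 * u 0 * w (suc n) + (((λ k → s 0 * u (suc k)) ⊠ w) n + ((tail s ⊠ u) ⊠ w) n)
      ≈⟨ +-cong (*-assoc _ _ _) (+-cong (⊠-scaleˡ (s 0) (tail u) w n) (⊠-assoc (tail s) u w n)) ⟩
    s 0 * (u 0 * w (suc n)) + (s 0 * (tail u ⊠ w) n + (tail s ⊠ (u ⊠ w)) n)
      ≈⟨ +-assoc _ _ _ ⟨
    s 0 * (u 0 * w (suc n)) + s 0 * (tail u ⊠ w) n + (tail s ⊠ (u ⊠ w)) n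
      ≈⟨ +-congʳ (distribˡ _ _ _) ⟨
    s 0 * (u ⊠ w) (suc n) + (tail s ⊠ (u ⊠ w)) n ∎

  commutativeRing : CommutativeRing c ℓ
  commutativeRing = record
    { Carrier = Seq
    ; _≈_     = _≋_
    ; _+_     = _⊞_
    ; _*_     = _⊠_
    ; -_      = ⊟_
    ; 0#      = 𝟘
    ; 1#      = 𝟙
    ; isCommutativeRing = record
      { isRing = record
        { +-isAbelianGroup = record
          { isGroup = record
            { isMonoid = record
              { isSemigroup = record
                { isMagma = record
                  { isEquivalence = record
                    { refl  = λ _ → refl
                    ; sym   = λ eq n → sym (eq n)
                    ; trans = λ eq eq′ n → trans (eq n) (eq′ n)
                    }
                  ; ∙-cong = λ eq eq′ n → +-cong (eq n) (eq′ n)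
                  }
                ; assoc = λ s u w n → +-assoc (s n) (u n) (w n)
                }
              ; identity = (λ s n → +-identityˡ (s n)) , (λ s n → +-identityʳ (s n))
              }
            ; inverse = (λ s n → -‿inverseˡ (s n)) , (λ s n → -‿inverseʳ (s n))
            ; ⁻¹-cong = λ eq n → -‿cong (eq n)
            }
          ; comm = λ s u n → +-comm (s n) (u n)
          }
        ; *-cong     = ⊠-cong
        ; *-assoc    = ⊠-assoc
        ; *-identity = ⊠-identityˡ , (λ s n → trans (⊠-comm s 𝟙 n) (⊠-identityˡ s n))
        ; distrib    = (λ s u w n → begin
              (s ⊠ (u ⊞ w)) n         ≈⟨ ⊠-comm s (u ⊞ w) n ⟩
              ((u ⊞ w) ⊠ s) n         ≈⟨ ⊠-distribʳ s u w n ⟩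
              (u ⊠ s) n + (w ⊠ s) n   ≈⟨ +-cong (⊠-comm u s n) (⊠-comm w s n) ⟩
              (s ⊠ u) n + (s ⊠ w) n   ∎) ,
            ⊠-distribʳ
        }
      ; *-comm = ⊠-comm
      }
    }

  -- t d/dt
  θ : Seq → Seq
  θ s n = n · s n

  -- Induction along `tail`, for which tail (θ s) is tail s ⊞ θ (tail s) by definition.
  θ-⊠ : ∀ s u → θ (s ⊠ u) ≋ (θ s ⊠ u) ⊞ (s ⊠ θ u)
  θ-⊠ s u zero    = sym (begin
    (0# * u 0 + 0#) + (s 0 * 0# + 0#) ≈⟨ +-cong (+-identityʳ _) (+-identityʳ _) ⟩
    0# * u 0 + s 0 * 0#               ≈⟨ +-cong (zeroˡ _) (zeroʳ _) ⟩
    0# + 0#                           ≈⟨ +-identityˡ 0# ⟩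
    0#                                ∎)
  θ-⊠ s u (suc n) = begin
    suc n · (s 0 * u (suc n) + (tail s ⊠ u) n)
      ≈⟨ ×-distrib-+ _ _ (suc n) ⟩
    suc n · (s 0 * u (suc n)) + ((tail s ⊠ u) n + θ (tail s ⊠ u) n)
      ≈⟨ +-cong (sym (×-comm-* (suc n) _ _)) (+-congˡ (θ-⊠ (tail s) u n)) ⟩
    s 0 * θ u (suc n) + ((tail s ⊠ u) n + ((θ (tail s) ⊠ u) n + (tail s ⊠ θ u) n))
      ≈⟨ solve 4 (λ a b c d → a :+ (b :+ (c :+ d)) := (b :+ c) :+ (a :+ d))
           refl (s 0 * θ u (suc n)) ((tail s ⊠ u) n) ((θ (tail s) ⊠ u) n) ((tail s ⊠ θ u) n) ⟩
    ((tail s ⊠ u) n + (θ (tail s) ⊠ u) n) + (s ⊠ θ u) (suc n)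
      ≈⟨ +-congʳ (⊠-distribʳ u (tail s) (θ (tail s)) n) ⟨
    (tail (θ s) ⊠ u) n + (s ⊠ θ u) (suc n)
      ≈⟨ +-congʳ (trans (+-congʳ (zeroˡ _)) (+-identityˡ _)) ⟨
    (θ s ⊠ u) (suc n) + (s ⊠ θ u) (suc n) ∎

  Finite : Pred Seq ℓ
  Finite s = ∃[ N ] (∀ n → N ≤ n → s n ≈ 0#)

  Finite-⊠ : ∀ N {s u M} → (∀ n → N ≤ n → s n ≈ 0#) → (∀ n → M ≤ n → u n ≈ 0#) →
             ∀ n → N ℕ.+ M ≤ n → (s ⊠ u) n ≈ 0#
  Finite-⊠ zero    {u = u} s≈0 u≈0 n _ = ⊠-zeroˡ (λ n → s≈0 n z≤n) u n
  Finite-⊠ (suc N) {s} {u} {M} s≈0 u≈0 (suc n) (s≤s N+M≤n) = begin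
    s 0 * u (suc n) + (tail s ⊠ u) n
      ≈⟨ +-cong (trans (*-congˡ (u≈0 (suc n) (ℕ.m≤n⇒m≤1+n (ℕ.≤-trans (ℕ.m≤n+m M N) N+M≤n)))) (zeroʳ _))
                (Finite-⊠ N (λ k N≤k → s≈0 (suc k) (s≤s N≤k)) u≈0 n N+M≤n) ⟩
    0# + 0# ≈⟨ +-identityˡ 0# ⟩
    0#      ∎

  ·-≈0 : ∀ n {x} → x ≈ 0# → n · x ≈ 0#
  ·-≈0 zero    x≈0 = refl
  ·-≈0 (suc n) x≈0 = trans (+-cong x≈0 (·-≈0 n x≈0)) (+-identityˡ 0#)

  module _ (≈0-stable : ∀ {x} → ¬ ¬ (x ≈ 0#) → x ≈ 0#)
           (cancel : ∀ {x y} → ¬ (x ≈ 0#) → x * y ≈ 0# → y ≈ 0#)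
           (·-cancel : ∀ n {x} → suc n · x ≈ 0# → x ≈ 0#)
           (1≉0 : ¬ (1# ≈ 0#)) where

    ⊠-cancel₀ : ∀ s u → ¬ (s 0 ≈ 0#) → s ⊠ u ≋ 𝟘 → u ≋ 𝟘
    ⊠-cancel₀ s u s₀≉0 su≋0 zero = cancel s₀≉0 (trans (sym (+-identityʳ _)) (su≋0 0))
    ⊠-cancel₀ s u s₀≉0 su≋0 (suc n) = ⊠-cancel₀ s (tail u) s₀≉0 (λ k → begin
      (s ⊠ tail u) k                   ≈⟨ +-identityˡ _ ⟨
      0# + (s ⊠ tail u) k              ≈⟨ +-congʳ (trans (*-congˡ (⊠-cancel₀ s u s₀≉0 su≋0 0)) (zeroʳ _)) ⟨
      s (suc k) * u 0 + (s ⊠ tail u) k ≈⟨ ⊠-tailʳ s u k ⟨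
      (s ⊠ u) (suc k)                  ≈⟨ su≋0 (suc k) ⟩
      0#                               ∎) n

    -- The order of s is not computed; an index m with s m nonzero merely bounds it. By stability s
    -- 0 may be taken to vanish, as otherwise `⊠-cancel₀` applies, and the bound for `tail s` is
    -- smaller by one.
    ⊠-cancelₘ : ∀ m s u → ¬ (s m ≈ 0#) → s ⊠ u ≋ 𝟘 → u ≋ 𝟘
    ⊠-cancelₘ zero    s u sₘ≉0 su≋0 = ⊠-cancel₀ s u sₘ≉0 su≋0
    ⊠-cancelₘ (suc m) s u sₘ≉0 su≋0 n = ≈0-stable λ uₙ≉0 →
      let s₀≈0 = ≈0-stable λ s₀≉0 → uₙ≉0 (⊠-cancel₀ s u s₀≉0 su≋0 n)
      in uₙ≉0 (⊠-cancelₘ m (tail s) u sₘ≉0 (λ k → begin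
        (tail s ⊠ u) k                   ≈⟨ +-identityˡ _ ⟨
        0# + (tail s ⊠ u) k              ≈⟨ +-congʳ (trans (*-congʳ s₀≈0) (zeroˡ _)) ⟨
        s 0 * u (suc k) + (tail s ⊠ u) k ≈⟨ su≋0 (suc k) ⟩
        0#                               ∎) n)

    differentialDomain : DifferentialDomain c ℓ
    differentialDomain = record
      { commutativeRing = commutativeRing
      ; ≈0-stable = λ ¬s≉0 n → ≈0-stable λ sₙ≉0 → ¬s≉0 λ s≋0 → sₙ≉0 (s≋0 n)
      ; cancel    = λ {s} {u} s≉0 su≋0 n → ≈0-stable λ uₙ≉0 → s≉0 λ m → ≈0-stable λ sₘ≉0 →
                      uₙ≉0 (⊠-cancelₘ m s u sₘ≉0 su≋0 n)
      ; ·-cancel  = λ n {s} eq k → ·-cancel n (trans (sym (·-pointwise (suc n) s k)) (eq k))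
      ; 1≉0       = λ 𝟙≋𝟘 → 1≉0 (𝟙≋𝟘 0)
      ; ∂         = θ
      ; ∂-cong    = λ eq n → ×-congʳ n (eq n)
      ; ∂-+       = λ s u n → ×-distrib-+ (s n) (u n) n
      ; ∂-*       = θ-⊠
      }
      where
      open SemiringMult (CommutativeRing.semiring commutativeRing) using () renaming (_×_ to _·ₛ_)

      ·-pointwise : ∀ n s k → (n ·ₛ s) k ≈ n · s k
      ·-pointwise zero    s k = refl
      ·-pointwise (suc n) s k = +-congˡ (·-pointwise n s k)

    finite : DifferentialSubring differentialDomain ℓ
    finite = record
      { A      = Finite
      ; A-resp = λ s≋u (N , s≈0) → N , λ n N≤n → trans (sym (s≋u n)) (s≈0 n N≤n)
      ; A-0    = 0 , λ _ _ → refl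
      ; A-1    = 1 , λ { (suc n) _ → refl }
      ; A-+    = λ (N , s≈0) (M , u≈0) → N ℕ.⊔ M , λ n N⊔M≤n →
                   trans (+-cong (s≈0 n (ℕ.m⊔n≤o⇒m≤o N M N⊔M≤n)) (u≈0 n (ℕ.m⊔n≤o⇒n≤o N M N⊔M≤n))) (+-identityˡ 0#)
      ; A-*    = λ (N , s≈0) (M , u≈0) → N ℕ.+ M , Finite-⊠ N s≈0 u≈0
      ; A-neg  = λ (N , s≈0) → N , λ n N≤n → trans (-‿cong (s≈0 n N≤n)) -0#≈0#
      ; A-∂    = λ (N , s≈0) → N , λ n N≤n → ·-≈0 n (s≈0 n N≤n)
      }

  module Exponential (1/_! : ℕ → Carrier) (1/suc! : ∀ k → suc k · (1/ suc k !) ≈ 1/ k !) where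

    infixr 8 _^ₙ_
    _^ₙ_ : Seq → ℕ → Seq
    s ^ₙ k = fold 𝟙 (s ⊠_) k

    expₙ : Seq → Seq
    expₙ s n = sum {suc n} λ k → (s ^ₙ toℕ k) n * 1/ toℕ k !

    -- In `expₙ` the length of the sum grows with the index n. A fixed length N lets the sum be
    -- exchanged with convolutions.
    partial : ℕ → Seq → Seq
    partial N s n = sum {N} λ k → (s ^ₙ toℕ k) n * 1/ toℕ k !

    ^ₙ-vanishes : ∀ {s} → s 0 ≈ 0# → ∀ k n → n ℕ.< k → (s ^ₙ k) n ≈ 0#
    ^ₙ-vanishes s₀≈0 (suc k) zero    _ = trans (+-identityʳ _) (trans (*-congʳ s₀≈0) (zeroˡ _))
    ^ₙ-vanishes {s} s₀≈0 (suc k) (suc n) (s≤s n<k) = begin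
      s 0 * (s ^ₙ k) (suc n) + (tail s ⊠ s ^ₙ k) n
        ≈⟨ +-cong (trans (*-congʳ s₀≈0) (zeroˡ _))
                  (sum-≈0 {suc n} (λ i → tail s (toℕ i) * (s ^ₙ k) (n ℕ.∸ toℕ i)) λ i →
                    trans (*-congˡ (^ₙ-vanishes {s} s₀≈0 k _ (ℕ.≤-<-trans (ℕ.m∸n≤m n (toℕ i)) n<k))) (zeroʳ _)) ⟩
      0# + 0# ≈⟨ +-identityˡ 0# ⟩
      0#      ∎

    partial≈exp : ∀ {s} → s 0 ≈ 0# → ∀ {N} n → n ℕ.< N → partial N s n ≈ expₙ s n
    partial≈exp {s} s₀≈0 n n<N = sum-truncate (λ k → (s ^ₙ k) n * 1/ k !) n<N
      λ k n<k → trans (*-congʳ (^ₙ-vanishes {s} s₀≈0 k n n<k)) (zeroˡ _)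

    θ-𝟙 : θ 𝟙 ≋ 𝟘
    θ-𝟙 zero    = refl
    θ-𝟙 (suc n) = ·-≈0 (suc n) refl

    θ-^ₙ : ∀ s k n → θ (s ^ₙ suc k) n ≈ suc k · (θ s ⊠ s ^ₙ k) n
    θ-^ₙ s zero n = begin
      θ (s ⊠ 𝟙) n                   ≈⟨ θ-⊠ s 𝟙 n ⟩
      (θ s ⊠ 𝟙) n + (s ⊠ θ 𝟙) n     ≈⟨ +-congˡ (trans (⊠-comm s (θ 𝟙) n) (⊠-zeroˡ {θ 𝟙} θ-𝟙 s n)) ⟩
      (θ s ⊠ 𝟙) n + 0#              ∎
    θ-^ₙ s (suc k) n = begin
      θ (s ⊠ s ^ₙ suc k) n                                   ≈⟨ θ-⊠ s (s ^ₙ suc k) n ⟩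
      (θ s ⊠ s ^ₙ suc k) n + (s ⊠ θ (s ^ₙ suc k)) n
        ≈⟨ +-congˡ (⊠-cong {s} {s} {θ (s ^ₙ suc k)} {λ m → suc k · (θ s ⊠ s ^ₙ k) m} (λ _ → refl) (θ-^ₙ s k) n) ⟩
      (θ s ⊠ s ^ₙ suc k) n + (s ⊠ (λ m → suc k · (θ s ⊠ s ^ₙ k) m)) n
        ≈⟨ +-congˡ (⊠-· (suc k) s (θ s ⊠ s ^ₙ k) n) ⟩
      (θ s ⊠ s ^ₙ suc k) n + suc k · (s ⊠ (θ s ⊠ s ^ₙ k)) n
        ≈⟨ +-congˡ (×-congʳ (suc k) (begin
             (s ⊠ (θ s ⊠ s ^ₙ k)) n ≈⟨ ⊠-assoc s (θ s) (s ^ₙ k) n ⟨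
             ((s ⊠ θ s) ⊠ s ^ₙ k) n ≈⟨ ⊠-cong {s ⊠ θ s} {θ s ⊠ s} {s ^ₙ k} {s ^ₙ k} (⊠-comm s (θ s)) (λ _ → refl) n ⟩
             ((θ s ⊠ s) ⊠ s ^ₙ k) n ≈⟨ ⊠-assoc (θ s) s (s ^ₙ k) n ⟩
             (θ s ⊠ s ^ₙ suc k) n   ∎)) ⟩
      (θ s ⊠ s ^ₙ suc k) n + suc k · (θ s ⊠ s ^ₙ suc k) n ∎
      where
      ⊠-· : ∀ j s w n → (s ⊠ (λ m → j · w m)) n ≈ j · (s ⊠ w) n
      ⊠-· zero    s w n = trans (⊠-comm s 𝟘 n) (⊠-zeroˡ {𝟘} (λ _ → refl) s n)
      ⊠-· (suc j) s w n = begin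
        (s ⊠ (w ⊞ λ m → j · w m)) n               ≈⟨ CommutativeRing.distribˡ commutativeRing s w (λ m → j · w m) n ⟩
        (s ⊠ w) n + (s ⊠ (λ m → j · w m)) n       ≈⟨ +-congˡ (⊠-· j s w n) ⟩
        (s ⊠ w) n + j · (s ⊠ w) n                 ∎

    ⊠-partial : ∀ x N s n → (x ⊠ partial N s) n ≈ sum {N} λ k → (x ⊠ s ^ₙ toℕ k) n * 1/ toℕ k !
    ⊠-partial x N s n = begin
      sum {suc n} (λ i → x (toℕ i) * sum {N} λ k → w k i * 1/ toℕ k !)
        ≈⟨ sum-cong-≋ {suc n} (λ i → trans (*-distribˡ-sum {N} (x (toℕ i)) (λ k → w k i * 1/ toℕ k !))
                                           (sum-cong-≋ {N} λ k → sym (*-assoc (x (toℕ i)) (w k i) (1/ toℕ k !)))) ⟩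
      sum {suc n} (λ i → sum {N} λ k → x (toℕ i) * w k i * 1/ toℕ k !)
        ≈⟨ ∑-comm {suc n} {N} (λ i k → x (toℕ i) * w k i * 1/ toℕ k !) ⟩
      sum {N} (λ k → sum {suc n} λ i → x (toℕ i) * w k i * 1/ toℕ k !)
        ≈⟨ sum-cong-≋ {N} (λ k → *-distribʳ-sum {suc n} (1/ toℕ k !) (λ i → x (toℕ i) * w k i)) ⟨
      sum {N} (λ k → (x ⊠ s ^ₙ toℕ k) n * 1/ toℕ k !) ∎
      where
      w : Fin N → Fin (suc n) → Carrier
      w k i = (s ^ₙ toℕ k) (n ℕ.∸ toℕ i)

    -- Term by term, θ (s^(k+1) / (k+1)!) = θs · s^k / k!. The constant term drops out, which costs
    -- one term of the truncation.
    θ-partial : ∀ N s n → θ (partial (suc N) s) n ≈ (θ s ⊠ partial N s) n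
    θ-partial N s n = begin
      n · (𝟙 n * 1/ 0 ! + rest)    ≈⟨ ×-distrib-+ _ _ n ⟩
      n · (𝟙 n * 1/ 0 !) + n · rest ≈⟨ +-congʳ (trans (sym (×-assoc-* n (𝟙 n) (1/ 0 !))) (trans (*-congʳ (θ-𝟙 n)) (zeroˡ _))) ⟩
      0# + n · rest               ≈⟨ +-identityˡ _ ⟩
      n · rest                    ≈⟨ ·-sum n {N} (λ k → (s ^ₙ suc (toℕ k)) n * 1/ suc (toℕ k) !) ⟩
      sum {N} (λ k → n · ((s ^ₙ suc (toℕ k)) n * 1/ suc (toℕ k) !)) ≈⟨ sum-cong-≋ {N} (λ k → term (toℕ k)) ⟩
      sum {N} (λ k → (θ s ⊠ s ^ₙ toℕ k) n * 1/ toℕ k !) ≈⟨ ⊠-partial (θ s) N s n ⟨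
      (θ s ⊠ partial N s) n       ∎
      where
      rest : Carrier
      rest = sum {N} λ k → (s ^ₙ suc (toℕ k)) n * 1/ suc (toℕ k) !

      ·-sum : ∀ j {N} (f : Fin N → Carrier) → j · sum f ≈ sum λ k → j · f k
      ·-sum j {zero}  f = ·-≈0 j refl
      ·-sum j {suc N} f = trans (×-distrib-+ _ _ j) (+-congˡ (·-sum j (f ∘ suc)))

      term : ∀ k → n · ((s ^ₙ suc k) n * 1/ suc k !) ≈ (θ s ⊠ s ^ₙ k) n * 1/ k !
      term k = begin
        n · ((s ^ₙ suc k) n * 1/ suc k !)           ≈⟨ ×-assoc-* n _ _ ⟨
        θ (s ^ₙ suc k) n * 1/ suc k !               ≈⟨ *-congʳ (θ-^ₙ s k n) ⟩
        suc k · (θ s ⊠ s ^ₙ k) n * 1/ suc k !       ≈⟨ ×-assoc-* (suc k) _ _ ⟩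
        suc k · ((θ s ⊠ s ^ₙ k) n * 1/ suc k !)     ≈⟨ ×-comm-* (suc k) _ _ ⟨
        (θ s ⊠ s ^ₙ k) n * (suc k · 1/ suc k !)     ≈⟨ *-congˡ (1/suc! k) ⟩
        (θ s ⊠ s ^ₙ k) n * 1/ k !                   ∎

    θ-exp : ∀ {s} → s 0 ≈ 0# → θ (expₙ s) ≋ θ s ⊠ expₙ s
    θ-exp {s} s₀≈0 n = begin
      -- Both sides need a truncation longer than n, and `θ-partial` shortens it by one; hence
      -- `suc (suc n)`.
      θ (expₙ s) n                        ≈⟨ ×-congʳ n (partial≈exp {s} s₀≈0 n (ℕ.m<n⇒m<1+n (ℕ.n<1+n n))) ⟨
      θ (partial (suc (suc n)) s) n       ≈⟨ θ-partial (suc n) s n ⟩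
      (θ s ⊠ partial (suc n) s) n
        ≈⟨ sum-cong-≋ {suc n} (λ i → *-congˡ {θ s (toℕ i)} (partial≈exp {s} s₀≈0 (n ℕ.∸ toℕ i) (s≤s (ℕ.m∸n≤m n (toℕ i))))) ⟩
      (θ s ⊠ expₙ s) n ∎

-- The exponent of p in m^x - 1

∣m+n∣n⇒∣m : ∀ {i m n} → i ∣ m ℕ.+ n → i ∣ n → i ∣ m
∣m+n∣n⇒∣m {i} {m} {n} i∣m+n = ℕ.∣m+n∣m⇒∣n (≡.subst (i ∣_) (ℕ.+-comm m n) i∣m+n)

module Valuation (p : ℕ) (prime : Prime p) where
  private instance
    p≢0 : ℕ.NonZero p
    p≢0 = prime⇒nonZero prime

    p>1 : ℕ.NonTrivial p
    p>1 = prime⇒nonTrivial prime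

  p^-mono-∣ : ∀ {v w} → v ≤ w → p ℕ.^ v ∣ p ℕ.^ w
  p^-mono-∣ {v} v≤w = ≡.subst (p ℕ.^ v ∣_)
    (≡.trans (≡.sym (ℕ.^-distribˡ-+-* p v _)) (≡.cong (p ℕ.^_) (ℕ.m+[n∸m]≡n v≤w)))
    (ℕ.m∣m*n _)

  p∤1 : p ∤ 1
  p∤1 p∣1 = ℕ.nonTrivial⇒≢1 (ℕ.∣1⇒≡1 p∣1)

  p∤* : ∀ {m n} → p ∤ m → p ∤ n → p ∤ m ℕ.* n
  p∤* {m} {n} p∤m p∤n p∣mn with euclidsLemma m n prime p∣mn
  ... | inj₁ p∣m = p∤m p∣m
  ... | inj₂ p∣n = p∤n p∣n

  p∤^ : ∀ {m} → p ∤ m → ∀ n → p ∤ m ℕ.^ n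
  p∤^ p∤m zero    = p∤1
  p∤^ p∤m (suc n) = p∤* p∤m (p∤^ p∤m n)

  p^∣-cancelˡ : ∀ v {m n} → p ∤ m → p ℕ.^ v ∣ m ℕ.* n → p ℕ.^ v ∣ n
  p^∣-cancelˡ zero    {n = n} p∤m _ = ℕ.1∣ n
  p^∣-cancelˡ (suc v) {m} {n} p∤m pᵛ⁺¹∣mn with euclidsLemma m n prime (ℕ.∣-trans (ℕ.m∣m*n (p ℕ.^ v)) pᵛ⁺¹∣mn)
  ... | inj₁ p∣m = contradiction p∣m p∤m
  ... | inj₂ (divides q ≡.refl) = ≡.subst (p ℕ.^ suc v ∣_) (ℕ.*-comm p q)
    (ℕ.*-monoʳ-∣ p (p^∣-cancelˡ v p∤m (ℕ.*-cancelˡ-∣ p (≡.subst (p ℕ.^ suc v ∣_) (m*[q*p]≡p*[m*q]) pᵛ⁺¹∣mn))))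
    where
    m*[q*p]≡p*[m*q] : m ℕ.* (q ℕ.* p) ≡ p ℕ.* (m ℕ.* q)
    m*[q*p]≡p*[m*q] = ≡.trans (≡.sym (ℕ.*-assoc m q p)) (ℕ.*-comm (m ℕ.* q) p)

  Val : ℕ → ℕ → Set
  Val v n = p ℕ.^ v ∣ n × p ℕ.^ suc v ∤ n

  Val-unique : ∀ {v w n} → Val v n → Val w n → v ≡ w
  Val-unique {v} {w} (pᵛ∣n , pᵛ⁺¹∤n) (pʷ∣n , pʷ⁺¹∤n) = ℕ.≤-antisym
    (ℕ.≮⇒≥ λ w<v → pʷ⁺¹∤n (ℕ.∣-trans (p^-mono-∣ w<v) pᵛ∣n))
    (ℕ.≮⇒≥ λ v<w → pᵛ⁺¹∤n (ℕ.∣-trans (p^-mono-∣ v<w) pʷ∣n))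

  Val-*ˡ : ∀ {v m n} → p ∤ m → Val v n → Val v (m ℕ.* n)
  Val-*ˡ {v} {m} p∤m (pᵛ∣n , pᵛ⁺¹∤n) = ℕ.∣n⇒∣m*n m pᵛ∣n , pᵛ⁺¹∤n ∘ p^∣-cancelˡ (suc v) p∤m

  Val-cancelˡ : ∀ {v m n} → p ∤ m → Val v (m ℕ.* n) → Val v n
  Val-cancelˡ {v} {m} p∤m (pᵛ∣mn , pᵛ⁺¹∤mn) = p^∣-cancelˡ v p∤m pᵛ∣mn , pᵛ⁺¹∤mn ∘ ℕ.∣n⇒∣m*n m

  Val-+ : ∀ {K v m n} → v ℕ.< K → p ℕ.^ K ∣ m → Val v n → Val v (m ℕ.+ n)
  Val-+ v<K pᴷ∣m (pᵛ∣n , pᵛ⁺¹∤n) =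
    ℕ.∣m∣n⇒∣m+n (ℕ.∣-trans (p^-mono-∣ (ℕ.<⇒≤ v<K)) pᴷ∣m) pᵛ∣n ,
    λ pᵛ⁺¹∣m+n → pᵛ⁺¹∤n (ℕ.∣m+n∣m⇒∣n pᵛ⁺¹∣m+n (ℕ.∣-trans (p^-mono-∣ v<K) pᴷ∣m))

  -- The valuation of (m + n) - n, phrased without subtraction.
  Val-complement : ∀ {K v m n} → v ℕ.< K → p ℕ.^ K ∣ m ℕ.+ n → Val v n → Val v m
  Val-complement v<K pᴷ∣m+n (pᵛ∣n , pᵛ⁺¹∤n) =
    ∣m+n∣n⇒∣m (ℕ.∣-trans (p^-mono-∣ (ℕ.<⇒≤ v<K)) pᴷ∣m+n) pᵛ∣n ,
    λ pᵛ⁺¹∣m → pᵛ⁺¹∤n (ℕ.∣m+n∣m⇒∣n (ℕ.∣-trans (p^-mono-∣ v<K) pᴷ∣m+n) pᵛ⁺¹∣m)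

  decompose : ∀ n → ∃[ v ] ∃[ u ] n ≡ p ℕ.^ v ℕ.* u × (0 ℕ.< n → p ∤ u)
  decompose = ℕ.<-rec _ go
    where
    go : ∀ n → (∀ {k} → k ℕ.< n → ∃[ v ] ∃[ u ] k ≡ p ℕ.^ v ℕ.* u × (0 ℕ.< k → p ∤ u)) →
         ∃[ v ] ∃[ u ] n ≡ p ℕ.^ v ℕ.* u × (0 ℕ.< n → p ∤ u)
    go zero      rec = 0 , 0 , ≡.refl , λ ()
    go n@(suc _) rec with p ℕ.∣? n
    ... | no  p∤n = 0 , n , ≡.sym (ℕ.*-identityˡ n) , λ _ → p∤n
    ... | yes p∣n with rec (ℕ.quotient-< p∣n)
    ... | v , u , q≡pᵛu , p∤u = suc v , u ,
      ≡.trans (ℕ._∣_.equality p∣n) (≡.trans (≡.cong (ℕ._* p) q≡pᵛu) (≡.trans (ℕ.*-comm _ p) (≡.sym (ℕ.*-assoc p _ u)))) ,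
      λ _ → p∤u (ℕ.n≢0⇒n>0 λ q≡0 → ℕ.1+n≢0 (≡.trans (ℕ._∣_.equality p∣n) (≡.cong (ℕ._* p) q≡0)))

  Val-p^* : ∀ v {u} → p ∤ u → Val v (p ℕ.^ v ℕ.* u)
  Val-p^* v {u} p∤u = ℕ.m∣m*n u , λ pᵛ⁺¹∣pᵛu → p∤u (ℕ.*-cancelˡ-∣ (p ℕ.^ v) {{ℕ.m^n≢0 p v}}
    (≡.subst (_∣ p ℕ.^ v ℕ.* u) (ℕ.*-comm p (p ℕ.^ v)) pᵛ⁺¹∣pᵛu))

  p∤! : ∀ k → k ℕ.< p → p ∤ k !
  p∤! zero    _   = p∤1
  p∤! (suc k) k<p = p∤* (ℕ.>⇒∤ k<p) (p∤! k (ℕ.<-trans (ℕ.n<1+n k) k<p))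

  p∣pCk : ∀ {k} → 0 ℕ.< k → k ℕ.< p → p ∣ p C k
  p∣pCk {k} 0<k k<p with euclidsLemma (p C k) (k ! ℕ.* (p ℕ.∸ k) !) prime (≡.subst (p ∣_) (≡.sym pCk*≡p!) p∣p!)
    where
    instance
      k!*≢0 : ℕ.NonZero (k ! ℕ.* (p ℕ.∸ k) !)
      k!*≢0 = k ℕ.!* (p ℕ.∸ k) !≢0
    pCk*≡p! : (p C k) ℕ.* (k ! ℕ.* (p ℕ.∸ k) !) ≡ p !
    pCk*≡p! = ≡.trans (≡.cong (ℕ._* (k ! ℕ.* (p ℕ.∸ k) !)) (nCk≡n!/k![n-k]! (ℕ.<⇒≤ k<p)))
                      (ℕ.m/n*n≡m (k![n∸k]!∣n! (ℕ.<⇒≤ k<p)))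
    p∣p! : p ∣ p !
    p∣p! = ≡.subst (λ n → n ∣ n !) (ℕ.suc-pred p) (ℕ.m∣m*n (ℕ.pred p !))
  ... | inj₁ p∣pCk = p∣pCk
  ... | inj₂ p∣k!* = contradiction p∣k!* (p∤* (p∤! k k<p) (p∤! (p ℕ.∸ k) (ℕ.∸-monoʳ-< 0<k (ℕ.<⇒≤ k<p))))

  module _ {m : ℕ} (2≤m : 2 ≤ m) (p∤m : p ∤ m) where
    private instance
      m≢0 : ℕ.NonZero m
      m≢0 = ℕ.>-nonZero (ℕ.<-trans (s≤s z≤n) 2≤m)

    abstract
      -- The number m^x - 1; `pred` loses nothing since m^x is positive. It is opaque, so that
      -- everything below goes through `suc-M` and the powers do not unfold.
      M : ℕ → ℕ
      M x = ℕ.pred (m ℕ.^ x)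

      suc-M : ∀ x → suc (M x) ≡ m ℕ.^ x
      suc-M x = ℕ.suc-pred (m ℕ.^ x) {{ℕ.m^n≢0 m x}}

    M-0 : M 0 ≡ 0
    M-0 = ℕ.suc-injective (suc-M 0)

    -- As p does not divide m^y, this identity relates the exponents of p at x, y and x + y, and all
    -- later divisibility facts come from it.
    M-+ : ∀ x y → M (x ℕ.+ y) ≡ m ℕ.^ y ℕ.* M x ℕ.+ M y
    M-+ x y = ℕ.suc-injective (begin
      suc (M (x ℕ.+ y))                ≡⟨ suc-M (x ℕ.+ y) ⟩
      m ℕ.^ (x ℕ.+ y)                  ≡⟨ ℕ.^-distribˡ-+-* m x y ⟩
      m ℕ.^ x ℕ.* m ℕ.^ y              ≡⟨ ≡.cong (ℕ._* m ℕ.^ y) (suc-M x) ⟨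
      m ℕ.^ y ℕ.+ M x ℕ.* m ℕ.^ y      ≡⟨ ≡.cong₂ ℕ._+_ (≡.sym (suc-M y)) (ℕ.*-comm (M x) (m ℕ.^ y)) ⟩
      suc (M y ℕ.+ m ℕ.^ y ℕ.* M x)    ≡⟨ ≡.cong suc (ℕ.+-comm (M y) _) ⟩
      suc (m ℕ.^ y ℕ.* M x ℕ.+ M y)    ∎)
      where open ≡.≡-Reasoning

    M>0 : ∀ {x} → 0 ℕ.< x → 0 ℕ.< M x
    M>0 {x} 0<x = ℕ.s<s⁻¹ (≡.subst (1 ℕ.<_) (≡.sym (suc-M x))
      (ℕ.<-≤-trans 2≤m (ℕ.≤-trans (ℕ.≤-reflexive (≡.sym (ℕ.^-identityʳ m))) (ℕ.^-monoʳ-≤ m 0<x))))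

    abstract
      val unit : ℕ → ℕ
      val  x = proj₁ (decompose (M x))
      unit x = proj₁ (proj₂ (decompose (M x)))

      M≡p^val*unit : ∀ x → M x ≡ p ℕ.^ val x ℕ.* unit x
      M≡p^val*unit x = proj₁ (proj₂ (proj₂ (decompose (M x))))

      p∤unit : ∀ {x} → 0 ℕ.< x → p ∤ unit x
      p∤unit {x} 0<x = proj₂ (proj₂ (proj₂ (decompose (M x)))) (M>0 0<x)

    Val-val : ∀ {x} → 0 ℕ.< x → Val (val x) (M x)
    Val-val {x} 0<x = ≡.subst (Val (val x)) (≡.sym (M≡p^val*unit x)) (Val-p^* (val x) (p∤unit 0<x))

    M-∣-* : ∀ {q x} k → q ∣ M x → q ∣ M (k ℕ.* x)
    M-∣-* {q} zero q∣Mx = ≡.subst (q ∣_) (≡.sym M-0) (q ℕ.∣0)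
    M-∣-* {q} {x} (suc k) q∣Mx = ≡.subst (q ∣_) (≡.sym (M-+ x (k ℕ.* x)))
      (ℕ.∣m∣n⇒∣m+n (ℕ.∣n⇒∣m*n (m ℕ.^ (k ℕ.* x)) q∣Mx) (M-∣-* k q∣Mx))

    -- By the pigeonhole principle two of the powers m ^ i agree modulo p ^ K.
    order : ∀ K → ∃[ e ] 0 ℕ.< e × p ℕ.^ K ∣ M e
    order K with Fin.pigeonhole (ℕ.n<1+n (p ℕ.^ K)) (λ i → ℕ._mod_ (m ℕ.^ toℕ i) (p ℕ.^ K) {{ℕ.m^n≢0 p K}})
    ... | i , j , i<j , eq = e , ℕ.m<n⇒0<n∸m i<j , p^∣-cancelˡ K (p∤^ p∤m (toℕ i))
      (ℕ.∣m+n∣m⇒∣n {m = a ℕ./ q ℕ.* q} (≡.subst (q ∣_) (≡.sym a/q*q+) (ℕ.n∣m*n (b ℕ./ q))) (ℕ.n∣m*n (a ℕ./ q)))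
      where
      q = p ℕ.^ K
      instance
        q≢0 : ℕ.NonZero q
        q≢0 = ℕ.m^n≢0 p K
      e = toℕ j ℕ.∸ toℕ i
      a = m ℕ.^ toℕ i
      b = m ℕ.^ toℕ j
      a%q≡b%q : a ℕ.% q ≡ b ℕ.% q
      a%q≡b%q = Fin.fromℕ<-injective _ _ _ _ eq
      open ≡.≡-Reasoning
      b≡a+a*Me : b ≡ a ℕ.+ a ℕ.* M e
      b≡a+a*Me = begin
        b                     ≡⟨ ≡.cong (m ℕ.^_) (ℕ.m+[n∸m]≡n (ℕ.<⇒≤ i<j)) ⟨
        m ℕ.^ (toℕ i ℕ.+ e)   ≡⟨ ℕ.^-distribˡ-+-* m (toℕ i) e ⟩
        a ℕ.* m ℕ.^ e         ≡⟨ ≡.cong (a ℕ.*_) (suc-M e) ⟨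
        a ℕ.* suc (M e)       ≡⟨ ℕ.*-suc a (M e) ⟩
        a ℕ.+ a ℕ.* M e       ∎
      a/q*q+ : a ℕ./ q ℕ.* q ℕ.+ a ℕ.* M e ≡ b ℕ./ q ℕ.* q
      a/q*q+ = ℕ.+-cancelˡ-≡ (a ℕ.% q) _ _ (begin
        a ℕ.% q ℕ.+ (a ℕ./ q ℕ.* q ℕ.+ a ℕ.* M e) ≡⟨ ℕ.+-assoc (a ℕ.% q) _ _ ⟨
        a ℕ.% q ℕ.+ a ℕ./ q ℕ.* q ℕ.+ a ℕ.* M e   ≡⟨ ≡.cong (ℕ._+ a ℕ.* M e) (ℕ.m≡m%n+[m/n]*n a q) ⟨
        a ℕ.+ a ℕ.* M e                          ≡⟨ b≡a+a*Me ⟨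
        b                                        ≡⟨ ℕ.m≡m%n+[m/n]*n b q ⟩
        b ℕ.% q ℕ.+ b ℕ./ q ℕ.* q                 ≡⟨ ≡.cong (ℕ._+ b ℕ./ q ℕ.* q) a%q≡b%q ⟨
        a ℕ.% q ℕ.+ b ℕ./ q ℕ.* q                 ∎)

    -- Expanding (1 + w)^k - 1 with p ∣ w = M x gives k w up to a multiple of p w. The exponent of p
    -- is thus unchanged for k prime to p and grows for k = p.
    M-* : ∀ {x} → p ∣ M x → ∀ k → ∃[ z ] M (k ℕ.* x) ≡ (k ℕ.+ p ℕ.* z) ℕ.* M x
    M-* {x} _ zero = 0 , ≡.trans M-0 (≡.sym (≡.cong (ℕ._* M x) (ℕ.*-zeroʳ p)))
    M-* {x} p∣Mx@(divides y Mx≡yp) (suc k) with M-* p∣Mx k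
    ... | z , eq = z ℕ.+ y ℕ.* (k ℕ.+ p ℕ.* z) , (begin
      M (x ℕ.+ k ℕ.* x)                       ≡⟨ ≡.cong M (ℕ.+-comm x (k ℕ.* x)) ⟩
      M (k ℕ.* x ℕ.+ x)                       ≡⟨ M-+ (k ℕ.* x) x ⟩
      m ℕ.^ x ℕ.* M (k ℕ.* x) ℕ.+ M x         ≡⟨ ≡.cong₂ (λ a b → a ℕ.* b ℕ.+ M x) (≡.trans (≡.sym (suc-M x)) (≡.cong suc Mx≡yp)) eq ⟩
      suc (y ℕ.* p) ℕ.* ((k ℕ.+ p ℕ.* z) ℕ.* M x) ℕ.+ M x
        ≡⟨ solve 5 (λ y p k z w → (con 1 :+ y :* p) :* ((k :+ p :* z) :* w) :+ w
               := (con 1 :+ k :+ p :* (z :+ y :* (k :+ p :* z))) :* w)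
             ≡.refl y p k z (M x) ⟩
      (suc k ℕ.+ p ℕ.* (z ℕ.+ y ℕ.* (k ℕ.+ p ℕ.* z))) ℕ.* M x ∎)
      where
      open +-*-Solver
      open ≡.≡-Reasoning

    -- The members N of an arithmetic progression at which the exponent of p in
    -- M (N ± d) does not depend on N, for all d ≤ J.
    record Progression (J : ℕ) : Set where
      field
        start  : ℕ
        J<start : J ℕ.< start
        exponent : ℕ
      -- The multipliers 1 + p s are prime to p, so by `M-*` they leave the exponent at `start`
      -- unchanged.
      term : ℕ → ℕ
      term s = suc (p ℕ.* s) ℕ.* start
      field
        val-term : ∀ s → val (term s) ≡ exponent
        val-+    : ∀ s {d} → 0 ℕ.< d → d ≤ J → val (d ℕ.+ term s) ≡ val d
        val-∸    : ∀ s {d} → 0 ℕ.< d → d ≤ J → val (term s ℕ.∸ d) ≡ val d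

    bound : ∀ J → ∃[ K ] 0 ℕ.< K × (∀ {d} → d ≤ J → val d ℕ.< K)
    bound zero = suc (val 0) , s≤s z≤n , λ { z≤n → ℕ.n<1+n _ }
    bound (suc J) with bound J
    ... | K , 0<K , val<K = K ℕ.⊔ suc (val (suc J)) , ℕ.<-≤-trans 0<K (ℕ.m≤m⊔n K _) , λ d≤1+J → go (ℕ.m≤n⇒m<n∨m≡n d≤1+J)
      where
      go : ∀ {d} → d ℕ.< suc J ⊎ d ≡ suc J → val d ℕ.< K ℕ.⊔ suc (val (suc J))
      go (inj₁ (s≤s d≤J)) = ℕ.<-≤-trans (val<K d≤J) (ℕ.m≤m⊔n K _)
      go (inj₂ ≡.refl)    = ℕ.m≤n⊔m K _

    -- K exceeds every `val d` with d ≤ J, while p^K divides M (term s). In M (N + d) = m^d M N + M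
    -- d and M N = m^d M (N ∸ d) + M d the exponent of M d therefore prevails. At N itself it is
    -- constant by `M-*`, which applies because K > 0 makes p divide M n.
    progression : ∀ {J K n} → 0 ℕ.< K → (∀ {d} → d ≤ J → val d ℕ.< K) → J ℕ.< n → p ℕ.^ K ∣ M n → Progression J
    progression {J} {suc K} {n} _ val<K J<n pᴷ∣Mn = record
      { start    = n
      ; J<start  = J<n
      ; exponent = val n
      ; val-term = λ s → Val-unique (Val-val (ℕ.≤-<-trans z≤n (J<term s))) (Val-term s)
      ; val-+    = λ s {d} 0<d d≤J → Val-unique
          (Val-val (ℕ.<-≤-trans 0<d (ℕ.m≤m+n d _)))
          (≡.subst (Val (val d)) (≡.sym (≡.trans (≡.cong M (ℕ.+-comm d (term s))) (M-+ (term s) d)))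
            (Val-+ (val<K d≤J) (ℕ.∣n⇒∣m*n (m ℕ.^ d) (pᴷ∣Mterm s)) (Val-val 0<d)))
      ; val-∸    = λ s {d} 0<d d≤J → Val-unique
          (Val-val (ℕ.m<n⇒0<n∸m (ℕ.≤-<-trans d≤J (J<term s))))
          (Val-cancelˡ {val d} (p∤^ p∤m d) (Val-complement {suc K} {val d} (val<K d≤J)
            (≡.subst (p ℕ.^ suc K ∣_)
              (≡.trans (≡.cong M (≡.sym (ℕ.m∸n+n≡m (ℕ.≤-trans d≤J (ℕ.<⇒≤ (J<term s)))))) (M-+ (term s ℕ.∸ d) d))
              (pᴷ∣Mterm s))
            (Val-val 0<d)))
      }
      where
      term : ℕ → ℕ
      term s = suc (p ℕ.* s) ℕ.* n
      J<term : ∀ s → J ℕ.< term s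
      J<term s = ℕ.<-≤-trans J<n (ℕ.m≤m+n n _)
      pᴷ∣Mterm : ∀ s → p ℕ.^ suc K ∣ M (term s)
      pᴷ∣Mterm s = M-∣-* (suc (p ℕ.* s)) pᴷ∣Mn
      Val-term : ∀ s → Val (val n) (M (term s))
      Val-term s with M-* (ℕ.∣-trans (ℕ.m∣m*n (p ℕ.^ K)) pᴷ∣Mn) (suc (p ℕ.* s))
      ... | z , eq = ≡.subst (Val (val n)) (≡.sym eq) (Val-*ˡ {val n} p∤1+ (Val-val (ℕ.≤-<-trans z≤n J<n)))
        where
        p∤1+ : p ∤ suc (p ℕ.* s) ℕ.+ p ℕ.* z
        p∤1+ p∣1+ = p∤1 (∣m+n∣n⇒∣m (≡.subst (p ∣_) (≡.cong suc (≡.sym (ℕ.*-distribˡ-+ p s z))) p∣1+) (ℕ.m∣m*n (s ℕ.+ z)))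

    -- Passing from n to p n raises the exponent, since by `M-*` the factor between M n and M (p n)
    -- is p + p z.
    progressions : ∀ J → ∃[ P ] ∃[ Q ] Progression.exponent {J} P ≢ Progression.exponent {J} Q
    progressions J with bound J
    ... | suc K , _ , val<K with order (suc K)
    ... | e , 0<e , pᴷ∣Me = progression (s≤s z≤n) val<K J<n pᴷ∣Mn , progression (s≤s z≤n) val<K J<pn (M-∣-* p pᴷ∣Mn) ,
      λ val-n≡val-pn → proj₂ (Val-val 0<pn) (≡.subst (λ v → p ℕ.^ suc v ∣ M (p ℕ.* n)) val-n≡val-pn pᵛ⁺¹∣Mpn)
      where
      -- A multiple of e keeps p^K a divisor of M n, and the factor `suc J` makes n exceed J.
      n = suc J ℕ.* e
      J<n : J ℕ.< n
      J<n = ℕ.m≤m*n (suc J) e {{ℕ.>-nonZero 0<e}}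
      pᴷ∣Mn = M-∣-* (suc J) pᴷ∣Me
      J<pn : J ℕ.< p ℕ.* n
      J<pn = ℕ.<-≤-trans J<n (ℕ.m≤n*m n p)
      0<pn : 0 ℕ.< p ℕ.* n
      0<pn = ℕ.≤-<-trans z≤n J<pn
      pᵛ⁺¹∣Mpn : p ℕ.^ suc (val n) ∣ M (p ℕ.* n)
      pᵛ⁺¹∣Mpn with M-* (ℕ.∣-trans (ℕ.m∣m*n (p ℕ.^ K)) pᴷ∣Mn) p
      ... | z , eq = ≡.subst (p ℕ.^ suc (val n) ∣_) (≡.sym eq)
        (ℕ.*-pres-∣ {p} {_} {p ℕ.^ val n} (ℕ.∣m∣n⇒∣m+n ℕ.∣-refl (ℕ.m∣m*n z)) (proj₁ (Val-val (ℕ.≤-<-trans z≤n J<n))))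

-- Counting fixed points in characteristic p

module Cardinality {c ℓ} (S : Setoid c ℓ) where
  open Setoid S
  open Membership S using (_∈_)
  open Unique S using (Unique)
  open Equivalence using (to; from)

  ∈-─ : ∀ {x y ys} (x∈ys : x ∈ ys) → y ∈ ys → ¬ (x ≈ y) → y ∈ (ys ─ x∈ys)
  ∈-─ (here x≈z)   (here y≈z)   x≉y = contradiction (trans x≈z (sym y≈z)) x≉y
  ∈-─ (here _)     (there y∈ys) x≉y = y∈ys
  ∈-─ (there x∈ys) (here y≈z)   x≉y = here y≈z
  ∈-─ (there x∈ys) (there y∈ys) x≉y = there (∈-─ x∈ys y∈ys x≉y)

  length-mono : ∀ {xs} → Unique xs → ∀ {ys} → (∀ {x} → x ∈ xs → x ∈ ys) → length xs ≤ length ys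
  length-mono []                              _     = z≤n
  length-mono {x ∷ xs} (x∉xs ∷ xs!) {ys} xs⊆ys = ℕ.≤-trans
    (s≤s (length-mono xs! λ y∈xs → ∈-─ x∈ys (xs⊆ys (there y∈xs)) (x≉ y∈xs)))
    (ℕ.≤-reflexive (≡.sym (length-removeAt′ ys (index x∈ys))))
    where
    x∈ys : x ∈ ys
    x∈ys = xs⊆ys (here refl)
    x≉ : ∀ {y} → y ∈ xs → ¬ (x ≈ y)
    x≉ y∈xs x≈y = All.lookupₛ S (λ y≈z x≉y x≈z → x≉y (trans x≈z (sym y≈z))) x∉xs y∈xs x≈y

  -- `fixedPointCount` measures one particular enumeration; by double inclusion any enumeration of
  -- an equivalent predicate may replace it.
  cardinality-unique : ∀ {p q} {P : Pred Carrier p} {Q : Pred Carrier q} →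
    (∀ x → P x ⇔ Q x) → (E : Enumeration S P) (F : Enumeration S Q) →
    Enumeration.cardinality E ≡ Enumeration.cardinality F
  cardinality-unique P⇔Q E F = ℕ.≤-antisym
    (length-mono E.unique λ {x} → from (F.member x) ∘ to (P⇔Q x) ∘ to (E.member x))
    (length-mono F.unique λ {x} → from (E.member x) ∘ from (P⇔Q x) ∘ to (F.member x))
    where
    module E = Enumeration E
    module F = Enumeration F

module Counting {c ℓ} (K : AlgebraicallyClosedField c ℓ) where
  open AlgebraicallyClosedField K hiding (zero)
  open Roots K renaming (quotient to quotientₚ)
  open FixedPoints K
  open ArtinMazur K
  open Cardinality setoid
  open DifferenceSolver commutativeRing
  open RingProperties ring using (x∙y⁻¹≈ε⇒x≈y; x≈y⇒x∙y⁻¹≈ε)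
  open SemiringMult semiring using (×-congʳ; ×-assoc-*; ×-comm-*; ×1-homo-*) renaming (_×_ to _·_)
  open SemiringExp semiring using (_^_; ^-congˡ; ^-assocʳ)
  open SetoidReasoning setoid

  -- The value of the formal derivative, by differentiating the Horner form. Values are all that the
  -- simplicity of roots asks for, so no derived polynomial is formed.
  deriv : Poly → Carrier → Carrier
  deriv []      x = 0#
  deriv (a ∷ f) x = eval f x + x * deriv f x

  eval-≈ₚ : ∀ f g → f ≈ₚ g → ∀ x → eval f x ≈ eval g x
  eval-≈ₚ []      g       f≈g x = sym (eval-zero g (λ n → sym (f≈g n)) x)
  eval-≈ₚ (a ∷ f) []      f≈g x = eval-zero (a ∷ f) f≈g x
  eval-≈ₚ (a ∷ f) (b ∷ g) f≈g x = +-cong (f≈g 0) (*-congˡ (eval-≈ₚ f g (f≈g ∘ suc) x))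

  deriv-zero : ∀ f → (∀ n → coeff f n ≈ 0#) → ∀ x → deriv f x ≈ 0#
  deriv-zero []      f≈0 x = refl
  deriv-zero (a ∷ f) f≈0 x = begin
    eval f x + x * deriv f x ≈⟨ +-cong (eval-zero f (f≈0 ∘ suc) x) (*-congˡ (deriv-zero f (f≈0 ∘ suc) x)) ⟩
    0# + x * 0#              ≈⟨ +-identityˡ _ ⟩
    x * 0#                   ≈⟨ zeroʳ x ⟩
    0#                       ∎

  deriv-≈ₚ : ∀ f g → f ≈ₚ g → ∀ x → deriv f x ≈ deriv g x
  deriv-≈ₚ []      g       f≈g x = sym (deriv-zero g (λ n → sym (f≈g n)) x)
  deriv-≈ₚ (a ∷ f) []      f≈g x = deriv-zero (a ∷ f) f≈g x
  deriv-≈ₚ (a ∷ f) (b ∷ g) f≈g x = +-cong (eval-≈ₚ f g (f≈g ∘ suc) x) (*-congˡ (deriv-≈ₚ f g (f≈g ∘ suc) x))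

  deriv-+ : ∀ f g x → deriv (f +ₚ g) x ≈ deriv f x + deriv g x
  deriv-+ []      g       x = sym (+-identityˡ _)
  deriv-+ (a ∷ f) []      x = sym (+-identityʳ _)
  deriv-+ (a ∷ f) (b ∷ g) x = begin
    eval (f +ₚ g) x + x * deriv (f +ₚ g) x                   ≈⟨ +-cong (eval-+ f g x) (*-congˡ (deriv-+ f g x)) ⟩
    (eval f x + eval g x) + x * (deriv f x + deriv g x)
      ≈⟨ solve 5 (λ x f g f′ g′ → (f :+ g) :+ x :* (f′ :+ g′) := (f :+ x :* f′) :+ (g :+ x :* g′))
           refl x (eval f x) (eval g x) (deriv f x) (deriv g x) ⟩
    (eval f x + x * deriv f x) + (eval g x + x * deriv g x)  ∎

  deriv-map : ∀ a f x → deriv (map (a *_) f) x ≈ a * deriv f x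
  deriv-map a []      x = sym (zeroʳ a)
  deriv-map a (b ∷ f) x = begin
    eval (map (a *_) f) x + x * deriv (map (a *_) f) x ≈⟨ +-cong (eval-map a f x) (*-congˡ (deriv-map a f x)) ⟩
    a * eval f x + x * (a * deriv f x)
      ≈⟨ solve 4 (λ a x f f′ → a :* f :+ x :* (a :* f′) := a :* (f :+ x :* f′)) refl a x (eval f x) (deriv f x) ⟩
    a * (eval f x + x * deriv f x) ∎

  deriv-* : ∀ f g x → deriv (f *ₚ g) x ≈ deriv f x * eval g x + eval f x * deriv g x
  deriv-* []      g x = sym (trans (+-cong (zeroˡ _) (zeroˡ _)) (+-identityˡ 0#))
  deriv-* (a ∷ f) g x = begin
    deriv (map (a *_) g +ₚ (0# ∷ f *ₚ g)) x
      ≈⟨ deriv-+ (map (a *_) g) _ x ⟩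
    deriv (map (a *_) g) x + (eval (f *ₚ g) x + x * deriv (f *ₚ g) x)
      ≈⟨ +-cong (deriv-map a g x) (+-cong (eval-* f g x) (*-congˡ (deriv-* f g x))) ⟩
    a * deriv g x + (eval f x * eval g x + x * (deriv f x * eval g x + eval f x * deriv g x))
      ≈⟨ solve 6 (λ a x f g f′ g′ → a :* g′ :+ (f :* g :+ x :* (f′ :* g :+ f :* g′)) := (f :+ x :* f′) :* g :+ (a :+ x :* f) :* g′)
           refl a x (eval f x) (eval g x) (deriv f x) (deriv g x) ⟩
    (eval f x + x * deriv f x) * eval g x + (a + x * eval f x) * deriv g x ∎

  deriv-∘ : ∀ f g x → deriv (f ∘ₚ g) x ≈ deriv f (eval g x) * deriv g x
  deriv-∘ []      g x = sym (zeroˡ _)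
  deriv-∘ (a ∷ f) g x = begin
    deriv ((a ∷ []) +ₚ (f ∘ₚ g) *ₚ g) x
      ≈⟨ deriv-+ (a ∷ []) ((f ∘ₚ g) *ₚ g) x ⟩
    (0# + x * 0#) + deriv ((f ∘ₚ g) *ₚ g) x
      ≈⟨ +-cong (trans (+-identityˡ _) (zeroʳ x)) (deriv-* (f ∘ₚ g) g x) ⟩
    0# + (deriv (f ∘ₚ g) x * eval g x + eval (f ∘ₚ g) x * deriv g x)
      ≈⟨ +-identityˡ _ ⟩
    deriv (f ∘ₚ g) x * eval g x + eval (f ∘ₚ g) x * deriv g x
      ≈⟨ +-cong (*-congʳ (deriv-∘ f g x)) (*-congʳ (eval-∘ f g x)) ⟩
    deriv f (eval g x) * deriv g x * eval g x + eval f (eval g x) * deriv g x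
      ≈⟨ solve 4 (λ f f′ g g′ → f′ :* g′ :* g :+ f :* g′ := (f :+ g :* f′) :* g′)
           refl (eval f (eval g x)) (deriv f (eval g x)) (eval g x) (deriv g x) ⟩
    (eval f (eval g x) + eval g x * deriv f (eval g x)) * deriv g x ∎

  quotient-eval : ∀ f r x → eval f x ≈ eval f r + (x - r) * eval (quotientₚ r f) x
  quotient-eval f r x = begin
    eval f x                                                  ≈⟨ eval-cong f x≈r+e ⟩
    eval f (r + (x - r))                                      ≈⟨ eval-quotient r (x - r) f ⟩
    eval f r + (x - r) * eval (quotientₚ r f) (r + (x - r))   ≈⟨ +-congˡ (*-congˡ (eval-cong (quotientₚ r f) x≈r+e)) ⟨
    eval f r + (x - r) * eval (quotientₚ r f) x               ∎
    where
    x≈r+e : x ≈ r + (x - r)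
    x≈r+e = solve 2 (λ x r → x := r :+ (x :- r)) refl x r

  -- The product rule for f = f(r) + (X - r) q.
  quotient-deriv : ∀ f r x → deriv f x ≈ eval (quotientₚ r f) x + (x - r) * deriv (quotientₚ r f) x
  quotient-deriv []          r x = sym (trans (+-identityˡ _) (zeroʳ _))
  quotient-deriv (a ∷ [])    r x = trans (+-congˡ (zeroʳ x)) (+-congˡ (sym (zeroʳ (x - r))))
  quotient-deriv (a ∷ f@(_ ∷ _)) r x = begin
    eval f x + x * deriv f x
      ≈⟨ +-cong (quotient-eval f r x) (*-congˡ (quotient-deriv f r x)) ⟩
    (eval f r + (x - r) * q) + x * (q + (x - r) * q′)
      ≈⟨ solve 5 (λ f r x q q′ → (f :+ (x :- r) :* q) :+ x :* (q :+ (x :- r) :* q′)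
             := (f :+ x :* q) :+ (x :- r) :* (q :+ x :* q′))
           refl (eval f r) r x q q′ ⟩
    (eval f r + x * q) + (x - r) * (q + x * q′) ∎
    where
    q  = eval (quotientₚ r f) x
    q′ = deriv (quotientₚ r f) x

  SimpleRoots : Poly → Set (c ⊔ ℓ)
  SimpleRoots f = ∀ x → Root f x → ¬ (deriv f x ≈ 0#)

  -- `roots` adds r to the roots of the quotient unless r is a root of the quotient too, and then
  -- f′(r) = 0. With simple roots every linear factor therefore contributes, and the quotient again
  -- has simple roots.
  cardinality-roots : ∀ {f d} (f° : Degree f d) → SimpleRoots f → Enumeration.cardinality (roots f°) ≡ d
  cardinality-roots {f} {zero}  (leading _) _ = ≡.refl
  cardinality-roots {f} {suc d} f° simple with root f (suc d , Degree⇒HasDegree f° , s≤s z≤n)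
  ... | r , fr≈0 with eval (quotientₚ r f) r ≈? 0#
  ...   | yes qr≈0 = contradiction (begin
          deriv f r                                                     ≈⟨ quotient-deriv f r r ⟩
          eval (quotientₚ r f) r + (r - r) * deriv (quotientₚ r f) r    ≈⟨ +-cong qr≈0 (*-congʳ (-‿inverseʳ r)) ⟩
          0# + 0# * deriv (quotientₚ r f) r                             ≈⟨ +-identityˡ _ ⟩
          0# * deriv (quotientₚ r f) r                                  ≈⟨ zeroˡ _ ⟩
          0#                                                            ∎) (simple r fr≈0)
  ...   | no _ = ≡.cong suc (cardinality-roots (quotient-degree r f°) λ s qs≈0 q′s≈0 →
          simple s (trans (factor f fr≈0 s) (*0ʳ qs≈0)) (begin
            deriv f s                                                   ≈⟨ quotient-deriv f r s ⟩
            eval (quotientₚ r f) s + (s - r) * deriv (quotientₚ r f) s  ≈⟨ +-cong qs≈0 (*0ʳ q′s≈0) ⟩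
            0# + 0#                                                     ≈⟨ +-identityˡ 0# ⟩
            0#                                                          ∎))
    where
    *0ʳ : ∀ {x y} → y ≈ 0# → x * y ≈ 0#
    *0ʳ {x} y≈0 = trans (*-congˡ y≈0) (zeroʳ x)

  trim : ∀ f {d} → HasDegree f d → ∃[ g ] Degree g d × f ≈ₚ g
  trim []      (l , _)         = contradiction refl l
  trim (a ∷ f) {zero}  (l , h) = a ∷ [] , leading l , λ { zero → refl ; (suc n) → h (suc n) (s≤s z≤n) }
  trim (a ∷ f) {suc d} (l , h) with trim f (l , λ n d<n → h (suc n) (s≤s d<n))
  ... | g , g° , f≈g = a ∷ g , a ∷ g° , λ { zero → refl ; (suc n) → f≈g n }

  -X : Poly
  -X = 0# ∷ - 1# ∷ []

  eval--X : ∀ x → eval -X x ≈ - x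
  eval--X x = begin
    0# + x * (- 1# + x * 0#) ≈⟨ +-identityˡ _ ⟩
    x * (- 1# + x * 0#)      ≈⟨ *-congˡ (trans (+-congˡ (zeroʳ x)) (+-identityʳ _)) ⟩
    x * - 1#                 ≈⟨ *-comm x _ ⟩
    - 1# * x                 ≈⟨ RingProperties.-1*x≈-x ring x ⟩
    - x                      ∎

  deriv--X : ∀ x → deriv -X x ≈ - 1#
  deriv--X x = begin
    (- 1# + x * 0#) + x * (0# + x * 0#) ≈⟨ +-cong (+-congˡ (zeroʳ x)) (*-congˡ (trans (+-identityˡ _) (zeroʳ x))) ⟩
    (- 1# + 0#) + x * 0#                ≈⟨ +-cong (+-identityʳ _) (zeroʳ x) ⟩
    - 1# + 0#                           ≈⟨ +-identityʳ _ ⟩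
    - 1#                                ∎

  -1≉0 : ¬ (- 1# ≈ 0#)
  -1≉0 -1≈0 = 0≉1 (begin
    0#       ≈⟨ -‿inverseʳ 1# ⟨
    1# - 1#  ≈⟨ +-congˡ -1≈0 ⟩
    1# + 0#  ≈⟨ +-identityʳ 1# ⟩
    1#       ∎)

  fixedPointCount-roots : ∀ f f° n {g d} → Degree g d → SimpleRoots g →
    (∀ x → FixedPoint (eval f ^∘ suc n) x ⇔ Root g x) → fixedPointCount f f° n ≡ d
  fixedPointCount-roots f f° n g° simple fix⇔root =
    ≡.trans (cardinality-unique fix⇔root (fixedPoints f f° n) (roots g°)) (cardinality-roots g° simple)

  -- The derivative of fⁿ - x is -1, so fⁿ - x has only simple roots.
  fixedPointCount-inseparable : ∀ f (f° : DegreeAtLeast 2 f) → (∀ x → deriv f x ≈ 0#) → ∀ n →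
    fixedPointCount f f° n ≡ proj₁ f° ℕ.^ suc n
  fixedPointCount-inseparable f f°@(suc (suc e) , hasDegree , s≤s (s≤s z≤n)) f′≈0 n with trim f hasDegree
  ... | g , g° , f≈g = fixedPointCount-roots f f° n
    (+ₚ-degreeʳ -X (proj₁ (proj₂ (iterate n))) (degree-bound n))
    (λ x _ h′≈0 → -1≉0 (begin
      - 1#                                       ≈⟨ +-identityˡ _ ⟨
      0# - 1#                                    ≈⟨ +-cong (proj₂ (proj₂ (proj₂ (iterate n))) x) (deriv--X x) ⟨
      deriv (proj₁ (iterate n)) x + deriv -X x   ≈⟨ deriv-+ (proj₁ (iterate n)) -X x ⟨
      deriv (proj₁ (iterate n) +ₚ -X) x          ≈⟨ h′≈0 ⟩
      0#                                         ∎))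
    (λ x → mk⇔
      (λ fⁿx≈x → trans (h-x n x) (x≈y⇒x∙y⁻¹≈ε fⁿx≈x))
      (λ hx≈0 → x∙y⁻¹≈ε⇒x≈y _ _ (trans (sym (h-x n x)) hx≈0)))
    where
    d = suc (suc e)

    g′≈0 : ∀ x → deriv g x ≈ 0#
    g′≈0 x = trans (sym (deriv-≈ₚ f g f≈g x)) (f′≈0 x)

    iterate : ∀ n → ∃[ h ] Degree h (d ℕ.^ suc n) × (∀ x → (eval f ^∘ suc n) x ≈ eval h x) × (∀ x → deriv h x ≈ 0#)
    iterate zero = g , ≡.subst (Degree g) (≡.sym (ℕ.^-identityʳ d)) g° , eval-≈ₚ f g f≈g , g′≈0
    iterate (suc n) with iterate n | ℕ.suc-pred (d ℕ.^ suc n) {{ℕ.m^n≢0 d (suc n)}}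
    ... | h , h° , fⁿ≈h , _ | eq = g ∘ₚ h ,
      ≡.subst (λ k → Degree (g ∘ₚ h) (d ℕ.* k)) eq (∘ₚ-degree g° (≡.subst (Degree h) (≡.sym eq) h°)) ,
      (λ x → begin
        eval f ((eval f ^∘ suc n) x) ≈⟨ eval-cong f (fⁿ≈h x) ⟩
        eval f (eval h x)            ≈⟨ eval-≈ₚ f g f≈g _ ⟩
        eval g (eval h x)            ≈⟨ eval-∘ g h x ⟨
        eval (g ∘ₚ h) x              ∎) ,
      (λ x → begin
        deriv (g ∘ₚ h) x              ≈⟨ deriv-∘ g h x ⟩
        deriv g (eval h x) * deriv h x ≈⟨ *-congʳ (g′≈0 _) ⟩
        0# * deriv h x                ≈⟨ zeroˡ _ ⟩
        0#                            ∎)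

    degree-bound : ∀ n → 2 ≤ d ℕ.^ suc n
    degree-bound n = ℕ.≤-trans (s≤s (s≤s z≤n)) (ℕ.m≤m*n d (d ℕ.^ n) {{ℕ.m^n≢0 d n}})

    h-x : ∀ n x → eval (proj₁ (iterate n) +ₚ -X) x ≈ (eval f ^∘ suc n) x - x
    h-x n x = trans (eval-+ (proj₁ (iterate n)) -X x)
      (+-cong (sym (proj₁ (proj₂ (proj₂ (iterate n))) x)) (eval--X x))

  eval-X^ : ∀ m x → eval (X^ m) x ≈ x ^ m
  eval-X^ zero    x = trans (+-congˡ (zeroʳ x)) (+-identityʳ 1#)
  eval-X^ (suc m) x = trans (+-identityˡ _) (*-congˡ (eval-X^ m x))

  deriv-X^ : ∀ m x → deriv (X^ (suc m)) x ≈ suc m · x ^ m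
  deriv-X^ zero    x = begin
    eval (X^ 0) x + x * (0# + x * 0#) ≈⟨ +-cong (eval-X^ 0 x) (trans (*-congˡ (trans (+-identityˡ _) (zeroʳ x))) (zeroʳ x)) ⟩
    1# + 0#                           ∎
  deriv-X^ (suc m) x = begin
    eval (X^ (suc m)) x + x * deriv (X^ (suc m)) x ≈⟨ +-cong (eval-X^ (suc m) x) (*-congˡ (deriv-X^ m x)) ⟩
    x ^ suc m + x * (suc m · x ^ m)                ≈⟨ +-congˡ (×-comm-* (suc m) x (x ^ m)) ⟩
    x ^ suc m + suc m · x ^ suc m                  ∎

  iterate-X^ : ∀ m n x → (eval (X^ m) ^∘ n) x ≈ x ^ (m ℕ.^ n)
  iterate-X^ m zero    x = sym (*-identityʳ x)
  iterate-X^ m (suc n) x = begin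
    eval (X^ m) ((eval (X^ m) ^∘ n) x) ≈⟨ eval-X^ m _ ⟩
    ((eval (X^ m) ^∘ n) x) ^ m         ≈⟨ ^-congˡ m (iterate-X^ m n x) ⟩
    (x ^ (m ℕ.^ n)) ^ m                ≈⟨ ^-assocʳ x (m ℕ.^ n) m ⟩
    x ^ (m ℕ.^ n ℕ.* m)                ≡⟨ ≡.cong (x ^_) (ℕ.*-comm (m ℕ.^ n) m) ⟩
    x ^ (m ℕ.^ suc n)                  ∎

  module Characteristic (p : ℕ) (prime : Prime p) (p·1≈0 : p · 1# ≈ 0#) where
    open Valuation p prime
    open Binomial commutativeSemiring using (theorem; binomialTerm)
    open SemiringSum semiring using (sum; sum-cong-≋; sum-init-last; sum-replicate-zero)

    p∣⇒·≈0 : ∀ {n} → p ∣ n → ∀ x → n · x ≈ 0#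
    p∣⇒·≈0 {n} (divides q ≡.refl) x = begin
      (q ℕ.* p) · x               ≈⟨ ×-congʳ (q ℕ.* p) (*-identityˡ x) ⟨
      (q ℕ.* p) · (1# * x)        ≈⟨ ×-assoc-* (q ℕ.* p) 1# x ⟨
      (q ℕ.* p) · 1# * x          ≈⟨ *-congʳ (×1-homo-* q p) ⟩
      (q · 1#) * (p · 1#) * x     ≈⟨ *-congʳ (*-congˡ p·1≈0) ⟩
      (q · 1#) * 0# * x           ≈⟨ *-congʳ (zeroʳ _) ⟩
      0# * x                      ≈⟨ zeroˡ x ⟩
      0#                          ∎

    -- Bézout writes 1 as a difference of multiples of p and n, both of which would vanish in K.
    p∤⇒·1≉0 : ∀ {n} → p ∤ n → ¬ (n · 1# ≈ 0#)
    p∤⇒·1≉0 {n} p∤n n·1≈0 with coprime-Bézout coprime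
      where
      coprime : Coprime p n
      coprime (d∣p , d∣n) with prime⇒irreducible prime d∣p
      ... | inj₁ d≡1    = d≡1
      ... | inj₂ ≡.refl = contradiction d∣n p∤n
    ... | Bézout.+- a b 1+bn≡ap = 0≉1 (begin
      0#                    ≈⟨ p∣⇒·≈0 (divides a ≡.refl) 1# ⟨
      (a ℕ.* p) · 1#        ≡⟨ ≡.cong (_· 1#) 1+bn≡ap ⟨
      1# + (b ℕ.* n) · 1#   ≈⟨ +-congˡ (trans (×1-homo-* b n) (trans (*-congˡ n·1≈0) (zeroʳ _))) ⟩
      1# + 0#               ≈⟨ +-identityʳ 1# ⟩
      1#                    ∎)
    ... | Bézout.-+ a b 1+ap≡bn = 0≉1 (begin
      0#                    ≈⟨ trans (×1-homo-* b n) (trans (*-congˡ n·1≈0) (zeroʳ _)) ⟨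
      (b ℕ.* n) · 1#        ≡⟨ ≡.cong (_· 1#) 1+ap≡bn ⟨
      1# + (a ℕ.* p) · 1#   ≈⟨ +-congˡ (p∣⇒·≈0 (divides a ≡.refl) 1#) ⟩
      1# + 0#               ≈⟨ +-identityʳ 1# ⟩
      1#                    ∎)

    deriv-X^-p∣ : ∀ {m} → p ∣ m → ∀ x → deriv (X^ m) x ≈ 0#
    deriv-X^-p∣ {zero}  p∣m x = trans (+-identityˡ _) (zeroʳ x)
    deriv-X^-p∣ {suc m} p∣m x = trans (deriv-X^ m x) (p∣⇒·≈0 p∣m _)

    deriv-IsPolyIn-X^ : ∀ f → IsPolyIn-X^ p f → ∀ x → deriv f x ≈ 0#
    deriv-IsPolyIn-X^ f (g , f≈g∘Xᵖ) x = begin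
      deriv f x                                    ≈⟨ deriv-≈ₚ f (g ∘ₚ X^ p) f≈g∘Xᵖ x ⟩
      deriv (g ∘ₚ X^ p) x                          ≈⟨ deriv-∘ g (X^ p) x ⟩
      deriv g (eval (X^ p) x) * deriv (X^ p) x     ≈⟨ *-congˡ (deriv-X^-p∣ ℕ.∣-refl x) ⟩
      deriv g (eval (X^ p) x) * 0#                 ≈⟨ zeroʳ _ ⟩
      0#                                           ∎

    frobenius : ∀ x y → (x + y) ^ p ≈ x ^ p + y ^ p
    -- The exponent is generalised to a variable q equal to p, so that it can be matched as a
    -- successor in the binomial sum.
    frobenius x y = go p ≡.refl
      where
      term : ∀ n → Fin (suc n) → Carrier
      term = binomialTerm x y

      first : ∀ q → term (suc q) zero ≈ y ^ suc q
      first q = trans (+-identityʳ _) (*-identityˡ _)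

      last : ∀ q → term (suc q) (suc (fromℕ q)) ≈ x ^ suc q
      last q = begin
        term (suc q) (suc (fromℕ q))
          ≡⟨ ≡.cong (λ k → (suc q C suc k) · (x ^ suc k * y ^ (q ℕ.∸ k))) (Fin.toℕ-fromℕ q) ⟩
        (suc q C suc q) · (x ^ suc q * y ^ (q ℕ.∸ q))
          ≡⟨ ≡.cong₂ (λ k l → k · (x ^ suc q * y ^ l)) (nCn≡1 (suc q)) (ℕ.n∸n≡0 q) ⟩
        1 · (x ^ suc q * 1#)
          ≈⟨ trans (+-identityʳ _) (*-identityʳ _) ⟩
        x ^ suc q ∎

      middle : ∀ q → suc q ≡ p → ∀ i → term (suc q) (suc (inject₁ i)) ≈ 0#
      middle q 1+q≡p i = p∣⇒·≈0 (≡.subst (λ n → p ∣ n C suc (toℕ (inject₁ i))) (≡.sym 1+q≡p)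
        (p∣pCk (s≤s z≤n) (≡.subst (suc (toℕ (inject₁ i)) ℕ.<_) 1+q≡p (s≤s (Fin.inject₁ℕ< i))))) _

      go : ∀ q → q ≡ p → (x + y) ^ q ≈ x ^ q + y ^ q
      go zero    0≡p   = contradiction (≡.sym 0≡p) (ℕ.≢-nonZero⁻¹ p {{prime⇒nonZero prime}})
      go (suc q) 1+q≡p = begin
        (x + y) ^ suc q                                      ≈⟨ theorem (suc q) x y ⟩
        term (suc q) zero + sum (λ i → term (suc q) (suc i)) ≈⟨ +-congˡ (sum-init-last (λ i → term (suc q) (suc i))) ⟩
        term (suc q) zero + (sum (λ i → term (suc q) (suc (inject₁ i))) + term (suc q) (suc (fromℕ q)))
          ≈⟨ +-cong (first q) (+-cong (trans (sum-cong-≋ (middle q 1+q≡p)) (sum-replicate-zero q)) (last q)) ⟩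
        y ^ suc q + (0# + x ^ suc q)                         ≈⟨ +-congˡ (+-identityˡ _) ⟩
        y ^ suc q + x ^ suc q                                ≈⟨ +-comm _ _ ⟩
        x ^ suc q + y ^ suc q                                ∎

    1^n≈1 : ∀ n → 1# ^ n ≈ 1#
    1^n≈1 zero    = refl
    1^n≈1 (suc n) = trans (*-identityˡ _) (1^n≈1 n)

    ^-≈0 : ∀ n {x} → x ^ n ≈ 0# → x ≈ 0#
    ^-≈0 zero    1≈0 = contradiction (sym 1≈0) 0≉1
    ^-≈0 (suc n) {x} xx^n≈0 with x ≈? 0#
    ... | yes x≈0 = x≈0
    ... | no  x≉0 with (x ^ n) ≈? 0#
    ...   | yes x^n≈0 = ^-≈0 n x^n≈0
    ...   | no  x^n≉0 = contradiction xx^n≈0 (*-≉0 x≉0 x^n≉0)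

    -- Frobenius turns y^p - 1 into (y - 1)^p, and a field has no nilpotents. This is why the factor
    -- p^v of m^n - 1 does not contribute fixed points.
    ^p≈1⇒≈1 : ∀ {y} → y ^ p ≈ 1# → y ≈ 1#
    ^p≈1⇒≈1 {y} yᵖ≈1 = x∙y⁻¹≈ε⇒x≈y y 1# (^-≈0 p (begin
      (y - 1#) ^ p                    ≈⟨ solve 2 (λ a b → a := a :+ b :- b) refl ((y - 1#) ^ p) 1# ⟩
      ((y - 1#) ^ p + 1#) - 1#        ≈⟨ +-congʳ (+-congˡ (1^n≈1 p)) ⟨
      ((y - 1#) ^ p + 1# ^ p) - 1#    ≈⟨ +-congʳ (frobenius (y - 1#) 1#) ⟨
      ((y - 1#) + 1#) ^ p - 1#        ≈⟨ +-congʳ (^-congˡ p (solve 2 (λ a b → a :- b :+ b := a) refl y 1#)) ⟩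
      y ^ p - 1#                      ≈⟨ +-congʳ yᵖ≈1 ⟩
      1# - 1#                         ≈⟨ -‿inverseʳ 1# ⟩
      0#                              ∎))

    ^p^v≈1⇒≈1 : ∀ v {y} → y ^ (p ℕ.^ v) ≈ 1# → y ≈ 1#
    ^p^v≈1⇒≈1 zero    {y} y≈1 = trans (sym (*-identityʳ y)) y≈1
    ^p^v≈1⇒≈1 (suc v) {y} eq  = ^p≈1⇒≈1 (^p^v≈1⇒≈1 v (trans (^-assocʳ y p (p ℕ.^ v)) eq))

    X^-Degree : ∀ m → Degree (X^ m) m
    X^-Degree zero    = leading (0≉1 ∘ sym)
    X^-Degree (suc m) = 0# ∷ X^-Degree m

    x*y≈x⇒y≈1 : ∀ {x y} → ¬ (x ≈ 0#) → x * y ≈ x → y ≈ 1#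
    x*y≈x⇒y≈1 {x} {y} x≉0 xy≈x with (y - 1#) ≈? 0#
    ... | yes y-1≈0 = x∙y⁻¹≈ε⇒x≈y y 1# y-1≈0
    ... | no  y-1≉0 = contradiction (begin
      x * (y - 1#)    ≈⟨ solve 3 (λ x y e → x :* (y :- e) := x :* y :- x :* e) refl x y 1# ⟩
      x * y - x * 1#  ≈⟨ +-cong xy≈x (-‿cong (*-identityʳ x)) ⟩
      x - x           ≈⟨ -‿inverseʳ x ⟩
      0#              ∎) (*-≉0 x≉0 y-1≉0)

    -- x ^ (1 + p ^ v u) = x if and only if x ^ (1 + u) = x, and the latter
    -- equation has simple roots as its derivative at a nonzero root is u.
    fixedPointCount-X^ : ∀ m m≥2 n v u → m ℕ.^ suc n ≡ suc (p ℕ.^ v ℕ.* u) → p ∤ u →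
      fixedPointCount (X^ m) (X^-degree m m≥2) n ≡ suc u
    fixedPointCount-X^ m m≥2 n v zero    _  p∤u = contradiction (p ℕ.∣0) p∤u
    fixedPointCount-X^ m m≥2 n v u@(suc u′) eq p∤u =
      fixedPointCount-roots (X^ m) (X^-degree m m≥2) n (+ₚ-degreeʳ -X (X^-Degree (suc u)) (s≤s (s≤s z≤n))) simple
        (λ x → mk⇔
          (λ fx≈x → trans (eval-h x) (x≈y⇒x∙y⁻¹≈ε (fix⇒ x (trans (sym (iterate-X^ m (suc n) x)) fx≈x))))
          (λ hx≈0 → trans (iterate-X^ m (suc n) x) (fix⇐ x (root⇒ x hx≈0))))
      where
      h : Poly
      h = X^ (suc u) +ₚ -X

      eval-h : ∀ x → eval h x ≈ x ^ suc u - x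
      eval-h x = trans (eval-+ (X^ (suc u)) -X x) (+-cong (eval-X^ (suc u) x) (eval--X x))

      root⇒ : ∀ x → Root h x → x ^ suc u ≈ x
      root⇒ x hx≈0 = x∙y⁻¹≈ε⇒x≈y _ _ (trans (sym (eval-h x)) hx≈0)

      0^ : ∀ k {x} → x ≈ 0# → x ^ suc k ≈ 0#
      0^ k x≈0 = trans (*-congʳ x≈0) (zeroˡ _)

      x^pᵛu : ∀ x → x ^ (p ℕ.^ v ℕ.* u) ≈ (x ^ u) ^ (p ℕ.^ v)
      x^pᵛu x = sym (trans (^-assocʳ x u (p ℕ.^ v)) (reflexive (≡.cong (x ^_) (ℕ.*-comm u (p ℕ.^ v)))))

      fix⇒ : ∀ x → x ^ (m ℕ.^ suc n) ≈ x → x ^ suc u ≈ x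
      fix⇒ x fx≈x with x ≈? 0#
      ... | yes x≈0 = trans (0^ u x≈0) (sym x≈0)
      ... | no  x≉0 = trans (*-congˡ (^p^v≈1⇒≈1 v (trans (sym (x^pᵛu x)) (x*y≈x⇒y≈1 x≉0
        (trans (reflexive (≡.cong (x ^_) (≡.sym eq))) fx≈x))))) (*-identityʳ x)

      fix⇐ : ∀ x → x ^ suc u ≈ x → x ^ (m ℕ.^ suc n) ≈ x
      fix⇐ x xx^u≈x = trans (reflexive (≡.cong (x ^_) eq)) (go (x ≈? 0#))
        where
        go : Dec (x ≈ 0#) → x ^ suc (p ℕ.^ v ℕ.* u) ≈ x
        go (yes x≈0) = trans (0^ (p ℕ.^ v ℕ.* u) x≈0) (sym x≈0)
        go (no  x≉0) = trans (*-congˡ (trans (x^pᵛu x) (trans (^-congˡ (p ℕ.^ v) (x*y≈x⇒y≈1 x≉0 xx^u≈x)) (1^n≈1 (p ℕ.^ v))))) (*-identityʳ x)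

      simple : SimpleRoots h
      simple x hx≈0 h′x≈0 with x ≈? 0# | x∙y⁻¹≈ε⇒x≈y _ _ (begin
        suc u · x ^ u - 1#                   ≈⟨ +-cong (deriv-X^ u x) (deriv--X x) ⟨
        deriv (X^ (suc u)) x + deriv -X x    ≈⟨ deriv-+ (X^ (suc u)) -X x ⟨
        deriv h x                            ≈⟨ h′x≈0 ⟩
        0#                                   ∎)
      -- At the root 0 the derivative is -1: u is positive, so x ^ u vanishes and cannot satisfy the
      -- equation `eq′`.
      ... | yes x≈0 | eq′ = 0≉1 (begin
        0#              ≈⟨ zeroʳ _ ⟨
        (suc u · 1#) * 0#    ≈⟨ *-congˡ (0^ u′ x≈0) ⟨
        (suc u · 1#) * x ^ u ≈⟨ ×-assoc-* (suc u) 1# (x ^ u) ⟩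
        suc u · (1# * x ^ u) ≈⟨ ×-congʳ (suc u) (*-identityˡ _) ⟩
        suc u · x ^ u   ≈⟨ eq′ ⟩
        1#              ∎)
      ... | no  x≉0 | eq′ = p∤⇒·1≉0 p∤u (begin
        u · 1#                ≈⟨ solve 2 (λ a e → a := (e :+ a) :- e) refl (u · 1#) 1# ⟩
        suc u · 1# - 1#       ≈⟨ +-congʳ (×-congʳ (suc u) (x*y≈x⇒y≈1 x≉0 (root⇒ x hx≈0))) ⟨
        suc u · x ^ u - 1#    ≈⟨ +-congʳ eq′ ⟩
        1# - 1#               ≈⟨ -‿inverseʳ 1# ⟩
        0#                    ∎)

module AlgebraicClosureCharacteristic {c ℓ} {p : ℕ} (K : AlgebraicClosure (𝔽 p) c ℓ) where
  open AlgebraicClosure K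
  open SemiringMult semiring renaming (_×_ to _·_)
  open MorphismStructures.RingMorphisms (𝔽 p) rawRing
  open IsRingHomomorphism ι-isRingHomomorphism
  open SetoidReasoning setoid

  ι-+ : ∀ n → ι (+ n) ≈ n · 1#
  ι-+ zero    = 0#-homo
  ι-+ (suc n) = trans (+-homo (+ 1) (+ n)) (+-cong 1#-homo (ι-+ n))

  p·1≈0 : p · 1# ≈ 0#
  p·1≈0 = begin
    p · 1#  ≈⟨ ι-+ p ⟨
    ι (+ p) ≈⟨ ⟦⟧-cong (≡.subst (p ∣_) (≡.cong ℤ.∣_∣ (≡.sym (ℤ.+-identityʳ (+ p)))) ℕ.∣-refl) ⟩
    ι (+ 0) ≈⟨ 0#-homo ⟩
    0#      ∎

-- Rational power series and the case of geometric fixed point counts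

module RationalSeries where
  open CommutativeRing ℚ.+-*-commutativeRing using (semiring)
  open SemiringMult semiring using (×-assoc-*) renaming (_×_ to _·_)
  open Series ℚ.+-*-commutativeRing public
  open ≡.≡-Reasoning

  private
    /-+ : ∀ i j d .{{_ : ℕ.NonZero d}} → (i ℚ./ d) ℚ.+ (j ℚ./ d) ≡ (i ℤ.+ j) ℚ./ d
    /-+ i j (suc d) = ℚ.toℚᵘ-injective (ℚᵘ.≃-trans (ℚ.toℚᵘ-homo-+ (i ℚ./ suc d) (j ℚ./ suc d))
      (ℚᵘ.≃-trans (ℚᵘ.+-cong (ℚ.toℚᵘ-fromℚᵘ (ℚᵘ.mkℚᵘ i d)) (ℚ.toℚᵘ-fromℚᵘ (ℚᵘ.mkℚᵘ j d)))
        (ℚᵘ.≃-trans (ℚᵘ.*≡* (begin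
          (i ℤ.* + suc d ℤ.+ j ℤ.* + suc d) ℤ.* + suc d ≡⟨ ≡.cong (ℤ._* + suc d) (ℤ.*-distribʳ-+ (+ suc d) i j) ⟨
          (i ℤ.+ j) ℤ.* + suc d ℤ.* + suc d             ≡⟨ ℤ.*-assoc (i ℤ.+ j) (+ suc d) (+ suc d) ⟩
          (i ℤ.+ j) ℤ.* (+ suc d ℤ.* + suc d)           ∎))
        (ℚᵘ.≃-sym (ℚ.toℚᵘ-fromℚᵘ (ℚᵘ.mkℚᵘ (i ℤ.+ j) d))))))

    ·-/ : ∀ n i d .{{_ : ℕ.NonZero d}} → n · (i ℚ./ d) ≡ (+ n ℤ.* i) ℚ./ d
    ·-/ zero    i d = ≡.sym (ℚ.0/n≡0 d)
    ·-/ (suc n) i d = begin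
      (i ℚ./ d) ℚ.+ n · (i ℚ./ d)          ≡⟨ ≡.cong ((i ℚ./ d) ℚ.+_) (·-/ n i d) ⟩
      (i ℚ./ d) ℚ.+ ((+ n ℤ.* i) ℚ./ d)    ≡⟨ /-+ i (+ n ℤ.* i) d ⟩
      (i ℤ.+ + n ℤ.* i) ℚ./ d              ≡⟨ ≡.cong (λ j → j ℚ./ d) (ℤ.suc-* (+ n) i) ⟨
      (+ suc n ℤ.* i) ℚ./ d                ∎

  -- Serves twice: (k + 1) / (k + 1)! = 1 / k! for the exponential, and n (a / n) = a for the
  -- logarithm of the zeta function.
  ·-/-cancel : ∀ n i d e .{{_ : ℕ.NonZero d}} .{{_ : ℕ.NonZero e}} → e ≡ suc n ℕ.* d → suc n · (i ℚ./ e) ≡ i ℚ./ d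
  ·-/-cancel n i d@(suc d′) e@.(suc n ℕ.* d) ≡.refl = ≡.trans (·-/ (suc n) i e)
    (ℚ.fromℚᵘ-cong {ℚᵘ.mkℚᵘ (+ suc n ℤ.* i) (d′ ℕ.+ n ℕ.* d)} {ℚᵘ.mkℚᵘ i d′} (ℚᵘ.*≡* (begin
      (+ suc n ℤ.* i) ℤ.* + d     ≡⟨ ≡.cong (ℤ._* + d) (ℤ.*-comm (+ suc n) i) ⟩
      (i ℤ.* + suc n) ℤ.* + d     ≡⟨ ℤ.*-assoc i (+ suc n) (+ d) ⟩
      i ℤ.* (+ suc n ℤ.* + d)     ≡⟨ ≡.cong (i ℤ.*_) (ℤ.pos-* (suc n) d) ⟨
      i ℤ.* + (suc n ℕ.* d)       ∎)))

  /1≡·1 : ∀ n → (+ n) ℚ./ 1 ≡ n · 1ℚ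
  /1≡·1 n = ≡.sym (≡.trans (·-/ n (+ 1) 1) (≡.cong (λ i → i ℚ./ 1) (ℤ.*-identityʳ (+ n))))

  0≤·1 : ∀ n → 0ℚ ℚ.≤ n · 1ℚ
  0≤·1 zero    = ℚ.≤-refl
  0≤·1 (suc n) = ℚ.+-mono-≤ (ℚ.nonNegative⁻¹ 1ℚ) (0≤·1 n)

  suc·1≢0 : ∀ n → suc n · 1ℚ ≢ 0ℚ
  suc·1≢0 n = ≡.≢-sym (ℚ.<⇒≢ (ℚ.+-mono-<-≤ (ℚ.positive⁻¹ 1ℚ) (0≤·1 n)))

  *-cancel : ∀ {x y} → x ≢ 0ℚ → x ℚ.* y ≡ 0ℚ → y ≡ 0ℚ
  *-cancel {x} {y} x≢0 xy≡0 = begin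
    y                      ≡⟨ ℚ.*-identityˡ y ⟨
    1ℚ ℚ.* y               ≡⟨ ≡.cong (ℚ._* y) (ℚ.*-inverseˡ x) ⟨
    ℚ.1/ x ℚ.* x ℚ.* y     ≡⟨ ℚ.*-assoc (ℚ.1/ x) x y ⟩
    ℚ.1/ x ℚ.* (x ℚ.* y)   ≡⟨ ≡.cong (ℚ.1/ x ℚ.*_) xy≡0 ⟩
    ℚ.1/ x ℚ.* 0ℚ          ≡⟨ ℚ.*-zeroʳ (ℚ.1/ x) ⟩
    0ℚ                     ∎
    where instance
      x-nonZero : ℚ.NonZero x
      x-nonZero = ℚ.≢-nonZero x≢0

  ·≡·1* : ∀ n x → n · x ≡ (n · 1ℚ) ℚ.* x
  ·≡·1* n x = ≡.sym (≡.trans (×-assoc-* n 1ℚ x) (≡.cong (n ·_) (ℚ.*-identityˡ x)))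

  ·-cancel : ∀ n {x} → suc n · x ≡ 0ℚ → x ≡ 0ℚ
  ·-cancel n {x} eq = *-cancel (suc·1≢0 n) (≡.trans (≡.sym (·≡·1* (suc n) x)) eq)

  ≡0-stable : ∀ {x} → ¬ ¬ (x ≡ 0ℚ) → x ≡ 0ℚ
  ≡0-stable {x} = decidable-stable (x ℚ.≟ 0ℚ)

  ℚ⟦t⟧ : DifferentialDomain 0ℓ 0ℓ
  ℚ⟦t⟧ = differentialDomain ≡0-stable *-cancel ·-cancel (λ ())

  polynomials : DifferentialSubring ℚ⟦t⟧ 0ℓ
  polynomials = finite ≡0-stable *-cancel ·-cancel (λ ())

  1/_! : ℕ → ℚ
  1/ k ! = (ℤ.1ℤ ℚ./ (k ℕ.!)) {{k ℕ.!≢0}}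

  suc·1/suc! : ∀ k → suc k · (1/ suc k !) ≡ 1/ k !
  suc·1/suc! k = ·-/-cancel k ℤ.1ℤ (k ℕ.!) (suc k ℕ.!) {{k ℕ.!≢0}} {{suc k ℕ.!≢0}} ≡.refl

  open Exponential 1/_! suc·1/suc! using (_^ₙ_; expₙ; θ-exp)

  exp≋expₙ : ∀ s → exp s ≋ expₙ s
  exp≋expₙ s n = SemiringSum.sum-cong-≋ semiring {suc n} λ k → ≡.cong (ℚ._* 1/ toℕ k !) (^ₛ≋^ₙ (toℕ k) n)
    where
    ^ₛ≋^ₙ : ∀ k → s ^ₛ k ≋ s ^ₙ k
    ^ₛ≋^ₙ zero    zero    = ≡.refl
    ^ₛ≋^ₙ zero    (suc n) = ≡.refl
    ^ₛ≋^ₙ (suc k) = ⊠-cong {s} {s} {s ^ₛ k} {s ^ₙ k} (λ _ → ≡.refl) (^ₛ≋^ₙ k)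

  θ-exp′ : ∀ {s} → s 0 ≡ 0ℚ → θ (exp s) ≋ exp s ⊠ θ s
  θ-exp′ {s} s₀≡0 n = begin
    θ (exp s) n       ≡⟨ ≡.cong (n ·_) (exp≋expₙ s n) ⟩
    θ (expₙ s) n      ≡⟨ θ-exp {s} s₀≡0 n ⟩
    (θ s ⊠ expₙ s) n  ≡⟨ ⊠-cong {θ s} {θ s} {exp s} {expₙ s} (λ _ → ≡.refl) (exp≋expₙ s) n ⟨
    (θ s ⊠ exp s) n   ≡⟨ ⊠-comm (θ s) (exp s) n ⟩
    (exp s ⊠ θ s) n   ∎

module RationalExponential where
  open RationalSeries
  open CommutativeRing ℚ.+-*-commutativeRing using (semiring)
  open SemiringMult semiring using (×-comm-*; ×1-homo-*) renaming (_×_ to _·_)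
  open ≡.≡-Reasoning

  ·-injective : ∀ n {x y} → suc n · x ≡ suc n · y → x ≡ y
  ·-injective n {x} {y} eq = begin
    x                   ≡⟨ solve 2 (λ x y → x := x :- y :+ y) ≡.refl x y ⟩
    x ℚ.- y ℚ.+ y       ≡⟨ ≡.cong (ℚ._+ y) (·-cancel n {x ℚ.- y} (begin
      suc n · (x ℚ.- y)               ≡⟨ ·≡·1* (suc n) (x ℚ.- y) ⟩
      (suc n · 1ℚ) ℚ.* (x ℚ.- y)
        ≡⟨ solve 3 (λ k x y → k :* (x :- y) := k :* x :- k :* y) ≡.refl (suc n · 1ℚ) x y ⟩
      (suc n · 1ℚ) ℚ.* x ℚ.- (suc n · 1ℚ) ℚ.* y
        ≡⟨ ≡.cong₂ ℚ._-_ (·≡·1* (suc n) x) (·≡·1* (suc n) y) ⟨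
      suc n · x ℚ.- suc n · y         ≡⟨ ≡.cong (ℚ._- suc n · y) eq ⟩
      suc n · y ℚ.- suc n · y         ≡⟨ ℚ.+-inverseʳ (suc n · y) ⟩
      0ℚ                              ∎)) ⟩
    0ℚ ℚ.+ y            ≡⟨ ℚ.+-identityˡ y ⟩
    y                   ∎
    where open DifferenceSolver ℚ.+-*-commutativeRing

  -- If θ s = Σ dⁿtⁿ then θz = zθs gives z_{n+1} = d z_n for z = exp s.
  exp-geometric : ∀ d s → s 0 ≡ 0ℚ → (∀ n → θ s (suc n) ≡ (d ℕ.^ suc n) · 1ℚ) →
                  ∀ n → exp s (suc n) ≡ (d · 1ℚ) ℚ.* exp s n
  exp-geometric d s s₀≡0 θs n = ·-injective n (begin
    suc n · z (suc n)                          ≡⟨ θ-exp′ {s} s₀≡0 (suc n) ⟩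
    (z ⊠ θ s) (suc n)                          ≡⟨ ⊠-tailʳ z (θ s) n ⟩
    z (suc n) ℚ.* 0ℚ ℚ.+ (z ⊠ tail (θ s)) n    ≡⟨ ≡.cong (ℚ._+ (z ⊠ tail (θ s)) n) (ℚ.*-zeroʳ (z (suc n))) ⟩
    0ℚ ℚ.+ (z ⊠ tail (θ s)) n                  ≡⟨ ℚ.+-identityˡ _ ⟩
    (z ⊠ tail (θ s)) n                         ≡⟨ convolution n ⟩
    suc n · (D ℚ.* z n)                        ∎)
    where
    z = exp s
    D = d · 1ℚ

    θs-0 : θ s 1 ≡ D
    θs-0 = ≡.trans (θs 0) (≡.cong (_· 1ℚ) (ℕ.^-identityʳ d))

    θs-suc : ∀ n → θ s (suc (suc n)) ≡ D ℚ.* θ s (suc n)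
    θs-suc n = ≡.trans (θs (suc n)) (≡.trans (×1-homo-* d (d ℕ.^ suc n)) (≡.cong (D ℚ.*_) (≡.sym (θs n))))

    -- Since θ s is geometric, dropping one more term multiplies it by D. What remains is D times
    -- the coefficient of z θs at n + 1, which θz = z θs identifies as (n + 1) z_{n+1}.
    convolution : ∀ n → (z ⊠ tail (θ s)) n ≡ suc n · (D ℚ.* z n)
    convolution zero = begin
      z 0 ℚ.* θ s 1 ℚ.+ 0ℚ     ≡⟨ ≡.cong (λ x → z 0 ℚ.* x ℚ.+ 0ℚ) θs-0 ⟩
      z 0 ℚ.* D ℚ.+ 0ℚ         ≡⟨ ≡.cong (ℚ._+ 0ℚ) (ℚ.*-comm (z 0) D) ⟩
      D ℚ.* z 0 ℚ.+ 0ℚ         ∎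
    convolution (suc n) = begin
      (z ⊠ tail (θ s)) (suc n)
        ≡⟨ ⊠-tailʳ z (tail (θ s)) n ⟩
      z (suc n) ℚ.* θ s 1 ℚ.+ (z ⊠ tail (tail (θ s))) n
        ≡⟨ ≡.cong₂ ℚ._+_ (≡.trans (≡.cong (z (suc n) ℚ.*_) θs-0) (ℚ.*-comm (z (suc n)) D)) (begin
             (z ⊠ tail (tail (θ s))) n             ≡⟨ ⊠-comm z (tail (tail (θ s))) n ⟩
             (tail (tail (θ s)) ⊠ z) n             ≡⟨ ⊠-cong {tail (tail (θ s))} {λ k → D ℚ.* tail (θ s) k} {z} {z} θs-suc (λ _ → ≡.refl) n ⟩
             ((λ k → D ℚ.* tail (θ s) k) ⊠ z) n    ≡⟨ ⊠-scaleˡ D (tail (θ s)) z n ⟩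
             D ℚ.* (tail (θ s) ⊠ z) n              ≡⟨ ≡.cong (D ℚ.*_) (⊠-comm (tail (θ s)) z n) ⟩
             D ℚ.* (z ⊠ tail (θ s)) n              ≡⟨ ≡.cong (D ℚ.*_) (begin
               (z ⊠ tail (θ s)) n                       ≡⟨ ℚ.+-identityˡ _ ⟨
               0ℚ ℚ.+ (z ⊠ tail (θ s)) n                ≡⟨ ≡.cong (ℚ._+ (z ⊠ tail (θ s)) n) (ℚ.*-zeroʳ (z (suc n))) ⟨
               z (suc n) ℚ.* 0ℚ ℚ.+ (z ⊠ tail (θ s)) n  ≡⟨ ⊠-tailʳ z (θ s) n ⟨
               (z ⊠ θ s) (suc n)                        ≡⟨ θ-exp′ {s} s₀≡0 (suc n) ⟨
               suc n · z (suc n)                        ∎) ⟩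
             D ℚ.* (suc n · z (suc n))             ≡⟨ ×-comm-* (suc n) D (z (suc n)) ⟩
             suc n · (D ℚ.* z (suc n))             ∎) ⟩
      D ℚ.* z (suc n) ℚ.+ suc n · (D ℚ.* z (suc n)) ∎

  exp-geometric-rational : ∀ d s → s 0 ≡ 0ℚ → (∀ n → θ s (suc n) ≡ (d ℕ.^ suc n) · 1ℚ) →
                           Rational (fromSeries (exp s))
  exp-geometric-rational d s s₀≡0 θs = num , den , here (λ ()) , λ
    { (+ n)      → ≡.subst (λ k → (z ⊠ ℚ[t].coeff den) k ≡ ℚ[t].coeff num k) (≡.sym (ℕ.+-identityʳ n)) (z*den n)
    ; -[1+ n ]   → ≡.refl
    }
    where
    z = exp s
    D = d · 1ℚ
    num den : List ℚ
    num = 1ℚ ∷ []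
    den = 1ℚ ∷ ℚ.- D ∷ []
    open DifferenceSolver ℚ.+-*-commutativeRing

    z*den : ∀ n → (z ⊠ ℚ[t].coeff den) n ≡ ℚ[t].coeff num n
    z*den zero    = ≡.refl
    z*den (suc n) = begin
      (z ⊠ ℚ[t].coeff den) (suc n)           ≡⟨ ⊠-comm z (ℚ[t].coeff den) (suc n) ⟩
      1ℚ ℚ.* z (suc n) ℚ.+ (ℚ[t].coeff (ℚ.- D ∷ []) ⊠ z) n
        ≡⟨ ≡.cong₂ ℚ._+_ (≡.trans (ℚ.*-identityˡ _) (exp-geometric d s s₀≡0 θs n)) (constant n) ⟩
      D ℚ.* z n ℚ.+ ℚ.- D ℚ.* z n            ≡⟨ ℚ.*-distribʳ-+ (z n) D (ℚ.- D) ⟨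
      (D ℚ.+ ℚ.- D) ℚ.* z n                  ≡⟨ ≡.cong (ℚ._* z n) (ℚ.+-inverseʳ D) ⟩
      0ℚ ℚ.* z n                             ≡⟨ ℚ.*-zeroˡ (z n) ⟩
      0ℚ                                     ∎
      where
      constant : ∀ n → (ℚ[t].coeff (ℚ.- D ∷ []) ⊠ z) n ≡ ℚ.- D ℚ.* z n
      constant zero    = ℚ.+-identityʳ _
      constant (suc n) = ≡.trans (≡.cong (ℚ.- D ℚ.* z (suc n) ℚ.+_) (⊠-zeroˡ {𝟘} (λ _ → ≡.refl) z n)) (ℚ.+-identityʳ _)

-- From an equation over ℚ(t) to dependent derivatives

module ClearDenominators (ζ₀ : PowerSeries) where
  open RationalSeries
  open AlgebraicElement RationalSeries.ℚ⟦t⟧ RationalSeries.polynomials ζ₀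
  open RawRing ℚ⦅t⦆ using (_≈_; 0#)
  module L = Polynomial ℚ⦅t⦆
  open Laurent

  coeffₗ-0 : ∀ k → coeffₗ 0# k ≡ 0ℚ
  coeffₗ-0 k with k ℤ.+ + 0
  ... | + n      = ≡.refl
  ... | -[1+ _ ] = ≡.refl

  series≋𝟘⇒≈0 : ∀ w → series w ≋ 𝟘 → w ≈ 0#
  series≋𝟘⇒≈0 w w≋0 k = ≡.trans (go k) (≡.sym (coeffₗ-0 k))
    where
    go : ∀ k → coeffₗ w k ≡ 0ℚ
    go k with k ℤ.+ + pole w
    ... | + n      = w≋0 n
    ... | -[1+ _ ] = ≡.refl

  ≈0⇒series≋𝟘 : ∀ w → w ≈ 0# → series w ≋ 𝟘
  ≈0⇒series≋𝟘 w w≈0 n = ≡.trans (≡.sym go) (≡.trans (w≈0 k) (coeffₗ-0 k))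
    where
    k = + n ℤ.- + pole w
    k+pole≡n : k ℤ.+ + pole w ≡ + n
    k+pole≡n = ≡.trans (ℤ.+-assoc (+ n) (ℤ.- + pole w) (+ pole w))
      (≡.trans (≡.cong (λ i → + n ℤ.+ i) (ℤ.+-inverseˡ (+ pole w))) (ℤ.+-identityʳ (+ n)))
    go : coeffₗ w k ≡ series w n
    go rewrite k+pole≡n = ≡.refl

  coeff-finite : ∀ f n → length f ≤ n → ℚ[t].coeff f n ≡ 0ℚ
  coeff-finite []      n       _         = ≡.refl
  coeff-finite (_ ∷ f) (suc n) (s≤s f≤n) = coeff-finite f n f≤n

  Nonzero⇒coeff≢𝟘 : ∀ {f} → ℚ[t].Nonzero f → ¬ (ℚ[t].coeff f ≋ 𝟘)
  Nonzero⇒coeff≢𝟘 (here a≢0) f≋0 = a≢0 (f≋0 0)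
  Nonzero⇒coeff≢𝟘 (there f≢0) f≋0 = Nonzero⇒coeff≢𝟘 f≢0 (f≋0 ∘ suc)

  t^_ : ℕ → PowerSeries
  t^ m = shift m 𝟙

  shift≋t^ : ∀ m s → shift m s ≋ t^ m ⊠ s
  shift≋t^ zero    s n       = ≡.sym (⊠-identityˡ s n)
  shift≋t^ (suc m) s zero    = ≡.sym (≡.trans (ℚ.+-identityʳ _) (ℚ.*-zeroˡ (s 0)))
  shift≋t^ (suc m) s (suc n) = ≡.trans (shift≋t^ m s n)
    (≡.sym (≡.trans (≡.cong (ℚ._+ (t^ m ⊠ s) n) (ℚ.*-zeroˡ (s (suc n)))) (ℚ.+-identityˡ _)))

  t^-finite : ∀ m → Finite (t^ m)
  t^-finite m = suc m , go m
    where
    go : ∀ m n → m ℕ.< n → (t^ m) n ≡ 0ℚ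
    go zero    (suc n) _         = ≡.refl
    go (suc m) (suc n) (s≤s m<n) = go m n m<n

  t^≢𝟘 : ∀ m → ¬ (t^ m ≋ 𝟘)
  t^≢𝟘 zero    eq = contradiction (eq 0) λ ()
  t^≢𝟘 (suc m) eq = t^≢𝟘 m (eq ∘ suc)

  -- If w = t^(-N) s and w d = num, then s d = t^N num is again a polynomial. So the pole of w
  -- enters the bound on its support; the summand 0 is the pole of d.
  denominator : ∀ w → Rational w → ∃[ d ] Finite d × ¬ (d ≋ 𝟘) × Finite (series w ⊠ d)
  denominator w (num , den , den≢0 , w*den≈num) =
    ℚ[t].coeff den , (length den , coeff-finite den) , Nonzero⇒coeff≢𝟘 den≢0 ,
    length num ℕ.+ (pole w ℕ.+ 0) , λ n bound≤n → ≡.subst (λ n → (series w ⊠ ℚ[t].coeff den) n ≡ 0ℚ)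
      (ℕ.m∸n+n≡m (ℕ.≤-trans (ℕ.m≤n+m _ (length num)) bound≤n))
      (≡.trans (w*den≈num (+ (n ℕ.∸ (pole w ℕ.+ 0))))
        (coeff-finite num _ (ℕ.≤-trans (ℕ.m+n≤o⇒m≤o∸n (length num) bound≤n) (ℕ.m≤m+n _ 0))))

  eval-series : L.Poly → PowerSeries
  eval-series G = series (L.eval G (fromSeries ζ₀))

  -- Adding Laurent series brings them to a common pole order, which multiplies the series of each
  -- by t to the pole of the other.
  eval-cons : ∀ w f → eval-series (w ∷ f) ≋
    (t^ pole (L.eval f (fromSeries ζ₀)) ⊠ series w) ⊞ (t^ pole w ⊠ (ζ₀ ⊠ eval-series f))
  eval-cons w f n = ≡.cong₂ ℚ._+_
    (shift≋t^ (pole (L.eval f (fromSeries ζ₀))) (series w) n)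
    (shift≋t^ (pole w) (ζ₀ ⊠ eval-series f) n)

  eval-clearable : ∀ G → All Rational G → Clearable (eval-series G) (L.Nonzero G)
  eval-clearable [] [] = clearable-nil {E = eval-series []} (λ _ → ≡.refl) λ ()
  eval-clearable (w ∷ f) (rational-w ∷ rational-f) =
    let d , Fd , d≢0 , Fnum = denominator w rational-w
        M = pole (L.eval f (fromSeries ζ₀))
    in clearable-cons {T = t^ M} {t^ pole w} {series w} {d} {eval-series (w ∷ f)} {eval-series f}
         (t^-finite M) (t^≢𝟘 M) (t^-finite (pole w)) (t^≢𝟘 (pole w)) Fd d≢0 Fnum (eval-cons w f)
         (λ { (here w≉0) w≋0 → contradiction (series≋𝟘⇒≈0 w w≋0) w≉0 ; (there f≢0) _ → f≢0 })
         (eval-clearable f rational-f)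

  algebraic⇒dependent : ∀ f → ¬ (ζ₀ ≋ 𝟘) → ζ₀ ⊠ f ≋ θ ζ₀ → AlgebraicOver ℚ⦅t⦆ Rational (fromSeries ζ₀) →
    ¬ ¬ (∃[ n ] Dependent {n} (λ i → fold f θ (toℕ i)))
  algebraic⇒dependent f ζ₀≢0 ζ₀f≋θζ₀ (G , rational-G , G≢0 , G≈0) =
    clearable-dependent {E = eval-series G} {f} (eval-clearable G rational-G) G≢0
      (≈0⇒series≋𝟘 (L.eval G (fromSeries ζ₀)) G≈0) ζ₀≢0 ζ₀f≋θζ₀

-- Polynomial functions and their independence from an exponential

module PolynomialFunctions where
  open RationalSeries using (*-cancel; suc·1≢0)
  open CommutativeRing ℚ.+-*-commutativeRing using (semiring)
  open SemiringMult semiring using () renaming (_×_ to _·_)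
  open SemiringExp semiring using (_^_)
  open SemiringSum semiring using (sum; sum-cong-≋; *-distribˡ-sum)
  open DifferenceSolver ℚ.+-*-commutativeRing
  open ≡.≡-Reasoning

  -- The functions given by polynomials of degree less than k
  data PolynomialFunction : ℕ → (ℚ → ℚ) → Set where
    nil  : ∀ {f} → (∀ X → f X ≡ 0ℚ) → PolynomialFunction 0 f
    cons : ∀ {k f g} a → PolynomialFunction k g → (∀ X → f X ≡ a ℚ.+ X ℚ.* g X) → PolynomialFunction (suc k) f

  poly-zero : ∀ {k f} → (∀ X → f X ≡ 0ℚ) → PolynomialFunction k f
  poly-zero {zero}      f≡0 = nil f≡0
  poly-zero {suc k} {f} f≡0 = cons 0ℚ (poly-zero (λ _ → ≡.refl)) λ X → begin
    f X                ≡⟨ f≡0 X ⟩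
    0ℚ                 ≡⟨ ℚ.*-zeroʳ X ⟨
    X ℚ.* 0ℚ           ≡⟨ ℚ.+-identityˡ _ ⟨
    0ℚ ℚ.+ X ℚ.* 0ℚ    ∎

  poly-suc : ∀ {k f} → PolynomialFunction k f → PolynomialFunction (suc k) f
  poly-suc (nil f≡0)     = poly-zero f≡0
  poly-suc (cons a g eq) = cons a (poly-suc g) eq

  poly-+ : ∀ {k f g} → PolynomialFunction k f → PolynomialFunction k g → PolynomialFunction k (λ X → f X ℚ.+ g X)
  poly-+ (nil f≡0) (nil g≡0) = nil λ X → ≡.cong₂ ℚ._+_ (f≡0 X) (g≡0 X)
  poly-+ (cons {g = f′} a f° eq) (cons {g = g′} b g° eq′) = cons (a ℚ.+ b) (poly-+ f° g°) λ X →
    ≡.trans (≡.cong₂ ℚ._+_ (eq X) (eq′ X))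
      (solve 5 (λ a b X f g → (a :+ X :* f) :+ (b :+ X :* g) := (a :+ b) :+ X :* (f :+ g)) ≡.refl a b X (f′ X) (g′ X))

  poly-* : ∀ {k f} b → PolynomialFunction k f → PolynomialFunction k (λ X → b ℚ.* f X)
  poly-* b (nil f≡0) = nil λ X → ≡.trans (≡.cong (b ℚ.*_) (f≡0 X)) (ℚ.*-zeroʳ b)
  poly-* b (cons {g = g} a g° eq) = cons (b ℚ.* a) (poly-* b g°) λ X →
    ≡.trans (≡.cong (b ℚ.*_) (eq X))
      (solve 4 (λ a b X g → b :* (a :+ X :* g) := b :* a :+ X :* (b :* g)) ≡.refl a b X (g X))

  poly-resp : ∀ {k f g} → (∀ X → f X ≡ g X) → PolynomialFunction k f → PolynomialFunction k g
  poly-resp f≡g (nil f≡0)      = nil λ X → ≡.trans (≡.sym (f≡g X)) (f≡0 X)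
  poly-resp f≡g (cons a h° eq) = cons a h° λ X → ≡.trans (≡.sym (f≡g X)) (eq X)

  poly-translate : ∀ {k f} b → PolynomialFunction k f → PolynomialFunction k (λ X → f (X ℚ.+ b))
  poly-translate b (nil f≡0) = nil λ X → f≡0 (X ℚ.+ b)
  poly-translate b (cons {f = f} {g} a g° eq) = poly-resp
    (λ X → ≡.sym (≡.trans (eq (X ℚ.+ b))
      (solve 4 (λ a b X g → a :+ (X :+ b) :* g := (a :+ X :* g) :+ b :* g) ≡.refl a b X (g (X ℚ.+ b)))))
    (poly-+ (cons a g⁺ λ _ → ≡.refl) (poly-suc (poly-* b g⁺)))
    where
    g⁺ = poly-translate b g°

  poly-sum : ∀ {k n} (f : Fin n → ℚ → ℚ) → (∀ i → PolynomialFunction k (f i)) → PolynomialFunction k (λ X → sum λ i → f i X)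
  poly-sum {n = zero}  f f° = poly-zero λ _ → ≡.refl
  poly-sum {n = suc n} f f° = poly-+ (f° zero) (poly-sum (f ∘ suc) (f° ∘ suc))

  horner : ∀ {n} (a : Fin (suc n) → ℚ) X → sum (λ i → a i ℚ.* X ^ toℕ i) ≡ a zero ℚ.+ X ℚ.* sum (λ i → a (suc i) ℚ.* X ^ toℕ i)
  horner a X = ≡.cong₂ ℚ._+_ (ℚ.*-identityʳ (a zero))
    (≡.trans (sum-cong-≋ (λ i → solve 3 (λ a X w → a :* (X :* w) := X :* (a :* w)) ≡.refl (a (suc i)) X (X ^ toℕ i)))
             (≡.sym (*-distribˡ-sum X (λ i → a (suc i) ℚ.* X ^ toℕ i))))

  poly-coefficients : ∀ {n} (a : Fin n → ℚ) → PolynomialFunction n (λ X → sum λ i → a i ℚ.* X ^ toℕ i)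
  poly-coefficients {zero}  a = nil λ _ → ≡.refl
  poly-coefficients {suc n} a = cons (a zero) (poly-coefficients (a ∘ suc)) (horner a)

  poly-quotient : ∀ {k f} → PolynomialFunction (suc k) f → ∀ Y →
    ∃ λ h → PolynomialFunction k h × (∀ X → f X ≡ f Y ℚ.+ (X ℚ.- Y) ℚ.* h X)
  poly-quotient {zero} {f} (cons {g = g} a (nil g≡0) eq) Y = (λ _ → 0ℚ) , nil (λ _ → ≡.refl) , λ X → begin
    f X                         ≡⟨ const X ⟩
    a                           ≡⟨ const Y ⟨
    f Y                         ≡⟨ ℚ.+-identityʳ _ ⟨
    f Y ℚ.+ 0ℚ                  ≡⟨ ≡.cong (f Y ℚ.+_) (ℚ.*-zeroʳ (X ℚ.- Y)) ⟨
    f Y ℚ.+ (X ℚ.- Y) ℚ.* 0ℚ    ∎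
    where
    const : ∀ X → f X ≡ a
    const X = ≡.trans (eq X) (≡.trans (≡.cong (a ℚ.+_) (≡.trans (≡.cong (X ℚ.*_) (g≡0 X)) (ℚ.*-zeroʳ X))) (ℚ.+-identityʳ a))
  poly-quotient {suc k} {f} (cons {g = g} a g° eq) Y with poly-quotient g° Y
  ... | h , h° , eq′ = (λ X → g Y ℚ.+ X ℚ.* h X) , cons (g Y) h° (λ _ → ≡.refl) , λ X → begin
    f X                                                      ≡⟨ eq X ⟩
    a ℚ.+ X ℚ.* g X                                          ≡⟨ ≡.cong (λ y → a ℚ.+ X ℚ.* y) (eq′ X) ⟩
    a ℚ.+ X ℚ.* (g Y ℚ.+ (X ℚ.- Y) ℚ.* h X)
      ≡⟨ solve 5 (λ a X Y g h → a :+ X :* (g :+ (X :- Y) :* h) := (a :+ Y :* g) :+ (X :- Y) :* (g :+ X :* h))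
           ≡.refl a X Y (g Y) (h X) ⟩
    (a ℚ.+ Y ℚ.* g Y) ℚ.+ (X ℚ.- Y) ℚ.* (g Y ℚ.+ X ℚ.* h X)  ≡⟨ ≡.cong (ℚ._+ (X ℚ.- Y) ℚ.* (g Y ℚ.+ X ℚ.* h X)) (eq Y) ⟨
    f Y ℚ.+ (X ℚ.- Y) ℚ.* (g Y ℚ.+ X ℚ.* h X)                ∎

  progression-suc : ∀ α β s → (α ℚ.+ β) ℚ.+ β ℚ.* (s · 1ℚ) ≡ α ℚ.+ β ℚ.* (suc s · 1ℚ)
  progression-suc α β s = ≡.trans
    (≡.cong (λ x → (α ℚ.+ x) ℚ.+ β ℚ.* (s · 1ℚ)) (≡.sym (ℚ.*-identityʳ β)))
    (solve 4 (λ α β s e → (α :+ β :* e) :+ β :* s := α :+ β :* (e :+ s)) ≡.refl α β (s · 1ℚ) 1ℚ)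

  progression-zero : ∀ α β → α ℚ.+ β ℚ.* 0ℚ ≡ α
  progression-zero α β = ≡.trans (≡.cong (α ℚ.+_) (ℚ.*-zeroʳ β)) (ℚ.+-identityʳ α)

  -- Infinitely many zeros: division by X - α leaves a quotient with a smaller degree bound that
  -- vanishes on the progression started at α + β.
  vanishing : ∀ {k f} → PolynomialFunction k f → ∀ α {β} → β ≢ 0ℚ → (∀ s → f (α ℚ.+ β ℚ.* (s · 1ℚ)) ≡ 0ℚ) → ∀ X → f X ≡ 0ℚ
  vanishing (nil f≡0) α β≢0 _ = f≡0
  vanishing {suc k} {f} f° α {β} β≢0 f≡0 with poly-quotient f° α
  ... | h , h° , eq = λ X → begin
    f X                          ≡⟨ eq X ⟩
    f α ℚ.+ (X ℚ.- α) ℚ.* h X    ≡⟨ ≡.cong₂ (λ y z → y ℚ.+ (X ℚ.- α) ℚ.* z) fα≡0 (vanishing h° (α ℚ.+ β) β≢0 h≡0 X) ⟩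
    0ℚ ℚ.+ (X ℚ.- α) ℚ.* 0ℚ      ≡⟨ ℚ.+-identityˡ _ ⟩
    (X ℚ.- α) ℚ.* 0ℚ             ≡⟨ ℚ.*-zeroʳ (X ℚ.- α) ⟩
    0ℚ                           ∎
    where
    fα≡0 : f α ≡ 0ℚ
    fα≡0 = ≡.trans (≡.cong f (≡.sym (progression-zero α β))) (f≡0 0)

    h≡0 : ∀ s → h ((α ℚ.+ β) ℚ.+ β ℚ.* (s · 1ℚ)) ≡ 0ℚ
    h≡0 s = *-cancel (suc·1≢0 s) (*-cancel β≢0 (begin
      β ℚ.* ((suc s · 1ℚ) ℚ.* h X)       ≡⟨ solve 4 (λ α β s h → β :* (s :* h) := ((α :+ β :* s) :- α) :* h)
           ≡.refl α β (suc s · 1ℚ) (h X) ⟩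
      (X′ ℚ.- α) ℚ.* h X                 ≡⟨ ≡.cong (λ x → (X′ ℚ.- α) ℚ.* h x) (progression-suc α β s) ⟩
      (X′ ℚ.- α) ℚ.* h X′                ≡⟨ ℚ.+-identityˡ _ ⟨
      0ℚ ℚ.+ (X′ ℚ.- α) ℚ.* h X′         ≡⟨ ≡.cong (ℚ._+ (X′ ℚ.- α) ℚ.* h X′) fα≡0 ⟨
      f α ℚ.+ (X′ ℚ.- α) ℚ.* h X′        ≡⟨ eq X′ ⟨
      f X′                               ≡⟨ f≡0 (suc s) ⟩
      0ℚ                                 ∎))
      where
      X  = (α ℚ.+ β) ℚ.+ β ℚ.* (s · 1ℚ)
      X′ = α ℚ.+ β ℚ.* (suc s · 1ℚ)

  -- X = 0 yields the first coefficient. Dividing by X is possible away from 0 only; the progression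
  -- 1, 2, 3, ... suffices for `vanishing` to kill the remaining polynomial everywhere.
  coefficients-vanish : ∀ {n} (a : Fin n → ℚ) → (∀ X → sum (λ i → a i ℚ.* X ^ toℕ i) ≡ 0ℚ) → ∀ i → a i ≡ 0ℚ
  coefficients-vanish {suc n} a eq = λ { zero → a₀≡0 ; (suc i) → coefficients-vanish (a ∘ suc) rest i }
    where
    tail-sum : ℚ → ℚ
    tail-sum X = sum λ i → a (suc i) ℚ.* X ^ toℕ i

    a₀≡0 : a zero ≡ 0ℚ
    a₀≡0 = begin
      a zero                           ≡⟨ ℚ.+-identityʳ _ ⟨
      a zero ℚ.+ 0ℚ                    ≡⟨ ≡.cong (a zero ℚ.+_) (ℚ.*-zeroˡ (tail-sum 0ℚ)) ⟨
      a zero ℚ.+ 0ℚ ℚ.* tail-sum 0ℚ    ≡⟨ horner a 0ℚ ⟨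
      sum (λ i → a i ℚ.* 0ℚ ^ toℕ i)   ≡⟨ eq 0ℚ ⟩
      0ℚ                               ∎

    X*tail≡0 : ∀ X → X ℚ.* tail-sum X ≡ 0ℚ
    X*tail≡0 X = begin
      X ℚ.* tail-sum X                 ≡⟨ ℚ.+-identityˡ _ ⟨
      0ℚ ℚ.+ X ℚ.* tail-sum X          ≡⟨ ≡.cong (ℚ._+ X ℚ.* tail-sum X) a₀≡0 ⟨
      a zero ℚ.+ X ℚ.* tail-sum X      ≡⟨ horner a X ⟨
      sum (λ i → a i ℚ.* X ^ toℕ i)    ≡⟨ eq X ⟩
      0ℚ                               ∎

    rest : ∀ X → tail-sum X ≡ 0ℚ
    rest = vanishing (poly-coefficients (a ∘ suc)) 1ℚ {1ℚ} (λ ()) λ s → *-cancel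
      (≡.subst (_≢ 0ℚ) (≡.cong (1ℚ ℚ.+_) (≡.sym (ℚ.*-identityˡ (s · 1ℚ)))) (suc·1≢0 s))
      (X*tail≡0 (1ℚ ℚ.+ 1ℚ ℚ.* (s · 1ℚ)))

  Δ : (ℕ → ℚ) → ℕ → ℚ
  Δ f s = f (suc s) ℚ.- f s

  -- Δᵏ f = 0, that is, f is a polynomial sequence of degree less than k. In this form Δ lowers k by
  -- definition, and no coefficients have to be followed through shifts and `T`.
  Nilpotent : ℕ → (ℕ → ℚ) → Set
  Nilpotent zero    f = ∀ s → f s ≡ 0ℚ
  Nilpotent (suc k) f = Nilpotent k (Δ f)

  nilpotent-resp : ∀ k {f g} → (∀ s → f s ≡ g s) → Nilpotent k f → Nilpotent k g
  nilpotent-resp zero    f≡g f° s = ≡.trans (≡.sym (f≡g s)) (f° s)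
  nilpotent-resp (suc k) f≡g f°   = nilpotent-resp k (λ s → ≡.cong₂ ℚ._-_ (f≡g (suc s)) (f≡g s)) f°

  nilpotent-zero : ∀ k {f} → (∀ s → f s ≡ 0ℚ) → Nilpotent k f
  nilpotent-zero zero    f≡0 = f≡0
  nilpotent-zero (suc k) f≡0 = nilpotent-zero k (λ s → ≡.cong₂ ℚ._-_ (f≡0 (suc s)) (f≡0 s))

  nilpotent-+ : ∀ k f g → Nilpotent k f → Nilpotent k g → Nilpotent k (λ s → f s ℚ.+ g s)
  nilpotent-+ zero    f g f° g° s = ≡.cong₂ ℚ._+_ (f° s) (g° s)
  nilpotent-+ (suc k) f g f° g° = nilpotent-resp k
    (λ s → solve 4 (λ a b c d → (a :- b) :+ (c :- d) := (a :+ c) :- (b :+ d))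
         ≡.refl (f (suc s)) (f s) (g (suc s)) (g s))
    (nilpotent-+ k (Δ f) (Δ g) f° g°)

  nilpotent-* : ∀ k b f → Nilpotent k f → Nilpotent k (λ s → b ℚ.* f s)
  nilpotent-* zero    b f f° s = ≡.trans (≡.cong (b ℚ.*_) (f° s)) (ℚ.*-zeroʳ b)
  nilpotent-* (suc k) b f f° = nilpotent-resp k
    (λ s → solve 3 (λ b x y → b :* (x :- y) := b :* x :- b :* y) ≡.refl b (f (suc s)) (f s))
    (nilpotent-* k b (Δ f) f°)

  nilpotent-shift : ∀ k {f} → Nilpotent k f → Nilpotent k (f ∘ suc)
  nilpotent-shift zero    f° = f° ∘ suc
  nilpotent-shift (suc k) f° = nilpotent-shift k f°

  -- For l(s) = α + β s the product rule reads Δ(l f) = l Δf + β f(s + 1), and the first summand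
  -- falls under the induction hypothesis.
  nilpotent-linear : ∀ k f α β → Nilpotent k f → Nilpotent (suc k) (λ s → (α ℚ.+ β ℚ.* (s · 1ℚ)) ℚ.* f s)
  nilpotent-linear zero    f α β f° = nilpotent-zero 1 λ s →
    ≡.trans (≡.cong ((α ℚ.+ β ℚ.* (s · 1ℚ)) ℚ.*_) (f° s)) (ℚ.*-zeroʳ (α ℚ.+ β ℚ.* (s · 1ℚ)))
  nilpotent-linear (suc k) f α β f° = nilpotent-resp (suc k)
    (λ s → ≡.sym (≡.trans (≡.cong (λ x → x ℚ.* f (suc s) ℚ.- (α ℚ.+ β ℚ.* (s · 1ℚ)) ℚ.* f s) (≡.sym (progression-suc α β s)))
      (solve 5 (λ α β s x y → ((α :+ β) :+ β :* s) :* x :- (α :+ β :* s) :* y := (α :+ β :* s) :* (x :- y) :+ β :* x)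
           ≡.refl α β (s · 1ℚ) (f (suc s)) (f s))))
    (nilpotent-+ (suc k) (λ s → (α ℚ.+ β ℚ.* (s · 1ℚ)) ℚ.* Δ f s) (λ s → β ℚ.* f (suc s))
      (nilpotent-linear k (Δ f) α β f°) (nilpotent-* (suc k) β (f ∘ suc) (nilpotent-shift (suc k) {f} f°)))

  poly⇒nilpotent : ∀ {k f} → PolynomialFunction k f → ∀ α β → Nilpotent k (λ s → f (α ℚ.+ β ℚ.* (s · 1ℚ)))
  poly⇒nilpotent (nil f≡0) α β = λ s → f≡0 (α ℚ.+ β ℚ.* (s · 1ℚ))
  poly⇒nilpotent {suc k} (cons {g = g} a g° eq) α β = nilpotent-resp (suc k) (λ s → ≡.sym (eq (X s)))
    (nilpotent-+ (suc k) (λ _ → a) (λ s → X s ℚ.* g (X s)) (nilpotent-zero k λ s → ℚ.+-inverseʳ a)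
      (nilpotent-linear k (g ∘ X) α β (poly⇒nilpotent g° α β)))
    where
    X : ℕ → ℚ
    X s = α ℚ.+ β ℚ.* (s · 1ℚ)

  -- Applying Δ k times to A + B ρ kills A and turns B into (r - 1 + rΔ)ᵏ B, and
  -- r - 1 + rΔ is injective on sequences annihilated by a power of Δ.
  module _ {r : ℚ} (r≢1 : r ℚ.- 1ℚ ≢ 0ℚ) where
    T : (ℕ → ℚ) → ℕ → ℚ
    T f s = r ℚ.* f (suc s) ℚ.- f s

    nilpotent-T : ∀ k {f} → Nilpotent k f → Nilpotent k (T f)
    nilpotent-T k {f} f° = nilpotent-resp k
      (λ s → ≡.cong (r ℚ.* f (suc s) ℚ.+_) (≡.trans (≡.sym (ℚ.neg-distribˡ-* 1ℚ (f s))) (≡.cong ℚ.-_ (ℚ.*-identityˡ (f s)))))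
      (nilpotent-+ k (λ s → r ℚ.* f (suc s)) (λ s → ℚ.- 1ℚ ℚ.* f s)
        (nilpotent-* k r (f ∘ suc) (nilpotent-shift k {f} f°)) (nilpotent-* k (ℚ.- 1ℚ) f f°))

    -- `T` commutes with Δ, so Δf = 0 by induction. Then f s = f (suc s), T f is (r - 1) f, and r ≠
    -- 1.
    T-injective : ∀ k f → Nilpotent k f → (∀ s → T f s ≡ 0ℚ) → ∀ s → f s ≡ 0ℚ
    T-injective zero    f f° _ = f°
    T-injective (suc k) f f° Tf≡0 s = *-cancel r≢1 (begin
      (r ℚ.- 1ℚ) ℚ.* f s          ≡⟨ solve 3 (λ r e x → (r :- e) :* x := r :* x :- e :* x) ≡.refl r 1ℚ (f s) ⟩
      r ℚ.* f s ℚ.- 1ℚ ℚ.* f s    ≡⟨ ≡.cong₂ (λ x y → r ℚ.* x ℚ.- y) fs≡ (ℚ.*-identityˡ (f s)) ⟩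
      T f s                       ≡⟨ Tf≡0 s ⟩
      0ℚ                          ∎)
      where
      Δf≡0 : Δ f s ≡ 0ℚ
      Δf≡0 = T-injective k (Δ f) f° (λ s → begin
        T (Δ f) s          ≡⟨ solve 4 (λ r x y z → r :* (x :- y) :- (y :- z) := (r :* x :- y) :- (r :* y :- z))
             ≡.refl r (f (suc (suc s))) (f (suc s)) (f s) ⟩
        Δ (T f) s          ≡⟨ ≡.cong₂ ℚ._-_ (Tf≡0 (suc s)) (Tf≡0 s) ⟩
        0ℚ                 ∎) s
      fs≡ : f s ≡ f (suc s)
      fs≡ = begin
        f s                       ≡⟨ ℚ.+-identityˡ _ ⟨
        0ℚ ℚ.+ f s                ≡⟨ ≡.cong (ℚ._+ f s) Δf≡0 ⟨
        f (suc s) ℚ.- f s ℚ.+ f s ≡⟨ solve 2 (λ x y → x :- y :+ y := x) ≡.refl (f (suc s)) (f s) ⟩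
        f (suc s)                 ∎

    exponential-independent : ∀ {ρ : ℕ → ℚ} → (∀ s → ρ s ≢ 0ℚ) → (∀ s → ρ (suc s) ≡ r ℚ.* ρ s) →
      ∀ j k A B → Nilpotent j A → Nilpotent k B → (∀ s → A s ℚ.+ ρ s ℚ.* B s ≡ 0ℚ) → ∀ s → B s ≡ 0ℚ
    exponential-independent {ρ} ρ≢0 ρ-suc zero k A B A° B° eq s = *-cancel (ρ≢0 s) (begin
      ρ s ℚ.* B s            ≡⟨ ℚ.+-identityˡ _ ⟨
      0ℚ ℚ.+ ρ s ℚ.* B s     ≡⟨ ≡.cong (ℚ._+ ρ s ℚ.* B s) (A° s) ⟨
      A s ℚ.+ ρ s ℚ.* B s    ≡⟨ eq s ⟩
      0ℚ                     ∎)
    exponential-independent {ρ} ρ≢0 ρ-suc (suc j) k A B A° B° eq =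
      T-injective k B B° (exponential-independent {ρ} ρ≢0 ρ-suc j k (Δ A) (T B) A° (nilpotent-T k {B} B°) λ s → begin
        Δ A s ℚ.+ ρ s ℚ.* T B s
          ≡⟨ solve 6 (λ a b ρ r x y → (a :- b) :+ ρ :* (r :* x :- y) := (a :+ (r :* ρ) :* x) :- (b :+ ρ :* y))
               ≡.refl (A (suc s)) (A s) (ρ s) r (B (suc s)) (B s) ⟩
        (A (suc s) ℚ.+ (r ℚ.* ρ s) ℚ.* B (suc s)) ℚ.- (A s ℚ.+ ρ s ℚ.* B s)
          ≡⟨ ≡.cong (λ x → (A (suc s) ℚ.+ x ℚ.* B (suc s)) ℚ.- (A s ℚ.+ ρ s ℚ.* B s)) (ρ-suc s) ⟨
        (A (suc s) ℚ.+ ρ (suc s) ℚ.* B (suc s)) ℚ.- (A s ℚ.+ ρ s ℚ.* B s)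
          ≡⟨ ≡.cong₂ ℚ._-_ (eq (suc s)) (eq s) ⟩
        0ℚ ∎)

-- Fixed point counts of x^m satisfy no polynomial recurrence

module NoRecurrence {p : ℕ} (prime : Prime p) {m : ℕ} (2≤m : 2 ≤ m) (p∤m : p ∤ m) where
  open Valuation p prime
  open RationalSeries
  open PolynomialFunctions
  open CommutativeRing ℚ.+-*-commutativeRing using (semiring)
  open SemiringMult semiring using (×-homo-+; ×1-homo-*) renaming (_×_ to _·_)
  open SemiringExp semiring using (_^_)
  open SemiringSum semiring using (sum; sum-cong-≋; *-distribˡ-sum; *-distribʳ-sum; ∑-comm; ∑-distrib-+; sum-remove)
  open DifferenceSolver ℚ.+-*-commutativeRing
  open ≡.≡-Reasoning

  ⌜_⌝ : ℕ → ℚ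
  ⌜ n ⌝ = n · 1ℚ

  ⌜∸⌝ : ∀ {k n} → k ≤ n → ⌜ n ℕ.∸ k ⌝ ≡ ⌜ n ⌝ ℚ.- ⌜ k ⌝
  ⌜∸⌝ {k} {n} k≤n = begin
    ⌜ n ℕ.∸ k ⌝                        ≡⟨ solve 2 (λ x y → x := (x :+ y) :- y) ≡.refl ⌜ n ℕ.∸ k ⌝ ⌜ k ⌝ ⟩
    (⌜ n ℕ.∸ k ⌝ ℚ.+ ⌜ k ⌝) ℚ.- ⌜ k ⌝  ≡⟨ ≡.cong (ℚ._- ⌜ k ⌝) (×-homo-+ 1ℚ (n ℕ.∸ k) k) ⟨
    ⌜ n ℕ.∸ k ℕ.+ k ⌝ ℚ.- ⌜ k ⌝        ≡⟨ ≡.cong (λ x → ⌜ x ⌝ ℚ.- ⌜ k ⌝) (ℕ.m∸n+n≡m k≤n) ⟩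
    ⌜ n ⌝ ℚ.- ⌜ k ⌝                    ∎

  ⌜⌝≢0 : ∀ n .{{_ : ℕ.NonZero n}} → ⌜ n ⌝ ≢ 0ℚ
  ⌜⌝≢0 (suc n) = suc·1≢0 n

  ⌜⌝-injective-< : ∀ {k n} → k ℕ.< n → ⌜ k ⌝ ≢ ⌜ n ⌝
  ⌜⌝-injective-< {k} {n} k<n ⌜k⌝≡⌜n⌝ = ⌜⌝≢0 (n ℕ.∸ k) {{ℕ.>-nonZero (ℕ.m<n⇒0<n∸m k<n)}} (begin
    ⌜ n ℕ.∸ k ⌝      ≡⟨ ⌜∸⌝ (ℕ.<⇒≤ k<n) ⟩
    ⌜ n ⌝ ℚ.- ⌜ k ⌝  ≡⟨ ≡.cong (λ x → ⌜ n ⌝ ℚ.- x) ⌜k⌝≡⌜n⌝ ⟩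
    ⌜ n ⌝ ℚ.- ⌜ n ⌝  ≡⟨ ℚ.+-inverseʳ ⌜ n ⌝ ⟩
    0ℚ               ∎)

  ⌜p^⌝≢0 : ∀ v → ⌜ p ℕ.^ v ⌝ ≢ 0ℚ
  ⌜p^⌝≢0 v = ⌜⌝≢0 (p ℕ.^ v) {{ℕ.m^n≢0 p v {{prime⇒nonZero prime}}}}

  abstract
    -- The weight p^(-v). With v = val x the count 1 + (m^x - 1) p^(-v) is affine in m^x with slope
    -- w v, and distinct v give distinct slopes.
    w : ℕ → ℚ
    w v = (ℚ.1/ ⌜ p ℕ.^ v ⌝) {{ℚ.≢-nonZero (⌜p^⌝≢0 v)}}

    w* : ∀ v → w v ℚ.* ⌜ p ℕ.^ v ⌝ ≡ 1ℚ
    w* v = ℚ.*-inverseˡ ⌜ p ℕ.^ v ⌝ {{ℚ.≢-nonZero (⌜p^⌝≢0 v)}}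

  w-injective-< : ∀ {v v′} → v ℕ.< v′ → w v ≢ w v′
  w-injective-< {v} {v′} v<v′ wv≡wv′ = ⌜⌝-injective-<
    (ℕ.^-monoʳ-< p (ℕ.nonTrivial⇒n>1 p {{prime⇒nonTrivial prime}}) v<v′) (begin
    ⌜ p ℕ.^ v ⌝                                ≡⟨ ℚ.*-identityˡ _ ⟨
    1ℚ ℚ.* ⌜ p ℕ.^ v ⌝                         ≡⟨ ≡.cong (ℚ._* ⌜ p ℕ.^ v ⌝) (w* v′) ⟨
    w v′ ℚ.* ⌜ p ℕ.^ v′ ⌝ ℚ.* ⌜ p ℕ.^ v ⌝      ≡⟨ ≡.cong (λ x → x ℚ.* ⌜ p ℕ.^ v′ ⌝ ℚ.* ⌜ p ℕ.^ v ⌝) wv≡wv′ ⟨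
    w v ℚ.* ⌜ p ℕ.^ v′ ⌝ ℚ.* ⌜ p ℕ.^ v ⌝
      ≡⟨ solve 3 (λ a b c → a :* b :* c := a :* c :* b) ≡.refl (w v) ⌜ p ℕ.^ v′ ⌝ ⌜ p ℕ.^ v ⌝ ⟩
    w v ℚ.* ⌜ p ℕ.^ v ⌝ ℚ.* ⌜ p ℕ.^ v′ ⌝       ≡⟨ ≡.cong (ℚ._* ⌜ p ℕ.^ v′ ⌝) (w* v) ⟩
    1ℚ ℚ.* ⌜ p ℕ.^ v′ ⌝                        ≡⟨ ℚ.*-identityˡ _ ⟩
    ⌜ p ℕ.^ v′ ⌝                               ∎)

  w-injective : ∀ {v v′} → v ≢ v′ → w v ≢ w v′
  w-injective {v} {v′} v≢v′ with ℕ.<-cmp v v′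
  ... | tri< v<v′ _ _ = w-injective-< v<v′
  ... | tri≈ _ v≡v′ _ = contradiction v≡v′ v≢v′
  ... | tri> _ _ v′<v = w-injective-< v′<v ∘ ≡.sym

  1+⌜unit⌝ : ∀ x → 1ℚ ℚ.+ ⌜ unit 2≤m p∤m x ⌝ ≡
             (1ℚ ℚ.- w (val 2≤m p∤m x)) ℚ.+ w (val 2≤m p∤m x) ℚ.* ⌜ m ℕ.^ x ⌝
  1+⌜unit⌝ x = begin
    1ℚ ℚ.+ ⌜ u ⌝                                ≡⟨ ≡.cong (1ℚ ℚ.+_) (ℚ.*-identityˡ ⌜ u ⌝) ⟨
    1ℚ ℚ.+ 1ℚ ℚ.* ⌜ u ⌝                         ≡⟨ ≡.cong (λ y → 1ℚ ℚ.+ y ℚ.* ⌜ u ⌝) (w* v) ⟨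
    1ℚ ℚ.+ w v ℚ.* ⌜ p ℕ.^ v ⌝ ℚ.* ⌜ u ⌝
      ≡⟨ solve 4 (λ e w a u → e :+ w :* a :* u := (e :- w :* e) :+ w :* (e :+ a :* u))
           ≡.refl 1ℚ (w v) ⌜ p ℕ.^ v ⌝ ⌜ u ⌝ ⟩
    (1ℚ ℚ.- w v ℚ.* 1ℚ) ℚ.+ w v ℚ.* (1ℚ ℚ.+ ⌜ p ℕ.^ v ⌝ ℚ.* ⌜ u ⌝)
      ≡⟨ ≡.cong₂ (λ y z → (1ℚ ℚ.- y) ℚ.+ w v ℚ.* (1ℚ ℚ.+ z)) (ℚ.*-identityʳ (w v)) (≡.sym (×1-homo-* (p ℕ.^ v) u)) ⟩
    (1ℚ ℚ.- w v) ℚ.+ w v ℚ.* ⌜ suc (p ℕ.^ v ℕ.* u) ⌝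
      ≡⟨ ≡.cong (λ k → (1ℚ ℚ.- w v) ℚ.+ w v ℚ.* ⌜ k ⌝) (≡.trans (≡.cong suc (≡.sym (M≡p^val*unit 2≤m p∤m x))) (suc-M 2≤m p∤m x)) ⟩
    (1ℚ ℚ.- w v) ℚ.+ w v ℚ.* ⌜ m ℕ.^ x ⌝ ∎
    where
    v = val 2≤m p∤m x
    u = unit 2≤m p∤m x

  θ-power : ∀ F i x → fold F θ i x ≡ ⌜ x ⌝ ^ i ℚ.* F x
  θ-power F zero    x = ≡.sym (ℚ.*-identityˡ (F x))
  θ-power F (suc i) x = begin
    x · fold F θ i x                  ≡⟨ ·≡·1* x _ ⟩
    ⌜ x ⌝ ℚ.* fold F θ i x            ≡⟨ ≡.cong (⌜ x ⌝ ℚ.*_) (θ-power F i x) ⟩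
    ⌜ x ⌝ ℚ.* (⌜ x ⌝ ^ i ℚ.* F x)     ≡⟨ ℚ.*-assoc ⌜ x ⌝ (⌜ x ⌝ ^ i) (F x) ⟨
    ⌜ x ⌝ ^ suc i ℚ.* F x             ∎

  sum-pointwise : ∀ {n} (f : Fin n → PowerSeries) k →
    SemiringSum.sum (DifferentialDomain.semiring ℚ⟦t⟧) f k ≡ sum (λ i → f i k)
  sum-pointwise {zero}  f k = ≡.refl
  sum-pointwise {suc n} f k = ≡.cong (f zero k ℚ.+_) (sum-pointwise (f ∘ suc) k)

  common-bound : ∀ {n} (c : Fin n → PowerSeries) → (∀ i → Finite (c i)) → ∃[ J ] (∀ i k → J ≤ k → c i k ≡ 0ℚ)
  common-bound {zero}  c Fc = 0 , λ ()
  common-bound {suc n} c Fc with Fc zero | common-bound (c ∘ suc) (Fc ∘ suc)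
  ... | J , c₀≡0 | J′ , c≡0 = J ℕ.⊔ J′ , λ
    { zero    k J⊔J′≤k → c₀≡0 k (ℕ.m⊔n≤o⇒m≤o J J′ J⊔J′≤k)
    ; (suc i) k J⊔J′≤k → c≡0 i k (ℕ.m⊔n≤o⇒n≤o J J′ J⊔J′≤k)
    }

  module _ {F : PowerSeries} (F≡ : ∀ x → F (suc x) ≡ 1ℚ ℚ.+ ⌜ unit 2≤m p∤m (suc x) ⌝)
           {n : ℕ} (c : Fin n → PowerSeries) where

    -- F satisfies the recurrence Σ_k Q k (x - k) F (x - k) = 0.
    Q : ℕ → ℚ → ℚ
    Q k X = sum λ i → c i k ℚ.* X ^ toℕ i

    Q-poly : ∀ k → PolynomialFunction n (Q k)
    Q-poly k = poly-coefficients (λ i → c i k)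

    -- The coefficient of t^x in Σ cᵢ θⁱF. As θ multiplies the coefficient at y by y, exchanging the
    -- sums over i and k collects the powers of x - k into Q k.
    recurrence : SemiringSum.sum (DifferentialDomain.semiring ℚ⟦t⟧) (λ i → c i ⊠ fold F θ (toℕ i)) ≋ 𝟘 →
      ∀ x → sum {suc x} (λ k → Q (toℕ k) ⌜ x ℕ.∸ toℕ k ⌝ ℚ.* F (x ℕ.∸ toℕ k)) ≡ 0ℚ
    recurrence Σ≋0 x = begin
      sum {suc x} (λ k → Q (toℕ k) ⌜ x ℕ.∸ toℕ k ⌝ ℚ.* F (x ℕ.∸ toℕ k))
        ≡⟨ sum-cong-≋ {suc x} (λ k → ≡.trans
             (*-distribʳ-sum (F (x ℕ.∸ toℕ k)) (λ i → c i (toℕ k) ℚ.* ⌜ x ℕ.∸ toℕ k ⌝ ^ toℕ i))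
             (sum-cong-≋ {n} λ i → ≡.trans (ℚ.*-assoc (c i (toℕ k)) (⌜ x ℕ.∸ toℕ k ⌝ ^ toℕ i) (F (x ℕ.∸ toℕ k)))
                                           (≡.cong (c i (toℕ k) ℚ.*_) (≡.sym (θ-power F (toℕ i) (x ℕ.∸ toℕ k)))))) ⟩
      sum {suc x} (λ k → sum {n} λ i → c i (toℕ k) ℚ.* fold F θ (toℕ i) (x ℕ.∸ toℕ k))
        ≡⟨ ∑-comm {suc x} {n} (λ k i → c i (toℕ k) ℚ.* fold F θ (toℕ i) (x ℕ.∸ toℕ k)) ⟩
      sum {n} (λ i → (c i ⊠ fold F θ (toℕ i)) x)
        ≡⟨ sum-pointwise (λ i → c i ⊠ fold F θ (toℕ i)) x ⟨
      SemiringSum.sum (DifferentialDomain.semiring ℚ⟦t⟧) (λ i → c i ⊠ fold F θ (toℕ i)) x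
        ≡⟨ Σ≋0 x ⟩
      0ℚ ∎

    module _ {J : ℕ} (c≡0 : ∀ i k → J ≤ k → c i k ≡ 0ℚ) (j₀ : ℕ) (j₀<J : j₀ ℕ.< J)
             (Σ≋0 : SemiringSum.sum (DifferentialDomain.semiring ℚ⟦t⟧) (λ i → c i ⊠ fold F θ (toℕ i)) ≋ 𝟘) where

      Q≡0 : ∀ k X → J ≤ k → Q k X ≡ 0ℚ
      Q≡0 k X J≤k = sum-≈0 (λ i → c i k ℚ.* X ^ toℕ i) λ i →
        ≡.trans (≡.cong (ℚ._* X ^ toℕ i) (c≡0 i k J≤k)) (ℚ.*-zeroˡ (X ^ toℕ i))

      -- The number of terms becomes independent of x, as is required to read the recurrence along a
      -- progression.
      short-recurrence : ∀ x → J ≤ x → sum {J} (λ k → Q (toℕ k) ⌜ x ℕ.∸ toℕ k ⌝ ℚ.* F (x ℕ.∸ toℕ k)) ≡ 0ℚ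
      short-recurrence x J≤x = ≡.trans
        (≡.sym (sum-truncate (λ k → Q k ⌜ x ℕ.∸ k ⌝ ℚ.* F (x ℕ.∸ k)) (ℕ.m≤n⇒m≤1+n J≤x)
          λ k J≤k → ≡.trans (≡.cong (ℚ._* F (x ℕ.∸ k)) (Q≡0 k ⌜ x ℕ.∸ k ⌝ J≤k)) (ℚ.*-zeroˡ (F (x ℕ.∸ k)))))
        (recurrence Σ≋0 x)

      -- δ k is the offset j₀ - k of an argument from N. The exponent j₀ - k of m may be negative;
      -- as k < J, the factor m^J makes it the natural number in `C`.
      δ C : ℕ → ℚ
      δ k = ⌜ j₀ ⌝ ℚ.- ⌜ k ⌝
      C k = ⌜ m ℕ.^ (J ℕ.+ j₀ ℕ.∸ k) ⌝

      -- The exponent of p in m ^ (N + j₀ - k) - 1 for N in a progression with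
      -- exponent κ
      v : ℕ → ℕ → ℕ
      v κ k with ℕ.<-cmp k j₀
      ... | tri< _ _ _ = val 2≤m p∤m (j₀ ℕ.∸ k)
      ... | tri≈ _ _ _ = κ
      ... | tri> _ _ _ = val 2≤m p∤m (k ℕ.∸ j₀)

      v-j₀ : ∀ κ → v κ j₀ ≡ κ
      v-j₀ κ with ℕ.<-cmp j₀ j₀
      ... | tri< j₀<j₀ _ _ = contradiction j₀<j₀ (ℕ.n≮n j₀)
      ... | tri≈ _ _ _     = ≡.refl
      ... | tri> _ _ j₀<j₀ = contradiction j₀<j₀ (ℕ.n≮n j₀)

      v-≢j₀ : ∀ κ κ′ {k} → k ≢ j₀ → v κ k ≡ v κ′ k
      v-≢j₀ κ κ′ {k} k≢j₀ with ℕ.<-cmp k j₀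
      ... | tri< _ _ _    = ≡.refl
      ... | tri≈ _ k≡j₀ _ = contradiction k≡j₀ k≢j₀
      ... | tri> _ _ _    = ≡.refl

      -- By 1+⌜unit⌝ the recurrence at x = N + j₀, multiplied by m ^ J, becomes
      -- m ^ J 𝒜(N) + m ^ N ℬ(N) = 0 on a progression with exponent κ.
      𝒜 ℬ : ℕ → ℚ → ℚ
      𝒜 κ X = sum {J} λ k → (1ℚ ℚ.- w (v κ (toℕ k))) ℚ.* Q (toℕ k) (X ℚ.+ δ (toℕ k))
      ℬ κ X = sum {J} λ k → (w (v κ (toℕ k)) ℚ.* C (toℕ k)) ℚ.* Q (toℕ k) (X ℚ.+ δ (toℕ k))

      𝒜-poly : ∀ κ → PolynomialFunction n (𝒜 κ)
      𝒜-poly κ = poly-sum {n = J} _ λ k → poly-* (1ℚ ℚ.- w (v κ (toℕ k))) (poly-translate (δ (toℕ k)) (Q-poly (toℕ k)))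

      ℬ-poly : ∀ κ → PolynomialFunction n (ℬ κ)
      ℬ-poly κ = poly-sum {n = J} _ λ k → poly-* (w (v κ (toℕ k)) ℚ.* C (toℕ k)) (poly-translate (δ (toℕ k)) (Q-poly (toℕ k)))

      module _ (P : Progression 2≤m p∤m J) where
        open Progression P renaming (exponent to κ)

        J<term : ∀ s → J ℕ.< term s
        J<term s = ℕ.<-≤-trans J<start (ℕ.m≤m+n start _)

        val-v : ∀ s k → k ℕ.< J → val 2≤m p∤m (term s ℕ.+ j₀ ℕ.∸ k) ≡ v κ k
        val-v s k k<J with ℕ.<-cmp k j₀
        ... | tri< k<j₀ _ _ = ≡.trans
          (≡.cong (val 2≤m p∤m) (≡.trans (ℕ.+-∸-assoc (term s) (ℕ.<⇒≤ k<j₀)) (ℕ.+-comm (term s) _)))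
          (val-+ s (ℕ.m<n⇒0<n∸m k<j₀) (ℕ.≤-trans (ℕ.m∸n≤m j₀ k) (ℕ.<⇒≤ j₀<J)))
        ... | tri≈ _ ≡.refl _ = ≡.trans (≡.cong (val 2≤m p∤m) (ℕ.m+n∸n≡m (term s) k)) (val-term s)
        ... | tri> _ _ j₀<k = ≡.trans
          (≡.cong (val 2≤m p∤m) (≡.trans (≡.cong₂ ℕ._∸_ (ℕ.+-comm (term s) j₀) (≡.sym (ℕ.m+[n∸m]≡n (ℕ.<⇒≤ j₀<k))))
            (ℕ.[m+n]∸[m+o]≡n∸o j₀ (term s) (k ℕ.∸ j₀))))
          (val-∸ s (ℕ.m<n⇒0<n∸m j₀<k) (ℕ.≤-trans (ℕ.m∸n≤m k j₀) (ℕ.<⇒≤ k<J)))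

        F-term : ∀ s k → k ℕ.< J → ⌜ m ℕ.^ J ⌝ ℚ.* F (term s ℕ.+ j₀ ℕ.∸ k) ≡
          ⌜ m ℕ.^ J ⌝ ℚ.* (1ℚ ℚ.- w (v κ k)) ℚ.+ ⌜ m ℕ.^ term s ⌝ ℚ.* (w (v κ k) ℚ.* C k)
        F-term s k k<J = begin
          ⌜ m ℕ.^ J ⌝ ℚ.* F x
            ≡⟨ ≡.cong (⌜ m ℕ.^ J ⌝ ℚ.*_) F-x ⟩
          ⌜ m ℕ.^ J ⌝ ℚ.* ((1ℚ ℚ.- W) ℚ.+ W ℚ.* ⌜ m ℕ.^ x ⌝)
            ≡⟨ solve 4 (λ a b W d → a :* (b :+ W :* d) := a :* b :+ (a :* d) :* W)
                 ≡.refl ⌜ m ℕ.^ J ⌝ (1ℚ ℚ.- W) W ⌜ m ℕ.^ x ⌝ ⟩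
          ⌜ m ℕ.^ J ⌝ ℚ.* (1ℚ ℚ.- W) ℚ.+ (⌜ m ℕ.^ J ⌝ ℚ.* ⌜ m ℕ.^ x ⌝) ℚ.* W
            ≡⟨ ≡.cong (λ y → ⌜ m ℕ.^ J ⌝ ℚ.* (1ℚ ℚ.- W) ℚ.+ y ℚ.* W) powers ⟩
          ⌜ m ℕ.^ J ⌝ ℚ.* (1ℚ ℚ.- W) ℚ.+ (⌜ m ℕ.^ term s ⌝ ℚ.* C k) ℚ.* W
            ≡⟨ solve 4 (λ a d e W → a :+ (d :* e) :* W := a :+ d :* (W :* e))
                 ≡.refl (⌜ m ℕ.^ J ⌝ ℚ.* (1ℚ ℚ.- W)) ⌜ m ℕ.^ term s ⌝ (C k) W ⟩
          ⌜ m ℕ.^ J ⌝ ℚ.* (1ℚ ℚ.- W) ℚ.+ ⌜ m ℕ.^ term s ⌝ ℚ.* (W ℚ.* C k) ∎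
          where
          x = term s ℕ.+ j₀ ℕ.∸ k
          W = w (v κ k)

          -- F is described by `unit` at positive arguments only; k < J < N excludes the argument 0.
          0<x : 0 ℕ.< x
          0<x = ℕ.m<n⇒0<n∸m (ℕ.<-trans k<J (ℕ.<-≤-trans (J<term s) (ℕ.m≤m+n (term s) j₀)))

          F-pos : ∀ y → 0 ℕ.< y → F y ≡ 1ℚ ℚ.+ ⌜ unit 2≤m p∤m y ⌝
          F-pos (suc y) _ = F≡ y

          F-x : F x ≡ (1ℚ ℚ.- W) ℚ.+ W ℚ.* ⌜ m ℕ.^ x ⌝
          F-x = begin
            F x                                                ≡⟨ F-pos x 0<x ⟩
            1ℚ ℚ.+ ⌜ unit 2≤m p∤m x ⌝                          ≡⟨ 1+⌜unit⌝ x ⟩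
            (1ℚ ℚ.- w (val 2≤m p∤m x)) ℚ.+ w (val 2≤m p∤m x) ℚ.* ⌜ m ℕ.^ x ⌝
              ≡⟨ ≡.cong (λ u → (1ℚ ℚ.- w u) ℚ.+ w u ℚ.* ⌜ m ℕ.^ x ⌝) (val-v s k k<J) ⟩
            (1ℚ ℚ.- W) ℚ.+ W ℚ.* ⌜ m ℕ.^ x ⌝                   ∎

          exponents : J ℕ.+ x ≡ term s ℕ.+ (J ℕ.+ j₀ ℕ.∸ k)
          exponents = begin
            J ℕ.+ (term s ℕ.+ j₀ ℕ.∸ k)     ≡⟨ ℕ.+-∸-assoc J (ℕ.≤-trans (ℕ.<⇒≤ (ℕ.<-trans k<J (J<term s))) (ℕ.m≤m+n (term s) j₀)) ⟨
            J ℕ.+ (term s ℕ.+ j₀) ℕ.∸ k     ≡⟨ ≡.cong (ℕ._∸ k) (CommutativeSemigroupProperties.x∙yz≈y∙xz ℕ.+-commutativeSemigroup J (term s) j₀) ⟩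
            term s ℕ.+ (J ℕ.+ j₀) ℕ.∸ k     ≡⟨ ℕ.+-∸-assoc (term s) (ℕ.≤-trans (ℕ.<⇒≤ k<J) (ℕ.m≤m+n J j₀)) ⟩
            term s ℕ.+ (J ℕ.+ j₀ ℕ.∸ k)     ∎

          powers : ⌜ m ℕ.^ J ⌝ ℚ.* ⌜ m ℕ.^ x ⌝ ≡ ⌜ m ℕ.^ term s ⌝ ℚ.* C k
          powers = begin
            ⌜ m ℕ.^ J ⌝ ℚ.* ⌜ m ℕ.^ x ⌝      ≡⟨ ×1-homo-* (m ℕ.^ J) (m ℕ.^ x) ⟨
            ⌜ m ℕ.^ J ℕ.* m ℕ.^ x ⌝          ≡⟨ ≡.cong ⌜_⌝ (ℕ.^-distribˡ-+-* m J x) ⟨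
            ⌜ m ℕ.^ (J ℕ.+ x) ⌝              ≡⟨ ≡.cong (λ e → ⌜ m ℕ.^ e ⌝) exponents ⟩
            ⌜ m ℕ.^ (term s ℕ.+ (J ℕ.+ j₀ ℕ.∸ k)) ⌝ ≡⟨ ≡.cong ⌜_⌝ (ℕ.^-distribˡ-+-* m (term s) (J ℕ.+ j₀ ℕ.∸ k)) ⟩
            ⌜ m ℕ.^ term s ℕ.* m ℕ.^ (J ℕ.+ j₀ ℕ.∸ k) ⌝ ≡⟨ ×1-homo-* (m ℕ.^ term s) _ ⟩
            ⌜ m ℕ.^ term s ⌝ ℚ.* C k         ∎

        split-recurrence : ∀ s → ⌜ m ℕ.^ J ⌝ ℚ.* 𝒜 κ ⌜ term s ⌝ ℚ.+ ⌜ m ℕ.^ term s ⌝ ℚ.* ℬ κ ⌜ term s ⌝ ≡ 0ℚ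
        split-recurrence s = begin
          mᴶ ℚ.* 𝒜 κ N ℚ.+ mᴺ ℚ.* ℬ κ N
            ≡⟨ ≡.cong₂ ℚ._+_ (*-distribˡ-sum {J} mᴶ _) (*-distribˡ-sum {J} mᴺ _) ⟩
          sum {J} (λ k → mᴶ ℚ.* ((1ℚ ℚ.- W k) ℚ.* q k)) ℚ.+ sum {J} (λ k → mᴺ ℚ.* ((W k ℚ.* C (toℕ k)) ℚ.* q k))
            ≡⟨ ∑-distrib-+ {J} _ _ ⟨
          sum {J} (λ k → mᴶ ℚ.* ((1ℚ ℚ.- W k) ℚ.* q k) ℚ.+ mᴺ ℚ.* ((W k ℚ.* C (toℕ k)) ℚ.* q k))
            ≡⟨ sum-cong-≋ {J} (λ k → begin
                 mᴶ ℚ.* ((1ℚ ℚ.- W k) ℚ.* q k) ℚ.+ mᴺ ℚ.* ((W k ℚ.* C (toℕ k)) ℚ.* q k)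
                   ≡⟨ solve 5 (λ a b d e q → a :* (b :* q) :+ d :* (e :* q) := (a :* b :+ d :* e) :* q)
                        ≡.refl mᴶ (1ℚ ℚ.- W k) mᴺ (W k ℚ.* C (toℕ k)) (q k) ⟩
                 (mᴶ ℚ.* (1ℚ ℚ.- W k) ℚ.+ mᴺ ℚ.* (W k ℚ.* C (toℕ k))) ℚ.* q k
                   ≡⟨ ≡.cong₂ ℚ._*_ (F-term s (toℕ k) (Fin.toℕ<n k)) (≡.cong (Q (toℕ k)) (point k)) ⟨
                 (mᴶ ℚ.* F (x k)) ℚ.* Q (toℕ k) ⌜ x k ⌝
                   ≡⟨ solve 3 (λ a f q → (a :* f) :* q := a :* (q :* f)) ≡.refl mᴶ (F (x k)) (Q (toℕ k) ⌜ x k ⌝) ⟩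
                 mᴶ ℚ.* (Q (toℕ k) ⌜ x k ⌝ ℚ.* F (x k)) ∎) ⟩
          sum {J} (λ k → mᴶ ℚ.* (Q (toℕ k) ⌜ x k ⌝ ℚ.* F (x k)))
            ≡⟨ *-distribˡ-sum {J} mᴶ _ ⟨
          mᴶ ℚ.* sum {J} (λ k → Q (toℕ k) ⌜ x k ⌝ ℚ.* F (x k))
            ≡⟨ ≡.cong (mᴶ ℚ.*_) (short-recurrence (term s ℕ.+ j₀) (ℕ.≤-trans (ℕ.<⇒≤ (J<term s)) (ℕ.m≤m+n (term s) j₀))) ⟩
          mᴶ ℚ.* 0ℚ ≡⟨ ℚ.*-zeroʳ mᴶ ⟩
          0ℚ ∎
          where
          mᴶ = ⌜ m ℕ.^ J ⌝
          mᴺ = ⌜ m ℕ.^ term s ⌝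
          N  = ⌜ term s ⌝
          W q : Fin J → ℚ
          W k = w (v κ (toℕ k))
          q k = Q (toℕ k) (N ℚ.+ δ (toℕ k))
          x : Fin J → ℕ
          x k = term s ℕ.+ j₀ ℕ.∸ toℕ k
          point : ∀ k → ⌜ x k ⌝ ≡ N ℚ.+ δ (toℕ k)
          point k = begin
            ⌜ x k ⌝                                 ≡⟨ ⌜∸⌝ (ℕ.≤-trans (ℕ.<⇒≤ (ℕ.<-trans (Fin.toℕ<n k) (J<term s))) (ℕ.m≤m+n (term s) j₀)) ⟩
            ⌜ term s ℕ.+ j₀ ⌝ ℚ.- ⌜ toℕ k ⌝         ≡⟨ ≡.cong (ℚ._- ⌜ toℕ k ⌝) (×-homo-+ 1ℚ (term s) j₀) ⟩
            (N ℚ.+ ⌜ j₀ ⌝) ℚ.- ⌜ toℕ k ⌝            ≡⟨ ℚ.+-assoc N ⌜ j₀ ⌝ (ℚ.- ⌜ toℕ k ⌝) ⟩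
            N ℚ.+ δ (toℕ k)                         ∎

        -- The terms are N = start + L s with L = p start, so m^N is geometric in s with ratio r =
        -- m^L ≠ 1. `exponential-independent` makes `ℬ` vanish at these N, and `vanishing` extends
        -- this to all X.
        ℬ≡0 : ∀ X → ℬ κ X ≡ 0ℚ
        ℬ≡0 = vanishing (ℬ-poly κ) ⌜ start ⌝ (⌜⌝≢0 L {{L≢0}}) λ s →
          exponential-independent {r} r≢1 {ρ} ρ≢0 ρ-suc n n _ _
            (nilpotent-* n ⌜ m ℕ.^ J ⌝ _ (poly⇒nilpotent (𝒜-poly κ) ⌜ start ⌝ ⌜ L ⌝))
            (poly⇒nilpotent (ℬ-poly κ) ⌜ start ⌝ ⌜ L ⌝)
            (λ s → ≡.subst (λ X → ⌜ m ℕ.^ J ⌝ ℚ.* 𝒜 κ X ℚ.+ ρ s ℚ.* ℬ κ X ≡ 0ℚ) (⌜term⌝ s) (split-recurrence s)) s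
          where
          L = p ℕ.* start

          L≢0 : ℕ.NonZero L
          L≢0 = ℕ.m*n≢0 p start {{prime⇒nonZero prime}} {{ℕ.>-nonZero (ℕ.≤-<-trans z≤n J<start)}}

          r : ℚ
          r = ⌜ m ℕ.^ L ⌝

          r≢1 : r ℚ.- 1ℚ ≢ 0ℚ
          r≢1 r-1≡0 = ⌜⌝≢0 (M 2≤m p∤m L) {{ℕ.>-nonZero (M>0 2≤m p∤m (ℕ.>-nonZero⁻¹ L {{L≢0}}))}} (begin
            ⌜ M 2≤m p∤m L ⌝                     ≡⟨ solve 2 (λ a e → a := (e :+ a) :- e) ≡.refl ⌜ M 2≤m p∤m L ⌝ 1ℚ ⟩
            ⌜ suc (M 2≤m p∤m L) ⌝ ℚ.- 1ℚ        ≡⟨ ≡.cong (λ k → ⌜ k ⌝ ℚ.- 1ℚ) (suc-M 2≤m p∤m L) ⟩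
            r ℚ.- 1ℚ                            ≡⟨ r-1≡0 ⟩
            0ℚ                                  ∎)

          ρ : ℕ → ℚ
          ρ s = ⌜ m ℕ.^ term s ⌝

          ρ≢0 : ∀ s → ρ s ≢ 0ℚ
          ρ≢0 s = ⌜⌝≢0 (m ℕ.^ term s) {{ℕ.m^n≢0 m (term s) {{ℕ.>-nonZero (ℕ.<-trans (s≤s z≤n) 2≤m)}}}}

          term≡ : ∀ s → term s ≡ start ℕ.+ L ℕ.* s
          term≡ s = ≡.cong (start ℕ.+_) (begin
            p ℕ.* s ℕ.* start     ≡⟨ ℕ.*-assoc p s start ⟩
            p ℕ.* (s ℕ.* start)   ≡⟨ ≡.cong (p ℕ.*_) (ℕ.*-comm s start) ⟩
            p ℕ.* (start ℕ.* s)   ≡⟨ ℕ.*-assoc p start s ⟨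
            L ℕ.* s               ∎)

          term-suc : ∀ s → term (suc s) ≡ L ℕ.+ term s
          term-suc s = begin
            term (suc s)                  ≡⟨ term≡ (suc s) ⟩
            start ℕ.+ L ℕ.* suc s         ≡⟨ ≡.cong (start ℕ.+_) (ℕ.*-suc L s) ⟩
            start ℕ.+ (L ℕ.+ L ℕ.* s)     ≡⟨ CommutativeSemigroupProperties.x∙yz≈y∙xz ℕ.+-commutativeSemigroup start L (L ℕ.* s) ⟩
            L ℕ.+ (start ℕ.+ L ℕ.* s)     ≡⟨ ≡.cong (L ℕ.+_) (term≡ s) ⟨
            L ℕ.+ term s                  ∎

          ρ-suc : ∀ s → ρ (suc s) ≡ r ℚ.* ρ s
          ρ-suc s = begin
            ⌜ m ℕ.^ term (suc s) ⌝          ≡⟨ ≡.cong (λ e → ⌜ m ℕ.^ e ⌝) (term-suc s) ⟩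
            ⌜ m ℕ.^ (L ℕ.+ term s) ⌝        ≡⟨ ≡.cong ⌜_⌝ (ℕ.^-distribˡ-+-* m L (term s)) ⟩
            ⌜ m ℕ.^ L ℕ.* m ℕ.^ term s ⌝    ≡⟨ ×1-homo-* (m ℕ.^ L) (m ℕ.^ term s) ⟩
            r ℚ.* ρ s                       ∎

          ⌜term⌝ : ∀ s → ⌜ term s ⌝ ≡ ⌜ start ⌝ ℚ.+ ⌜ L ⌝ ℚ.* ⌜ s ⌝
          ⌜term⌝ s = begin
            ⌜ term s ⌝                       ≡⟨ ≡.cong ⌜_⌝ (term≡ s) ⟩
            ⌜ start ℕ.+ L ℕ.* s ⌝            ≡⟨ ×-homo-+ 1ℚ start (L ℕ.* s) ⟩
            ⌜ start ⌝ ℚ.+ ⌜ L ℕ.* s ⌝        ≡⟨ ≡.cong (⌜ start ⌝ ℚ.+_) (×1-homo-* L s) ⟩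
            ⌜ start ⌝ ℚ.+ ⌜ L ⌝ ℚ.* ⌜ s ⌝    ∎

      sum-cancel : ∀ {N} (i : Fin N) (f g : Fin N → ℚ) → (∀ k → k ≢ i → f k ≡ g k) → sum f ≡ sum g → f i ≡ g i
      sum-cancel {suc N} i f g f≡g Σf≡Σg = RingProperties.+-cancelʳ ℚ.+-*-ring (sum (λ k → g (punchIn i k))) (f i) (g i) (begin
        f i ℚ.+ sum (λ k → g (punchIn i k))  ≡⟨ ≡.cong (f i ℚ.+_) (sum-cong-≋ {N} λ k → f≡g (punchIn i k) (Fin.punchInᵢ≢i i k)) ⟨
        f i ℚ.+ sum (λ k → f (punchIn i k))  ≡⟨ sum-remove {i = i} f ⟨
        sum f                                ≡⟨ Σf≡Σg ⟩
        sum g                                ≡⟨ sum-remove {i = i} g ⟩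
        g i ℚ.+ sum (λ k → g (punchIn i k))  ∎)

      -- The functions ℬ of two progressions differ in the term k = j₀ only.
      Q-j₀≡0 : ∀ X → Q j₀ X ≡ 0ℚ
      Q-j₀≡0 X with progressions 2≤m p∤m J
      ... | P , P′ , κ≢κ′ = *-cancel C≢0 (*-cancel w-w′≢0 (begin
        (w κ ℚ.- w κ′) ℚ.* (C j₀ ℚ.* Q j₀ X)
          ≡⟨ solve 4 (λ a b c q → (a :- b) :* (c :* q) := (a :* c) :* q :- (b :* c) :* q)
               ≡.refl (w κ) (w κ′) (C j₀) (Q j₀ X) ⟩
        (w κ ℚ.* C j₀) ℚ.* Q j₀ X ℚ.- (w κ′ ℚ.* C j₀) ℚ.* Q j₀ X
          ≡⟨ ≡.cong (ℚ._- (w κ′ ℚ.* C j₀) ℚ.* Q j₀ X) equal-terms ⟩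
        (w κ′ ℚ.* C j₀) ℚ.* Q j₀ X ℚ.- (w κ′ ℚ.* C j₀) ℚ.* Q j₀ X
          ≡⟨ ℚ.+-inverseʳ ((w κ′ ℚ.* C j₀) ℚ.* Q j₀ X) ⟩
        0ℚ ∎))
        where
        κ κ′ : ℕ
        κ  = Progression.exponent P
        κ′ = Progression.exponent P′

        C≢0 : C j₀ ≢ 0ℚ
        C≢0 = ⌜⌝≢0 (m ℕ.^ (J ℕ.+ j₀ ℕ.∸ j₀)) {{ℕ.m^n≢0 m (J ℕ.+ j₀ ℕ.∸ j₀) {{ℕ.>-nonZero (ℕ.<-trans (s≤s z≤n) 2≤m)}}}}

        w-w′≢0 : w κ ℚ.- w κ′ ≢ 0ℚ
        w-w′≢0 w-w′≡0 = w-injective κ≢κ′ (RingProperties.x∙y⁻¹≈ε⇒x≈y ℚ.+-*-ring (w κ) (w κ′) w-w′≡0)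

        f : ℕ → ℕ → ℚ
        f κ k = (w (v κ k) ℚ.* C k) ℚ.* Q k (X ℚ.+ δ k)

        f-j₀ : ∀ κ → f κ j₀ ≡ (w κ ℚ.* C j₀) ℚ.* Q j₀ X
        f-j₀ κ = ≡.cong₂ (λ u Y → (w u ℚ.* C j₀) ℚ.* Q j₀ Y) (v-j₀ κ)
          (≡.trans (≡.cong (X ℚ.+_) (ℚ.+-inverseʳ ⌜ j₀ ⌝)) (ℚ.+-identityʳ X))

        i₀ : Fin J
        i₀ = fromℕ< j₀<J

        f-i₀ : f κ (toℕ i₀) ≡ f κ′ (toℕ i₀)
        f-i₀ = sum-cancel i₀ (f κ ∘ toℕ) (f κ′ ∘ toℕ)
          (λ k k≢i₀ → ≡.cong (λ u → (w u ℚ.* C (toℕ k)) ℚ.* Q (toℕ k) (X ℚ.+ δ (toℕ k)))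
            (v-≢j₀ κ κ′ λ k≡j₀ → k≢i₀ (Fin.toℕ-injective (≡.trans k≡j₀ (≡.sym (Fin.toℕ-fromℕ< j₀<J))))))
          (≡.trans (ℬ≡0 P X) (≡.sym (ℬ≡0 P′ X)))

        equal-terms : (w κ ℚ.* C j₀) ℚ.* Q j₀ X ≡ (w κ′ ℚ.* C j₀) ℚ.* Q j₀ X
        equal-terms = ≡.trans (≡.sym (f-j₀ κ)) (≡.trans
          (≡.subst (λ k → f κ k ≡ f κ′ k) (Fin.toℕ-fromℕ< j₀<J) f-i₀) (f-j₀ κ′))

    independent : (∀ i → Finite (c i)) →
      SemiringSum.sum (DifferentialDomain.semiring ℚ⟦t⟧) (λ i → c i ⊠ fold F θ (toℕ i)) ≋ 𝟘 → ∀ i → c i ≋ 𝟘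
    independent Fc Σ≋0 i j = coefficients-vanish (λ i → c i j)
      -- The common bound J may fail to exceed j; enlarging it preserves the vanishing beyond it and
      -- secures the inequality required of j₀.
      (Q-j₀≡0 {J ℕ.⊔ suc j} (λ i k J⊔≤k → c≡0 i k (ℕ.m⊔n≤o⇒m≤o J (suc j) J⊔≤k)) j (ℕ.m≤n⊔m J (suc j)) Σ≋0) i
      where
      J   = proj₁ (common-bound c Fc)
      c≡0 = proj₂ (common-bound c Fc)

-- The zeta functions

module ZetaFunction {c ℓ} {p : ℕ} (prime : Prime p) (K : AlgebraicClosure (𝔽 p) c ℓ) where
  open AlgebraicClosure K using (algebraicallyClosedField; DegreeAtLeast; X^_; IsPolyIn-X^; _≈_; 0#)
  open ArtinMazur algebraicallyClosedField
  open Counting algebraicallyClosedField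
  open Characteristic p prime (AlgebraicClosureCharacteristic.p·1≈0 K)
  open Valuation p prime using (val; unit; M≡p^val*unit; suc-M; p∤unit)
  open RationalSeries
  open SemiringMult (CommutativeRing.semiring ℚ.+-*-commutativeRing) using () renaming (_×_ to _·_)

  ·-/suc : ∀ n a → suc n · (+ a ℚ./ suc n) ≡ a · 1ℚ
  ·-/suc n a = ≡.trans (·-/-cancel n (+ a) 1 (suc n) (≡.sym (ℕ.*-identityʳ (suc n)))) (/1≡·1 a)

  -- A copy of the series that is local to the definition of ζ: its exponential
  -- is definitionally equal to that of the original.
  logζ : ∀ f → DegreeAtLeast 2 f → PowerSeries
  logζ f f° zero    = 0ℚ
  logζ f f° (suc n) = + fixedPointCount f f° n ℚ./ suc n

  -- Vanishing of f′ covers the polynomials in x^p and, through the derivative m x^(m-1), also the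
  -- powers x^m with p ∣ m, which then need not be rewritten as compositions with x^p.
  rational-inseparable : ∀ f f° → (∀ x → deriv f x ≈ 0#) → Rational (ζ f f°)
  rational-inseparable f f° f′≈0 = RationalExponential.exp-geometric-rational (proj₁ f°) (logζ f f°) ≡.refl λ n →
    ≡.trans (·-/suc n (fixedPointCount f f° n)) (≡.cong (_· 1ℚ) (fixedPointCount-inseparable f f° f′≈0 n))

  fixedPointCount-power : ∀ {m} (m≥2 : 2 ≤ m) (p∤m : p ∤ m) n →
    fixedPointCount (X^ m) (X^-degree m m≥2) n ≡ suc (unit m≥2 p∤m (suc n))
  fixedPointCount-power {m} m≥2 p∤m n = fixedPointCount-X^ m m≥2 n (val m≥2 p∤m (suc n)) (unit m≥2 p∤m (suc n))
    (≡.trans (≡.sym (suc-M m≥2 p∤m (suc n))) (≡.cong suc (M≡p^val*unit m≥2 p∤m (suc n))))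
    (p∤unit m≥2 p∤m (s≤s z≤n))

  transcendental-power : ∀ {m} (m≥2 : 2 ≤ m) → p ∤ m → Transcendental (ζ (X^ m) (X^-degree m m≥2))
  transcendental-power {m} m≥2 p∤m algebraic =
    -- The series F is θ s, the quotient of θζ by ζ = exp s; ζ is nonzero because its constant term
    -- is 1.
    ClearDenominators.algebraic⇒dependent (exp s) (θ s) (λ exp≋0 → contradiction (exp≋0 0) λ ())
      (λ n → ≡.sym (θ-exp′ {s} ≡.refl n)) algebraic
      λ (n , d , Fd , (i , d≢0) , Σ≋0) →
        d≢0 (NoRecurrence.independent prime m≥2 p∤m {θ s} θs d Fd Σ≋0 i)
    where
    s : PowerSeries
    s = logζ (X^ m) (X^-degree m m≥2)

    θs : ∀ n → θ s (suc n) ≡ suc (unit m≥2 p∤m (suc n)) · 1ℚ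
    θs n = ≡.trans (·-/suc n (fixedPointCount (X^ m) (X^-degree m m≥2) n))
      (≡.cong (_· 1ℚ) (fixedPointCount-power m≥2 p∤m n))

theorem1 : ∀ {c ℓ} (p : ℕ) → Prime p → (K : AlgebraicClosure (𝔽 p) c ℓ) →
    let open AlgebraicClosure K
        open ArtinMazur algebraicallyClosedField
    in (∀ f (deg-f≥2 : DegreeAtLeast 2 f) → IsPolyIn-X^ p f → Rational (ζ f deg-f≥2))
     × (∀ m (m≥2 : 2 ≤ m) → p ∣ m → Rational (ζ (X^ m) (X^-degree m m≥2)))
     × (∀ m (m≥2 : 2 ≤ m) → p ∤ m → Transcendental (ζ (X^ m) (X^-degree m m≥2)))
theorem1 p p-prime K =
    (λ f deg-f≥2 f∈K[xᵖ] → rational-inseparable f deg-f≥2 (deriv-IsPolyIn-X^ f f∈K[xᵖ]))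
  , (λ m m≥2 p∣m → rational-inseparable (X^ m) (X^-degree m m≥2) (deriv-X^-p∣ p∣m))
  , (λ m m≥2 p∤m → transcendental-power m≥2 p∤m)
  where
  open AlgebraicClosure K using (algebraicallyClosedField; X^_)
  open ArtinMazur algebraicallyClosedField
  open ZetaFunction p-prime K
  open Counting algebraicallyClosedField using (module Characteristic)
  open Characteristic p p-prime (AlgebraicClosureCharacteristic.p·1≈0 K)
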